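{- The following identities hold: $$ {}_4F_3\left(1,1,1,\tfrac{3}{2};\tfrac{5}{2},\tfrac{5}{2},\tfrac{5}{2};1\right)=27\sum_{n\geq 0}\frac{16^n}{(2n+3)^3 (2n+1)^2 \binom{2n}{n}^2}=\frac{27}{2}\left(7\,\zeta(3)+(3-2G)\,\pi-12\right), $$ where $\zeta(3)=\sum_{n\geq 1}\frac{1}{n^3}$ and $G=\sum_{n\geq 0}\frac{(-1)^n}{(2n+1)^2}$ is Catalan's constant.
   Context: The hypergeometric function is defined by the series ${}_4F_3(a,b,c,d;e,f,g;z)=\sum_{n\geq 0}\frac{(a)_n(b)_n(c)_n(d)_n}{n!\,(e)_n(f)_n(g)_n}\,z^n$, where $(a)_n=\frac{\Gamma(a+n)}{\Gamma(a)}$ is the rising factorial (Pochhammer symbol). -}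

module Defs where

import Algebra.Definitions.RawSemiring as RawSemiringDefinitions
import Data.Integer as ℤ
open import Data.Integer using (+_)
open import Data.List using (length; filter; cartesianProduct; upTo)
import Data.Nat as ℕ
open import Data.Nat using (ℕ; zero; suc; _!)
open import Data.Nat.Combinatorics using (_C_; nCn≡1; nCk+nC[k+1]≡[n+1]C[k+1])
import Data.Nat.Properties as ℕₚ
open import Data.Product using (∃-syntax; _×_; _,_)
import Data.Rational as ℚ
open import Data.Rational using (ℚ; 0ℚ; 1ℚ; ½)
import Data.Rational.Properties as ℚₚ
open import Data.Rational.Solver using (module +-*-Solver)
open import Relation.Binary.PropositionalEquality
  using (_≡_; _≢_; refl; sym; trans; cong; subst; module ≡-Reasoning)

open RawSemiringDefinitions ℚ.+-*-rawSemiring using () renaming (_^_ to _^ℚ_)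

-- Real numbers are Cauchy sequences of rationals.  There are no quotient types, so
-- equality of reals is the relation _≃_ below.

IsCauchy : (ℕ → ℚ) → Set
IsCauchy x = ∀ ε → 0ℚ ℚ.< ε →
  ∃[ N ] (∀ m n → N ℕ.≤ m → N ℕ.≤ n → ℚ.∣ x m ℚ.- x n ∣ ℚ.≤ ε)

record ℝ : Set where
  constructor mkℝ
  field
    seq    : ℕ → ℚ
    cauchy : IsCauchy seq

open ℝ public

infix 4 _≃_ _≤_

_≃_ : ℝ → ℝ → Set
x ≃ y = ∀ ε → 0ℚ ℚ.< ε →
  ∃[ N ] (∀ n → N ℕ.≤ n → ℚ.∣ seq x n ℚ.- seq y n ∣ ℚ.≤ ε)

_≤_ : ℝ → ℝ → Set
x ≤ y = ∀ ε → 0ℚ ℚ.< ε →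
  ∃[ N ] (∀ n → N ℕ.≤ n → seq x n ℚ.≤ seq y n ℚ.+ ε)

private
  0<½ε : ∀ {ε} → 0ℚ ℚ.< ε → 0ℚ ℚ.< ½ ℚ.* ε
  0<½ε {ε} 0<ε = subst (ℚ._< ½ ℚ.* ε) (ℚₚ.*-zeroʳ ½) (ℚₚ.*-monoʳ-<-pos ½ 0<ε)

  ½ε+½ε : ∀ ε → ½ ℚ.* ε ℚ.+ ½ ℚ.* ε ≡ ε
  ½ε+½ε ε = trans (sym (ℚₚ.*-distribʳ-+ ε ½ ½)) (ℚₚ.*-identityˡ ε)

  ⊔≤⇒ˡ : ∀ {m n o} → m ℕ.⊔ n ℕ.≤ o → m ℕ.≤ o
  ⊔≤⇒ˡ {m} {n} = ℕₚ.≤-trans (ℕₚ.m≤m⊔n m n)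

  ⊔≤⇒ʳ : ∀ {m n o} → m ℕ.⊔ n ℕ.≤ o → n ℕ.≤ o
  ⊔≤⇒ʳ {m} {n} = ℕₚ.≤-trans (ℕₚ.m≤n⊔m m n)

  +-cauchy : ∀ {x y} → IsCauchy x → IsCauchy y → IsCauchy (λ n → x n ℚ.+ y n)
  +-cauchy {x} {y} cx cy ε 0<ε =
    let (M , p) = cx (½ ℚ.* ε) (0<½ε 0<ε)
        (N , q) = cy (½ ℚ.* ε) (0<½ε 0<ε)
    in M ℕ.⊔ N , λ m n h k → begin
      ℚ.∣ (x m ℚ.+ y m) ℚ.- (x n ℚ.+ y n) ∣    ≡⟨ cong ℚ.∣_∣ (rearrange (x m) (y m) (x n) (y n)) ⟩
      ℚ.∣ (x m ℚ.- x n) ℚ.+ (y m ℚ.- y n) ∣    ≤⟨ ℚₚ.∣p+q∣≤∣p∣+∣q∣ (x m ℚ.- x n) (y m ℚ.- y n) ⟩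
      ℚ.∣ x m ℚ.- x n ∣ ℚ.+ ℚ.∣ y m ℚ.- y n ∣  ≤⟨ ℚₚ.+-mono-≤ (p m n (⊔≤⇒ˡ h) (⊔≤⇒ˡ k)) (q m n (⊔≤⇒ʳ h) (⊔≤⇒ʳ k)) ⟩
      ½ ℚ.* ε ℚ.+ ½ ℚ.* ε                      ≡⟨ ½ε+½ε ε ⟩
      ε                                        ∎
    where
    open ℚₚ.≤-Reasoning
    rearrange : ∀ a b c d → (a ℚ.+ b) ℚ.- (c ℚ.+ d) ≡ (a ℚ.- c) ℚ.+ (b ℚ.- d)
    rearrange = solve 4 (λ a b c d →
        (a :+ b) :+ (:- (c :+ d)) := (a :+ (:- c)) :+ (b :+ (:- d))) refl
      where open +-*-Solver

  neg-cauchy : ∀ {x} → IsCauchy x → IsCauchy (λ n → ℚ.- x n)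
  neg-cauchy {x} cx ε 0<ε =
    let (N , p) = cx ε 0<ε
    in N , λ m n h k → subst (ℚ._≤ ε) (sym (same (x m) (x n))) (p m n h k)
    where
    same : ∀ a b → ℚ.∣ (ℚ.- a) ℚ.- (ℚ.- b) ∣ ≡ ℚ.∣ a ℚ.- b ∣
    same a b = trans (cong ℚ.∣_∣ (sym (ℚₚ.neg-distrib-+ a (ℚ.- b)))) (ℚₚ.∣-p∣≡∣p∣ (a ℚ.- b))

  bounded : ∀ {x} → IsCauchy x →
    ∃[ B ] (0ℚ ℚ.< B × ∃[ N ] (∀ n → N ℕ.≤ n → ℚ.∣ x n ∣ ℚ.≤ B))
  bounded {x} cx =
    let (N , p) = cx 1ℚ (ℚₚ.positive⁻¹ 1ℚ)
    in ℚ.∣ x N ∣ ℚ.+ 1ℚ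
     , ℚₚ.+-mono-≤-< (ℚₚ.0≤∣p∣ (x N)) (ℚₚ.positive⁻¹ 1ℚ)
     , N
     , λ n h → begin
         ℚ.∣ x n ∣                          ≡⟨ cong ℚ.∣_∣ (split (x n) (x N)) ⟩
         ℚ.∣ x N ℚ.+ (x n ℚ.- x N) ∣        ≤⟨ ℚₚ.∣p+q∣≤∣p∣+∣q∣ (x N) (x n ℚ.- x N) ⟩
         ℚ.∣ x N ∣ ℚ.+ ℚ.∣ x n ℚ.- x N ∣    ≤⟨ ℚₚ.+-monoʳ-≤ ℚ.∣ x N ∣ (p n N h ℕₚ.≤-refl) ⟩
         ℚ.∣ x N ∣ ℚ.+ 1ℚ                   ∎
    where
    open ℚₚ.≤-Reasoning
    split : ∀ a b → a ≡ b ℚ.+ (a ℚ.- b)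
    split = solve 2 (λ a b → a := b :+ (a :+ (:- b))) refl
      where open +-*-Solver

  -- a product is at most ε as soon as |q| is at most ε / B, where B bounds |p|
  rescale : ∀ B ε → 0ℚ ℚ.< B → 0ℚ ℚ.< ε →
    ∃[ δ ] (0ℚ ℚ.< δ × (∀ p q → ℚ.∣ p ∣ ℚ.≤ B → ℚ.∣ q ∣ ℚ.≤ δ → ℚ.∣ p ℚ.* q ∣ ℚ.≤ ε))
  rescale B ε 0<B 0<ε = δ , 0<δ , λ p q hp hq → begin
      ℚ.∣ p ℚ.* q ∣          ≡⟨ ℚₚ.∣p*q∣≡∣p∣*∣q∣ p q ⟩
      ℚ.∣ p ∣ ℚ.* ℚ.∣ q ∣    ≤⟨ ℚₚ.*-monoʳ-≤-nonNeg ℚ.∣ q ∣ {{ℚₚ.∣-∣-nonNeg q}} hp ⟩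
      B ℚ.* ℚ.∣ q ∣          ≤⟨ ℚₚ.*-monoˡ-≤-nonNeg B {{ℚₚ.pos⇒nonNeg B}} hq ⟩
      B ℚ.* (ℚ.1/ B ℚ.* ε)   ≡⟨ sym (ℚₚ.*-assoc B (ℚ.1/ B) ε) ⟩
      B ℚ.* ℚ.1/ B ℚ.* ε     ≡⟨ cong (ℚ._* ε) (ℚₚ.*-inverseʳ B) ⟩
      1ℚ ℚ.* ε               ≡⟨ ℚₚ.*-identityˡ ε ⟩
      ε                      ∎
    where
    open ℚₚ.≤-Reasoning
    instance
      B⁺ : ℚ.Positive B
      B⁺ = ℚ.positive 0<B
      B≢0 : ℚ.NonZero B
      B≢0 = ℚₚ.pos⇒nonZero B
    δ : ℚ
    δ = ℚ.1/ B ℚ.* ε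
    0<δ : 0ℚ ℚ.< δ
    0<δ = subst (ℚ._< δ) (ℚₚ.*-zeroʳ (ℚ.1/ B))
                (ℚₚ.*-monoʳ-<-pos (ℚ.1/ B) {{ℚₚ.1/pos⇒pos B}} 0<ε)

  *-cauchy : ∀ {x y} → IsCauchy x → IsCauchy y → IsCauchy (λ n → x n ℚ.* y n)
  *-cauchy {x} {y} cx cy ε 0<ε =
    let (A , 0<A , K , a)  = bounded cx
        (B , 0<B , L , b)  = bounded cy
        (δ , 0<δ , scaleA) = rescale A (½ ℚ.* ε) 0<A (0<½ε 0<ε)
        (η , 0<η , scaleB) = rescale B (½ ℚ.* ε) 0<B (0<½ε 0<ε)
        (M , p)            = cx η 0<η
        (N , q)            = cy δ 0<δ
    in (K ℕ.⊔ L) ℕ.⊔ (M ℕ.⊔ N) , λ m n h k → begin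
      ℚ.∣ x m ℚ.* y m ℚ.- x n ℚ.* y n ∣
        ≡⟨ cong ℚ.∣_∣ (rearrange (x m) (y m) (x n) (y n)) ⟩
      ℚ.∣ x m ℚ.* (y m ℚ.- y n) ℚ.+ y n ℚ.* (x m ℚ.- x n) ∣
        ≤⟨ ℚₚ.∣p+q∣≤∣p∣+∣q∣ (x m ℚ.* (y m ℚ.- y n)) (y n ℚ.* (x m ℚ.- x n)) ⟩
      ℚ.∣ x m ℚ.* (y m ℚ.- y n) ∣ ℚ.+ ℚ.∣ y n ℚ.* (x m ℚ.- x n) ∣
        ≤⟨ ℚₚ.+-mono-≤
             (scaleA (x m) (y m ℚ.- y n) (a m (⊔≤⇒ˡ (⊔≤⇒ˡ h)))
                     (q m n (⊔≤⇒ʳ {M} (⊔≤⇒ʳ {K ℕ.⊔ L} h)) (⊔≤⇒ʳ {M} (⊔≤⇒ʳ {K ℕ.⊔ L} k))))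
             (scaleB (y n) (x m ℚ.- x n) (b n (⊔≤⇒ʳ {K} (⊔≤⇒ˡ k)))
                     (p m n (⊔≤⇒ˡ (⊔≤⇒ʳ {K ℕ.⊔ L} h)) (⊔≤⇒ˡ (⊔≤⇒ʳ {K ℕ.⊔ L} k)))) ⟩
      ½ ℚ.* ε ℚ.+ ½ ℚ.* ε
        ≡⟨ ½ε+½ε ε ⟩
      ε ∎
    where
    open ℚₚ.≤-Reasoning
    rearrange : ∀ a b c d →
      a ℚ.* b ℚ.- c ℚ.* d ≡ a ℚ.* (b ℚ.- d) ℚ.+ d ℚ.* (a ℚ.- c)
    rearrange = solve 4 (λ a b c d →
        a :* b :+ (:- (c :* d)) := a :* (b :+ (:- d)) :+ d :* (a :+ (:- c))) refl
      where open +-*-Solver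

  const-cauchy : ∀ q → IsCauchy (λ _ → q)
  const-cauchy q ε 0<ε = 0 , λ _ _ _ _ →
    subst (ℚ._≤ ε) (sym (cong ℚ.∣_∣ (ℚₚ.+-inverseʳ q))) (ℚₚ.<⇒≤ 0<ε)

infix  8 -_
infixl 7 _*_
infixl 6 _+_ _-_

ι : ℚ → ℝ
ι q = mkℝ (λ _ → q) (const-cauchy q)

_+_ : ℝ → ℝ → ℝ
x + y = mkℝ (λ n → seq x n ℚ.+ seq y n) (+-cauchy {seq x} {seq y} (cauchy x) (cauchy y))

-_ : ℝ → ℝ
- x = mkℝ (λ n → ℚ.- seq x n) (neg-cauchy {seq x} (cauchy x))

_-_ : ℝ → ℝ → ℝ
x - y = x + (- y)

_*_ : ℝ → ℝ → ℝ
x * y = mkℝ (λ n → seq x n ℚ.* seq y n) (*-cauchy {seq x} {seq y} (cauchy x) (cauchy y))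

infix 4 _⟶_

_⟶_ : (ℕ → ℝ) → ℝ → Set
s ⟶ x = ∀ ε → 0ℚ ℚ.< ε →
  ∃[ N ] (∀ n → N ℕ.≤ n → (x - ι ε ≤ s n) × (s n ≤ x + ι ε))

partialSum : (ℕ → ℝ) → ℕ → ℝ
partialSum a zero    = ι 0ℚ
partialSum a (suc n) = partialSum a n + a n

HasSum : (ℕ → ℝ) → ℝ → Set
HasSum a x = partialSum a ⟶ x

-- (a)ₙ = a (a + 1) ⋯ (a + n − 1), which is Γ(a + n) / Γ(a) by Γ(s + 1) = s Γ(s)
pochhammer : ℚ → ℕ → ℚ
pochhammer a zero    = 1ℚ
pochhammer a (suc n) = pochhammer a n ℚ.* (a ℚ.+ + n ℚ./ 1)

-- e is not one of 0, −1, −2, …, so that (e)ₙ may be divided by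
record LowerParameter (e : ℚ) : Set where
  field
    e+n≢0 : ∀ n → ℚ.NonZero (e ℚ.+ + n ℚ./ 1)

open LowerParameter {{...}}

private
  p*q≢0 : ∀ p q .{{_ : ℚ.NonZero p}} .{{_ : ℚ.NonZero q}} → ℚ.NonZero (p ℚ.* q)
  p*q≢0 p q = ℚ.≢-nonZero λ pq≡0 → ℚ≢0 q (begin
      q                        ≡⟨ sym (ℚₚ.*-identityˡ q) ⟩
      1ℚ ℚ.* q                 ≡⟨ cong (ℚ._* q) (sym (ℚₚ.*-inverseˡ p)) ⟩
      ℚ.1/ p ℚ.* p ℚ.* q       ≡⟨ ℚₚ.*-assoc (ℚ.1/ p) p q ⟩
      ℚ.1/ p ℚ.* (p ℚ.* q)     ≡⟨ cong (ℚ.1/ p ℚ.*_) pq≡0 ⟩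
      ℚ.1/ p ℚ.* 0ℚ            ≡⟨ ℚₚ.*-zeroʳ (ℚ.1/ p) ⟩
      0ℚ                       ∎)
    where
    open ≡-Reasoning
    ℚ≢0 : ∀ r .{{_ : ℚ.NonZero r}} → r ≢ 0ℚ
    ℚ≢0 r@record{} r≡0 = ℕ.≢-nonZero⁻¹ ℤ.∣ ℚ.↥ r ∣ (cong (λ s → ℤ.∣ ℚ.↥ s ∣) r≡0)

  pochhammer≢0 : ∀ e {{_ : LowerParameter e}} n → ℚ.NonZero (pochhammer e n)
  pochhammer≢0 e zero    = _
  pochhammer≢0 e (suc n) =
    p*q≢0 (pochhammer e n) (e ℚ.+ + n ℚ./ 1) {{pochhammer≢0 e n}} {{e+n≢0 n}}

₄F₃-denominator : (e f g : ℚ) → ℕ → ℚ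
₄F₃-denominator e f g n =
  + (n !) ℚ./ 1 ℚ.* (pochhammer e n ℚ.* pochhammer f n ℚ.* pochhammer g n)

₄F₃-denominator≢0 : ∀ e f g
  {{_ : LowerParameter e}} {{_ : LowerParameter f}} {{_ : LowerParameter g}} →
  ∀ n → ℚ.NonZero (₄F₃-denominator e f g n)
₄F₃-denominator≢0 e f g n =
  p*q≢0 (+ (n !) ℚ./ 1) (pochhammer e n ℚ.* pochhammer f n ℚ.* pochhammer g n)
    {{ℚₚ.pos⇒nonZero (+ (n !) ℚ./ 1) {{ℚₚ.normalize-pos (n !) 1 {{_}} {{n ℕₚ.!≢0}}}}}}
    {{p*q≢0 (pochhammer e n ℚ.* pochhammer f n) (pochhammer g n)
      {{p*q≢0 (pochhammer e n) (pochhammer f n) {{pochhammer≢0 e n}} {{pochhammer≢0 f n}}}}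
      {{pochhammer≢0 g n}}}}

₄F₃-term : (a b c d e f g z : ℚ)
  {{_ : LowerParameter e}} {{_ : LowerParameter f}} {{_ : LowerParameter g}} → ℕ → ℚ
₄F₃-term a b c d e f g z n =
  (pochhammer a n ℚ.* pochhammer b n ℚ.* pochhammer c n ℚ.* pochhammer d n
    ℚ.÷ ₄F₃-denominator e f g n) {{₄F₃-denominator≢0 e f g n}}
  ℚ.* (z ^ℚ n)

-- ₄F₃(a,b,c,d; e,f,g; z) = x: the defining series converges, with sum x
Is₄F₃ : (a b c d e f g z : ℚ)
  {{_ : LowerParameter e}} {{_ : LowerParameter f}} {{_ : LowerParameter g}} → ℝ → Set
Is₄F₃ a b c d e f g z = HasSum (λ n → ι (₄F₃-term a b c d e f g z n))

instance
  5/2-lower : LowerParameter (+ 5 ℚ./ 2)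
  5/2-lower = record { e+n≢0 = λ n →
    ℚₚ.pos⇒nonZero (+ 5 ℚ./ 2 ℚ.+ + n ℚ./ 1)
      {{ℚₚ.pos+nonNeg⇒pos (+ 5 ℚ./ 2) (+ n ℚ./ 1) {{ℚₚ.normalize-nonNeg n 1}}}} }

centralDenominator : ℕ → ℕ
centralDenominator n =
  (3 ℕ.+ 2 ℕ.* n) ℕ.^ 3 ℕ.* (1 ℕ.+ 2 ℕ.* n) ℕ.^ 2 ℕ.* ((2 ℕ.* n) C n) ℕ.^ 2

private
  C≢0 : ∀ {n k} → k ℕ.≤ n → ℕ.NonZero (n C k)
  C≢0 {zero}  {zero}  _         = _
  C≢0 {suc n} {zero}  _         = _
  C≢0 {suc n} {suc k} (ℕ.s≤s h) = subst ℕ.NonZero (nCk+nC[k+1]≡[n+1]C[k+1] n k)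
    (ℕ.>-nonZero (ℕₚ.≤-trans (ℕ.>-nonZero⁻¹ (n C k) {{C≢0 h}}) (ℕₚ.m≤m+n (n C k) (n C suc k))))

centralDenominator≢0 : ∀ n → ℕ.NonZero (centralDenominator n)
centralDenominator≢0 n =
  ℕₚ.m*n≢0 ((3 ℕ.+ 2 ℕ.* n) ℕ.^ 3 ℕ.* (1 ℕ.+ 2 ℕ.* n) ℕ.^ 2) (((2 ℕ.* n) C n) ℕ.^ 2)
    {{ℕₚ.m*n≢0 ((3 ℕ.+ 2 ℕ.* n) ℕ.^ 3) ((1 ℕ.+ 2 ℕ.* n) ℕ.^ 2)
      {{ℕₚ.m^n≢0 (3 ℕ.+ 2 ℕ.* n) 3}} {{ℕₚ.m^n≢0 (1 ℕ.+ 2 ℕ.* n) 2}}}}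
    {{ℕₚ.m^n≢0 ((2 ℕ.* n) C n) 2 {{C≢0 (ℕₚ.m≤m+n n (n ℕ.+ 0))}}}}

centralTerm : ℕ → ℚ
centralTerm n = (+ (16 ℕ.^ n) ℚ./ centralDenominator n) {{centralDenominator≢0 n}}

-- ζ(3) is indexed from n = 1, hence the suc
Isζ3 : ℝ → Set
Isζ3 = HasSum (λ n → ι ((+ 1 ℚ./ suc n ℕ.^ 3) {{ℕₚ.m^n≢0 (suc n) 3}}))

IsCatalan : ℝ → Set
IsCatalan = HasSum (λ n →
  ι ((ℤ.-1ℤ ℤ.^ n ℚ./ (1 ℕ.+ 2 ℕ.* n) ℕ.^ 2) {{ℕₚ.m^n≢0 (1 ℕ.+ 2 ℕ.* n) 2}}))

-- The number of cells [i/n, (i+1)/n] × [j/n, (j+1)/n] with 0 ≤ i, j < n that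
-- lie inside the unit disc, i.e. whose outer corner does.
cellsInQuarterDisc : ℕ → ℕ
cellsInQuarterDisc n =
  length (filter (λ (i , j) → suc i ℕ.^ 2 ℕ.+ suc j ℕ.^ 2 ℕ.≤? n ℕ.^ 2)
                 (cartesianProduct (upTo n) (upTo n)))

-- π is the area of the unit disc: each cell has area 1/n², and the disc
-- consists of four congruent quarters.
Isπ : ℝ → Set
Isπ x = (λ k → ι ((+ (4 ℕ.* cellsInQuarterDisc (suc k)) ℚ./ suc k ℕ.^ 2)
                    {{ℕₚ.m^n≢0 (suc k) 2}})) ⟶ x

{-# OPTIONS --safe #-}
module Submission where

-- Let uₙ = (2n)!!/(2n+1)!!.  Both summands are multiples of uₙ²/(2n+3)³, and a
-- telescoping part u_N²(6N+5) reduces their sum to X_N = Σ uₙ²/(2n+1).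
-- A finite identity rewrites X_N as an average of the partial sums of
-- 2 Σ (−1)ᵏ⁻¹ O_k/k with O_k = Σ_{j<k} 1/(2j+1)².  Up to O(1/N), such a partial sum is
-- the sum of 4 χ(a) χ(c)/(a²(a − c)) over odd a ≠ c below 2N, where χ alternates in
-- sign; symmetrising in a and c turns it into 4 Σ 1/a³ − 4 (Σ χ(a)/a²)(Σ χ(c)/c),
-- which tends to 7/2 ζ(3) − π G.
--
-- π enters through the Leibniz series, the Wallis product lim n uₙ² = π/4 and the area
-- of the disc.  The first two agree because n uₙ² is an average of Leibniz partial
-- sums.  For the third, put sₖ₊₁ = 1/uₖ and aₖ = sₖ₊₁ − sₖ: as Σ_{k+l=n} aₖ aₗ = 1, the
-- rectangles aₖ × aₗ with k + l < m form a staircase of area m, which is nearly a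
-- quarter disc of radius s_m (Wästlund); it is compared with the grid cells through
-- the overlaps of grid intervals with the intervals [sₖ, sₖ₊₁].

-- The Leibniz series and the Euler sum converge only conditionally, so replacing the weights in an
-- average by their limit 1 cannot rest on domination. It rests on the weights being monotone in the
-- summation index, through Abel's inequality, and this presupposes that the unweighted series is
-- Cauchy. For the Euler sum that is known only from its closed form; hence everything is phrased as
-- asymptotic equality `_≈_` of rational sequences, and convergence is transported along it.
--
-- Both averages use the weights `w n j`, that is C(2n,n+j)/C(2n,n). Their ratios along a row
-- (`w-step`) and between rows (`w-row`) are rational functions, so every finite identity is either
-- an indefinite sum with an explicit antidifference or a first-order recurrence in `n`, and is
-- checked by ring arithmetic.
--
-- As π is defined by counting lattice cells, its link to the Leibniz series must also be finite.
-- The Wallis numbers provide it: the reciprocals of `u` are at the same time the coordinates of the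
-- staircase.

import Algebra.Definitions.RawSemiring as RawSemiringDefinitions
import Data.Integer as ℤ
import Data.Integer.Properties as ℤₚ
open import Data.List as List using (List; []; _∷_; _++_; length; filter; cartesianProduct; upTo; applyUpTo)
open import Data.Nat as ℕ using (ℕ; zero; suc; _!)
open import Data.Nat.DivMod using (m/n*n≡m)
import Data.Nat.Properties as ℕₚ
open import Data.Product using (∃-syntax; _×_; _,_; proj₁; proj₂)
import Data.Rational.Unnormalised as ℚᵘ
import Data.Rational.Unnormalised.Properties as ℚᵘₚ
open import Data.Sum using (_⊎_; inj₁; inj₂)
import Defs as R
open R using (IsCauchy; pochhammer; cellsInQuarterDisc; centralTerm; centralDenominator; centralDenominator≢0)
open import Relation.Binary.PropositionalEquality
  using (_≡_; refl; sym; trans; cong; cong₂; subst; subst₂; module ≡-Reasoning)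
open import Relation.Nullary using (Dec; yes; no; ¬_; contradiction)
open import Relation.Unary using (Pred; Decidable)

-- Ordered-field arithmetic, reciprocals and natural numbers in ℚ

module RationalLemmas where

  open import Data.Rational
  open import Data.Rational.Properties
  open import Data.Rational.Solver using (module +-*-Solver)
  open +-*-Solver

  2ℚ 3ℚ 4ℚ 5ℚ 6ℚ 7ℚ 8ℚ : ℚ
  2ℚ = ℤ.+ 2 / 1
  3ℚ = ℤ.+ 3 / 1
  4ℚ = ℤ.+ 4 / 1
  5ℚ = ℤ.+ 5 / 1
  6ℚ = ℤ.+ 6 / 1
  7ℚ = ℤ.+ 7 / 1
  8ℚ = ℤ.+ 8 / 1

  p-q≡0⇒p≡q : ∀ {p q} → p - q ≡ 0ℚ → p ≡ q
  p-q≡0⇒p≡q {p} {q} h =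
    trans (solve 2 (λ p q → p := (p :- q) :+ q) refl p q) (trans (cong (_+ q) h) (+-identityˡ q))

  p≡q⇒p-q≡0 : ∀ {p q} → p ≡ q → p - q ≡ 0ℚ
  p≡q⇒p-q≡0 {p} refl = +-inverseʳ p

  -- An equation follows from others once its defect is exhibited as a
  -- linear combination of theirs.
  linear₁ : ∀ {a b p q} k → a - b ≡ k * (p - q) → p ≡ q → a ≡ b
  linear₁ {p = p} k h refl = p-q≡0⇒p≡q (trans h (trans (cong (k *_) (+-inverseʳ p)) (*-zeroʳ k)))

  linear₂ : ∀ {a b p q r s} k l → a - b ≡ k * (p - q) + l * (r - s) → p ≡ q → r ≡ s → a ≡ b
  linear₂ {p = p} {r = r} k l h refl refl = linear₁ {p = p} k
    (trans h (trans (cong (k * (p - p) +_) (trans (cong (l *_) (+-inverseʳ r)) (*-zeroʳ l)))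
                    (+-identityʳ (k * (p - p))))) refl

  linear₃ : ∀ {a b p q r s t u} k l m →
    a - b ≡ k * (p - q) + l * (r - s) + m * (t - u) → p ≡ q → r ≡ s → t ≡ u → a ≡ b
  linear₃ {p = p} {r = r} {t = t} k l m h refl refl refl = linear₂ {p = p} {r = r} k l
    (trans h (trans (cong (k * (p - p) + l * (r - r) +_)
                          (trans (cong (m *_) (+-inverseʳ t)) (*-zeroʳ m)))
                    (+-identityʳ (k * (p - p) + l * (r - r))))) refl refl

  gap⇒≤ : ∀ {a b d} → b - a ≡ d → 0ℚ ≤ d → a ≤ b
  gap⇒≤ {a} {b} refl h = subst₂ _≤_ (+-identityˡ a)
    (solve 2 (λ a b → (b :- a) :+ a := b) refl a b) (+-monoˡ-≤ a h)

  ≤⇒0≤gap : ∀ {a b} → a ≤ b → 0ℚ ≤ b - a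
  ≤⇒0≤gap {a} {b} h = subst (_≤ b - a) (+-inverseʳ a) (+-monoˡ-≤ (- a) h)

  0<1 : 0ℚ < 1ℚ
  0<1 = positive⁻¹ 1ℚ

  0≤1 : 0ℚ ≤ 1ℚ
  0≤1 = <⇒≤ 0<1

  0<2 : 0ℚ < 2ℚ
  0<2 = positive⁻¹ 2ℚ

  0≤2 : 0ℚ ≤ 2ℚ
  0≤2 = <⇒≤ 0<2

  0≤+ : ∀ {p q} → 0ℚ ≤ p → 0ℚ ≤ q → 0ℚ ≤ p + q
  0≤+ = +-mono-≤

  0<+ : ∀ {p q} → 0ℚ ≤ p → 0ℚ < q → 0ℚ < p + q
  0<+ = +-mono-≤-<

  0≤* : ∀ {p q} → 0ℚ ≤ p → 0ℚ ≤ q → 0ℚ ≤ p * q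
  0≤* {p} {q} hp hq = subst (_≤ p * q) (*-zeroˡ q) (*-monoʳ-≤-nonNeg q {{nonNegative hq}} hp)

  0<* : ∀ {p q} → 0ℚ < p → 0ℚ < q → 0ℚ < p * q
  0<* {p} {q} hp hq = subst (_< p * q) (*-zeroˡ q) (*-monoˡ-<-pos q {{positive hq}} hp)

  *-monoˡ : ∀ {p q r} → 0ℚ ≤ r → p ≤ q → r * p ≤ r * q
  *-monoˡ {r = r} h = *-monoˡ-≤-nonNeg r {{nonNegative h}}

  *-monoʳ : ∀ {p q r} → 0ℚ ≤ r → p ≤ q → p * r ≤ q * r
  *-monoʳ {r = r} h = *-monoʳ-≤-nonNeg r {{nonNegative h}}

  *-mono : ∀ {p q r s} → 0ℚ ≤ p → 0ℚ ≤ s → p ≤ q → r ≤ s → p * r ≤ q * s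
  *-mono hp hs h k = ≤-trans (*-monoˡ hp k) (*-monoʳ hs h)

  square-mono : ∀ {p q} → 0ℚ ≤ p → p ≤ q → p * p ≤ q * q
  square-mono hp h = *-mono hp (≤-trans hp h) h h

  0≤square : ∀ p → 0ℚ ≤ p * p
  0≤square p with ≤-total 0ℚ p
  ... | inj₁ h = 0≤* h h
  ... | inj₂ h = subst (0ℚ ≤_) (solve 1 (λ p → (:- p) :* (:- p) := p :* p) refl p) (0≤* h′ h′)
    where
    h′ : 0ℚ ≤ - p
    h′ = neg-antimono-≤ h

  *-cancelˡ-≡ : ∀ {p q} r → 0ℚ < r → r * p ≡ r * q → p ≡ q
  *-cancelˡ-≡ {p} {q} r h e = ≤-antisym
    (*-cancelˡ-≤-pos r {{positive h}} (≤-reflexive e))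
    (*-cancelˡ-≤-pos r {{positive h}} (≤-reflexive (sym e)))

  *-cancelˡ-≤ : ∀ {p q} r → 0ℚ < r → r * p ≤ r * q → p ≤ q
  *-cancelˡ-≤ r h = *-cancelˡ-≤-pos r {{positive h}}

  infix 9 _⁻¹

  -- A total reciprocal needs no nonzero instance, so it can stand under a sum and enter the ring
  -- solver as an unknown. Being opaque, it is governed outside only by the two facts proved here
  -- for positive arguments.
  abstract
    -- 0⁻¹ = 0
    _⁻¹ : ℚ → ℚ
    p ⁻¹ with p ≟ 0ℚ
    ... | yes _   = 0ℚ
    ... | no p≢0 = (1/ p) {{≢-nonZero p≢0}}

    p*p⁻¹ : ∀ {p} → 0ℚ < p → p * p ⁻¹ ≡ 1ℚ
    p*p⁻¹ {p} 0<p with p ≟ 0ℚ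
    ... | yes p≡0 = contradiction (sym p≡0) (<⇒≢ 0<p)
    ... | no p≢0  = *-inverseʳ p {{≢-nonZero p≢0}}

    0<p⁻¹ : ∀ {p} → 0ℚ < p → 0ℚ < p ⁻¹
    0<p⁻¹ {p} 0<p with p ≟ 0ℚ
    ... | yes p≡0 = contradiction (sym p≡0) (<⇒≢ 0<p)
    ... | no p≢0  = positive⁻¹ ((1/ p) {{pos⇒nonZero p {{positive 0<p}}}}) {{1/pos⇒pos p {{positive 0<p}}}}

  ⁻¹-unique : ∀ {p q} → 0ℚ < p → p * q ≡ 1ℚ → q ≡ p ⁻¹
  ⁻¹-unique {p} {q} 0<p e = *-cancelˡ-≡ p 0<p (trans e (sym (p*p⁻¹ 0<p)))

  ⁻¹-anti : ∀ {p q} → 0ℚ < p → p ≤ q → q ⁻¹ ≤ p ⁻¹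
  ⁻¹-anti {p} {q} 0<p p≤q = gap⇒≤
    (linear₂ (q ⁻¹) (- p ⁻¹) (solve 4 (λ p q i j →
        (i :- j) :- i :* j :* (q :- p) := j :* (p :* i :- con 1ℚ) :+ (:- i) :* (q :* j :- con 1ℚ))
        refl p q (p ⁻¹) (q ⁻¹))
      (p*p⁻¹ 0<p) (p*p⁻¹ 0<q))
    (0≤* (0≤* (<⇒≤ (0<p⁻¹ 0<p)) (<⇒≤ (0<p⁻¹ 0<q))) (≤⇒0≤gap p≤q))
    where
    0<q : 0ℚ < q
    0<q = <-≤-trans 0<p p≤q

  ∣p∣≤⁺ : ∀ {p q} → p ≤ q → - p ≤ q → ∣ p ∣ ≤ q
  ∣p∣≤⁺ {p} {q} h k with ∣p∣≡p∨∣p∣≡-p p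
  ... | inj₁ e = subst (_≤ q) (sym e) h
  ... | inj₂ e = subst (_≤ q) (sym e) k

  p≤∣p∣ : ∀ p → p ≤ ∣ p ∣
  p≤∣p∣ p with ≤-total 0ℚ p
  ... | inj₁ h = ≤-reflexive (sym (0≤p⇒∣p∣≡p h))
  ... | inj₂ h = ≤-trans h (0≤∣p∣ p)

  ∣p-q∣≡∣q-p∣ : ∀ p q → ∣ p - q ∣ ≡ ∣ q - p ∣
  ∣p-q∣≡∣q-p∣ p q = trans (cong ∣_∣ (solve 2 (λ p q → p :- q := :- (q :- p)) refl p q)) (∣-p∣≡∣p∣ (q - p))

  ∣p-r∣≤∣p-q∣+∣q-r∣ : ∀ p q r → ∣ p - r ∣ ≤ ∣ p - q ∣ + ∣ q - r ∣
  ∣p-r∣≤∣p-q∣+∣q-r∣ p q r = subst (λ d → ∣ d ∣ ≤ ∣ p - q ∣ + ∣ q - r ∣)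
    (solve 3 (λ p q r → (p :- q) :+ (q :- r) := p :- r) refl p q r) (∣p+q∣≤∣p∣+∣q∣ (p - q) (q - r))

  ∣p*q∣≤∣q∣ : ∀ {p} q → 0ℚ ≤ p → p ≤ 1ℚ → ∣ p * q ∣ ≤ ∣ q ∣
  ∣p*q∣≤∣q∣ {p} q 0≤p p≤1 = subst₂ _≤_
    (sym (trans (∣p*q∣≡∣p∣*∣q∣ p q) (cong (_* ∣ q ∣) (0≤p⇒∣p∣≡p 0≤p)))) (*-identityˡ ∣ q ∣)
    (*-monoʳ (0≤∣p∣ q) p≤1)

  -- Recursive, unlike `+ n / 1`, so that `fromℕ (suc n)` unfolds to `fromℕ n + 1ℚ` and the ring
  -- solver can work with `n` as a variable.
  fromℕ : ℕ → ℚ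
  fromℕ zero    = 0ℚ
  fromℕ (suc n) = fromℕ n + 1ℚ

  0≤fromℕ : ∀ n → 0ℚ ≤ fromℕ n
  0≤fromℕ zero    = ≤-refl
  0≤fromℕ (suc n) = 0≤+ (0≤fromℕ n) 0≤1

  0<1+fromℕ : ∀ n → 0ℚ < fromℕ (suc n)
  0<1+fromℕ n = 0<+ (0≤fromℕ n) 0<1

  fromℕ-mono : ∀ {m n} → m ℕ.≤ n → fromℕ m ≤ fromℕ n
  fromℕ-mono {n = n} ℕ.z≤n = 0≤fromℕ n
  fromℕ-mono (ℕ.s≤s h)     = +-monoˡ-≤ 1ℚ (fromℕ-mono h)

  fromℕ-mono-< : ∀ {m n} → m ℕ.< n → fromℕ m < fromℕ n
  fromℕ-mono-< {m} h = <-≤-trans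
    (subst (_< fromℕ (suc m)) (+-identityʳ (fromℕ m)) (+-monoʳ-< (fromℕ m) 0<1)) (fromℕ-mono h)

  fromℕ-+ : ∀ m n → fromℕ (m ℕ.+ n) ≡ fromℕ m + fromℕ n
  fromℕ-+ zero    n = sym (+-identityˡ (fromℕ n))
  fromℕ-+ (suc m) n = trans (cong (_+ 1ℚ) (fromℕ-+ m n))
    (solve 2 (λ m n → m :+ n :+ con 1ℚ := m :+ con 1ℚ :+ n) refl (fromℕ m) (fromℕ n))

  fromℕ-* : ∀ m n → fromℕ (m ℕ.* n) ≡ fromℕ m * fromℕ n
  fromℕ-* zero    n = sym (*-zeroˡ (fromℕ n))
  fromℕ-* (suc m) n = trans (fromℕ-+ n (m ℕ.* n)) (trans (cong (fromℕ n +_) (fromℕ-* m n))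
    (solve 2 (λ m n → n :+ m :* n := (m :+ con 1ℚ) :* n) refl (fromℕ m) (fromℕ n)))

  fromℕ-^2 : ∀ k → fromℕ (k ℕ.^ 2) ≡ fromℕ k * fromℕ k
  fromℕ-^2 k = trans (fromℕ-* k (k ℕ.* 1)) (cong (λ j → fromℕ k * fromℕ j) (ℕₚ.*-identityʳ k))

  /1-+ : ∀ i j → (i ℤ.+ j) / 1 ≡ i / 1 + j / 1
  /1-+ i j = toℚᵘ-injective (begin
    toℚᵘ ((i ℤ.+ j) / 1)                    ≈⟨ toℚᵘ-fromℚᵘ (ℚᵘ.mkℚᵘ (i ℤ.+ j) 0) ⟩
    ℚᵘ.mkℚᵘ (i ℤ.+ j) 0
      ≈⟨ ℚᵘ.*≡* (cong (ℤ._* ℤ.+ 1) (sym (cong₂ ℤ._+_ (ℤₚ.*-identityʳ i) (ℤₚ.*-identityʳ j)))) ⟩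
    ℚᵘ.mkℚᵘ i 0 ℚᵘ.+ ℚᵘ.mkℚᵘ j 0            ≈⟨ ℚᵘₚ.+-cong (toℚᵘ-fromℚᵘ (ℚᵘ.mkℚᵘ i 0)) (toℚᵘ-fromℚᵘ (ℚᵘ.mkℚᵘ j 0)) ⟨
    toℚᵘ (i / 1) ℚᵘ.+ toℚᵘ (j / 1)          ≈⟨ toℚᵘ-homo-+ (i / 1) (j / 1) ⟨
    toℚᵘ (i / 1 + j / 1)                    ∎)
    where open ℚᵘₚ.≃-Reasoning

  fromℕ≡/1 : ∀ n → fromℕ n ≡ ℤ.+ n / 1
  fromℕ≡/1 zero    = refl
  fromℕ≡/1 (suc n) = trans (cong (_+ 1ℚ) (fromℕ≡/1 n))
    (trans (sym (/1-+ (ℤ.+ n) (ℤ.+ 1))) (cong (λ k → ℤ.+ k / 1) (ℕₚ.+-comm n 1)))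

  [i/d]*d≡i/1 : ∀ i d → (i / suc d) * (ℤ.+ suc d / 1) ≡ i / 1
  [i/d]*d≡i/1 i d = toℚᵘ-injective (begin
    toℚᵘ ((i / suc d) * (ℤ.+ suc d / 1))              ≈⟨ toℚᵘ-homo-* (i / suc d) (ℤ.+ suc d / 1) ⟩
    toℚᵘ (i / suc d) ℚᵘ.* toℚᵘ (ℤ.+ suc d / 1)
      ≈⟨ ℚᵘₚ.*-cong (toℚᵘ-fromℚᵘ (ℚᵘ.mkℚᵘ i d)) (toℚᵘ-fromℚᵘ (ℚᵘ.mkℚᵘ (ℤ.+ suc d) 0)) ⟩
    ℚᵘ.mkℚᵘ i d ℚᵘ.* ℚᵘ.mkℚᵘ (ℤ.+ suc d) 0            ≈⟨ ℚᵘ.*≡* (trans (ℤₚ.*-identityʳ (i ℤ.* ℤ.+ suc d))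
                                                          (cong (λ k → i ℤ.* ℤ.+ suc k) (sym (ℕₚ.*-identityʳ d)))) ⟩
    ℚᵘ.mkℚᵘ i 0                                       ≈⟨ toℚᵘ-fromℚᵘ (ℚᵘ.mkℚᵘ i 0) ⟨
    toℚᵘ (i / 1)                                      ∎)
    where open ℚᵘₚ.≃-Reasoning

  -- `_/_` reduces to lowest terms and is stuck on a variable denominator; this turns the fractions
  -- of the definitions into ring expressions.
  i/d≡i/1*d⁻¹ : ∀ i d .{{_ : ℕ.NonZero d}} → i / d ≡ i / 1 * (fromℕ d) ⁻¹
  i/d≡i/1*d⁻¹ i (suc d) = linear₂ (fromℕ (suc d) ⁻¹) (- (i / suc d))
    (solve 4 (λ p q d e → p :- q :* e := e :* (p :* d :- q) :+ (:- p) :* (d :* e :- con 1ℚ))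
      refl (i / suc d) (i / 1) (fromℕ (suc d)) (fromℕ (suc d) ⁻¹))
    (trans (cong (i / suc d *_) (fromℕ≡/1 (suc d))) ([i/d]*d≡i/1 i d)) (p*p⁻¹ (0<1+fromℕ d))

  -- The absolute value of the numerator serves, the denominator being at least 1.
  archimedean : ∀ p → ∃[ n ] p ≤ fromℕ n
  archimedean p@(mkℚ i d _) = ℤ.∣ i ∣ , subst (p ≤_) (sym (fromℕ≡/1 ℤ.∣ i ∣))
    (toℚᵘ-cancel-≤ (ℚᵘₚ.≤-respʳ-≃ (ℚᵘₚ.≃-sym (toℚᵘ-fromℚᵘ (ℚᵘ.mkℚᵘ (ℤ.+ ℤ.∣ i ∣) 0)))
      (ℚᵘ.*≤* (ℤₚ.≤-trans (ℤₚ.≤-reflexive (ℤₚ.*-identityʳ i)) (bound i)))))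
    where
    bound : ∀ i → i ℤ.≤ ℤ.+ ℤ.∣ i ∣ ℤ.* ℤ.+ suc d
    bound (ℤ.+ n)    = ℤₚ.≤-trans (ℤ.+≤+ (ℕₚ.m≤m*n n (suc d))) (ℤₚ.≤-reflexive (ℤₚ.pos-* n (suc d)))
    bound ℤ.-[1+ n ] = ℤₚ.≤-trans ℤ.-≤+ (ℤₚ.≤-reflexive (ℤₚ.pos-* (suc n) (suc d)))

  abstract
    archimedean-≤ : ∀ C {ε} → 0ℚ < ε → ∃[ N ] (∀ n → N ℕ.≤ n → C * fromℕ (suc n) ⁻¹ ≤ ε)
    archimedean-≤ C {ε} 0<ε with archimedean (C * ε ⁻¹)
    ... | N , h = N , λ n N≤n → *-cancelˡ-≤ (fromℕ (suc n)) (0<1+fromℕ n) (begin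
      fromℕ (suc n) * (C * fromℕ (suc n) ⁻¹)
        ≡⟨ linear₁ C (solve 3 (λ n c i → n :* (c :* i) :- c := c :* (n :* i :- con 1ℚ))
                                                  refl (fromℕ (suc n)) C (fromℕ (suc n) ⁻¹)) (p*p⁻¹ (0<1+fromℕ n)) ⟩
      C
        ≡⟨ linear₁ (- C) (solve 3 (λ e c i → c :- c :* i :* e := (:- c) :* (e :* i :- con 1ℚ))
                                                  refl ε C (ε ⁻¹)) (p*p⁻¹ 0<ε) ⟩
      C * ε ⁻¹ * ε
        ≤⟨ *-monoʳ (<⇒≤ 0<ε) (≤-trans h (fromℕ-mono (ℕₚ.≤-trans N≤n (ℕₚ.n≤1+n n)))) ⟩
      fromℕ (suc n) * ε                       ∎)
      where open ≤-Reasoning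

-- Finite sums of rationals

module Sequences where

  open import Data.Rational
  open import Data.Rational.Properties
  open import Data.Rational.Solver using (module +-*-Solver)
  open +-*-Solver
  open RationalLemmas

  ∑ : ℕ → (ℕ → ℚ) → ℚ
  ∑ zero    f = 0ℚ
  ∑ (suc n) f = ∑ n f + f n

  ∑-cong : ∀ n {f g} → (∀ i → i ℕ.< n → f i ≡ g i) → ∑ n f ≡ ∑ n g
  ∑-cong zero    h = refl
  ∑-cong (suc n) h = cong₂ _+_ (∑-cong n (λ i i<n → h i (ℕₚ.m<n⇒m<1+n i<n))) (h n ℕₚ.≤-refl)

  ∑-mono : ∀ n {f g} → (∀ i → i ℕ.< n → f i ≤ g i) → ∑ n f ≤ ∑ n g
  ∑-mono zero    h = ≤-refl
  ∑-mono (suc n) h = +-mono-≤ (∑-mono n (λ i i<n → h i (ℕₚ.m<n⇒m<1+n i<n))) (h n ℕₚ.≤-refl)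

  ∑-0 : ∀ n → ∑ n (λ _ → 0ℚ) ≡ 0ℚ
  ∑-0 zero    = refl
  ∑-0 (suc n) = trans (+-identityʳ (∑ n (λ _ → 0ℚ))) (∑-0 n)

  0≤∑ : ∀ n {f} → (∀ i → 0ℚ ≤ f i) → 0ℚ ≤ ∑ n f
  0≤∑ zero    h = ≤-refl
  0≤∑ (suc n) h = 0≤+ (0≤∑ n h) (h n)

  ∑-+ : ∀ n f g → ∑ n (λ i → f i + g i) ≡ ∑ n f + ∑ n g
  ∑-+ zero    f g = refl
  ∑-+ (suc n) f g = trans (cong (_+ (f n + g n)) (∑-+ n f g))
    (solve 4 (λ a b c d → a :+ b :+ (c :+ d) := a :+ c :+ (b :+ d)) refl (∑ n f) (∑ n g) (f n) (g n))

  ∑-*ˡ : ∀ n c f → ∑ n (λ i → c * f i) ≡ c * ∑ n f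
  ∑-*ˡ zero    c f = sym (*-zeroʳ c)
  ∑-*ˡ (suc n) c f = trans (cong (_+ c * f n) (∑-*ˡ n c f)) (sym (*-distribˡ-+ c (∑ n f) (f n)))

  ∑-*ʳ : ∀ n c f → ∑ n (λ i → f i * c) ≡ ∑ n f * c
  ∑-*ʳ n c f = trans (∑-cong n (λ i _ → *-comm (f i) c)) (trans (∑-*ˡ n c f) (*-comm c (∑ n f)))

  ∑-- : ∀ n f g → ∑ n (λ i → f i - g i) ≡ ∑ n f - ∑ n g
  ∑-- zero    f g = refl
  ∑-- (suc n) f g = trans (cong (_+ (f n - g n)) (∑-- n f g))
    (solve 4 (λ a b c d → a :- b :+ (c :- d) := a :+ c :- (b :+ d)) refl (∑ n f) (∑ n g) (f n) (g n))

  ∑-head : ∀ n f → ∑ (suc n) f ≡ f 0 + ∑ n (λ i → f (suc i))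
  ∑-head zero    f = +-comm 0ℚ (f 0)
  ∑-head (suc n) f = trans (cong (_+ f (suc n)) (∑-head n f))
    (+-assoc (f 0) (∑ n (λ i → f (suc i))) (f (suc n)))

  ∑-split : ∀ m n f → ∑ (m ℕ.+ n) f ≡ ∑ m f + ∑ n (λ i → f (m ℕ.+ i))
  ∑-split m zero    f = trans (cong (λ k → ∑ k f) (ℕₚ.+-identityʳ m)) (sym (+-identityʳ (∑ m f)))
  ∑-split m (suc n) f = trans (cong (λ k → ∑ k f) (ℕₚ.+-suc m n))
    (trans (cong (_+ f (m ℕ.+ n)) (∑-split m n f))
           (+-assoc (∑ m f) (∑ n (λ i → f (m ℕ.+ i))) (f (m ℕ.+ n))))

  ∑-swap : ∀ m n (f : ℕ → ℕ → ℚ) → ∑ m (λ i → ∑ n (f i)) ≡ ∑ n (λ j → ∑ m (λ i → f i j))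
  ∑-swap zero    n f = sym (∑-0 n)
  ∑-swap (suc m) n f = trans (cong (_+ ∑ n (f m)) (∑-swap m n f))
    (sym (∑-+ n (λ j → ∑ m (λ i → f i j)) (f m)))

  ∑-telescope : ∀ n (f : ℕ → ℚ) → ∑ n (λ i → f (suc i) - f i) ≡ f n - f 0
  ∑-telescope zero    f = sym (+-inverseʳ (f 0))
  ∑-telescope (suc n) f = trans (cong (_+ (f (suc n) - f n)) (∑-telescope n f))
    (solve 3 (λ a b c → a :- b :+ (c :- a) := c :- b) refl (f n) (f 0) (f (suc n)))

  ∣∑∣≤∑∣∣ : ∀ n f → ∣ ∑ n f ∣ ≤ ∑ n (λ i → ∣ f i ∣)
  ∣∑∣≤∑∣∣ zero    f = ≤-refl
  ∣∑∣≤∑∣∣ (suc n) f = ≤-trans (∣p+q∣≤∣p∣+∣q∣ (∑ n f) (f n)) (+-monoˡ-≤ ∣ f n ∣ (∣∑∣≤∑∣∣ n f))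

  ∑-reverse : ∀ n f → ∑ n f ≡ ∑ n (λ i → f (n ℕ.∸ suc i))
  ∑-reverse zero    f = refl
  ∑-reverse (suc n) f = trans (cong (_+ f n) (∑-reverse n f))
    (trans (+-comm (∑ n (λ i → f (n ℕ.∸ suc i))) (f n)) (sym (∑-head n (λ i → f (n ℕ.∸ i)))))

  sign : ℕ → ℚ
  sign zero    = 1ℚ
  sign (suc n) = - sign n

  sign² : ∀ n → sign n * sign n ≡ 1ℚ
  sign² zero    = refl
  sign² (suc n) = trans (solve 1 (λ s → (:- s) :* (:- s) := s :* s) refl (sign n)) (sign² n)

  sign-+ : ∀ m n → sign (m ℕ.+ n) ≡ sign m * sign n
  sign-+ zero    n = sym (*-identityˡ (sign n))
  sign-+ (suc m) n = trans (cong -_ (sign-+ m n)) (neg-distribˡ-* (sign m) (sign n))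

  ∣sign∣ : ∀ n → ∣ sign n ∣ ≡ 1ℚ
  ∣sign∣ zero    = refl
  ∣sign∣ (suc n) = trans (∣-p∣≡∣p∣ (sign n)) (∣sign∣ n)

  -- Asymptotic equality of rational sequences

  infix 4 _≈_

  -- The relation `R._≃_` on bare sequences: neither side has to be known to converge.
  record _≈_ (x y : ℕ → ℚ) : Set where
    constructor mk≈
    field
      eventually : ∀ ε → 0ℚ < ε → ∃[ N ] (∀ n → N ℕ.≤ n → ∣ x n - y n ∣ ≤ ε)

  open _≈_ public

  ½ε : ∀ {ε} → 0ℚ < ε → 0ℚ < ½ * ε
  ½ε 0<ε = 0<* (positive⁻¹ ½) 0<ε

  ½ε+½ε : ∀ ε → ½ * ε + ½ * ε ≡ ε
  ½ε+½ε = solve 1 (λ e → con ½ :* e :+ con ½ :* e := e) refl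

  ⊔≤⇒ˡ : ∀ {m n o} → m ℕ.⊔ n ℕ.≤ o → m ℕ.≤ o
  ⊔≤⇒ˡ {m} {n} = ℕₚ.≤-trans (ℕₚ.m≤m⊔n m n)

  ⊔≤⇒ʳ : ∀ {m n o} → m ℕ.⊔ n ℕ.≤ o → n ℕ.≤ o
  ⊔≤⇒ʳ {m} {n} = ℕₚ.≤-trans (ℕₚ.m≤n⊔m m n)

  ≈-reflexive : ∀ {x y} → (∀ n → x n ≡ y n) → x ≈ y
  ≈-reflexive {x} {y} h = mk≈ λ ε 0<ε → 0 , λ n _ →
    subst (_≤ ε) (sym (cong ∣_∣ (p≡q⇒p-q≡0 (h n)))) (<⇒≤ 0<ε)

  ≈-refl : ∀ {x} → x ≈ x
  ≈-refl = ≈-reflexive (λ _ → refl)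

  ≈-sym : ∀ {x y} → x ≈ y → y ≈ x
  ≈-sym {x} {y} h = mk≈ λ ε 0<ε → let (N , p) = eventually h ε 0<ε in
    N , λ n k → subst (_≤ ε) (∣p-q∣≡∣q-p∣ (x n) (y n)) (p n k)

  ≈-trans : ∀ {x y z} → x ≈ y → y ≈ z → x ≈ z
  ≈-trans {x} {y} {z} h k = mk≈ λ ε 0<ε →
    let (M , p) = eventually h (½ * ε) (½ε 0<ε)
        (N , q) = eventually k (½ * ε) (½ε 0<ε) in
    M ℕ.⊔ N , λ n l → ≤-trans (∣p-r∣≤∣p-q∣+∣q-r∣ (x n) (y n) (z n))
    (≤-trans (+-mono-≤ (p n (⊔≤⇒ˡ l)) (q n (⊔≤⇒ʳ {M} l))) (≤-reflexive (½ε+½ε ε)))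

  ≈-+ : ∀ {x y z w} → x ≈ y → z ≈ w → (λ n → x n + z n) ≈ (λ n → y n + w n)
  ≈-+ {x} {y} {z} {w} h k = mk≈ λ ε 0<ε →
    let (M , p) = eventually h (½ * ε) (½ε 0<ε)
        (N , q) = eventually k (½ * ε) (½ε 0<ε) in
    M ℕ.⊔ N , λ n l → begin
    ∣ x n + z n - (y n + w n) ∣
      ≡⟨ cong ∣_∣ (solve 4 (λ x y z w → x :+ z :- (y :+ w) := (x :- y) :+ (z :- w))
                                            refl (x n) (y n) (z n) (w n)) ⟩
    ∣ (x n - y n) + (z n - w n) ∣      ≤⟨ ∣p+q∣≤∣p∣+∣q∣ (x n - y n) (z n - w n) ⟩
    ∣ x n - y n ∣ + ∣ z n - w n ∣      ≤⟨ +-mono-≤ (p n (⊔≤⇒ˡ l)) (q n (⊔≤⇒ʳ {M} l)) ⟩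
    ½ * ε + ½ * ε                      ≡⟨ ½ε+½ε ε ⟩
    ε                                  ∎
    where open ≤-Reasoning

  ≈-*ˡ : ∀ c {x y} → x ≈ y → (λ n → c * x n) ≈ (λ n → c * y n)
  ≈-*ˡ c {x} {y} h = mk≈ λ ε 0<ε →
    let 0<δ     = 0<* 0<ε (0<p⁻¹ 0<C)
        (N , p) = eventually h (ε * C ⁻¹) 0<δ in
    N , λ n l → begin
      ∣ c * x n - c * y n ∣
        ≡⟨ cong ∣_∣ (solve 3 (λ c x y → c :* x :- c :* y := c :* (x :- y)) refl c (x n) (y n)) ⟩
      ∣ c * (x n - y n) ∣          ≡⟨ ∣p*q∣≡∣p∣*∣q∣ c (x n - y n) ⟩
      ∣ c ∣ * ∣ x n - y n ∣        ≤⟨ *-mono (0≤∣p∣ c) (<⇒≤ 0<δ) ∣c∣≤C (p n l) ⟩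
      C * (ε * C ⁻¹)               ≡⟨ linear₁ ε (solve 3 (λ c e i → c :* (e :* i) :- e := e :* (c :* i :- con 1ℚ))
                                        refl C ε (C ⁻¹)) (p*p⁻¹ 0<C) ⟩
      ε                            ∎
    where
    open ≤-Reasoning
    C : ℚ
    C = ∣ c ∣ + 1ℚ
    0<C : 0ℚ < C
    0<C = 0<+ (0≤∣p∣ c) 0<1
    ∣c∣≤C : ∣ c ∣ ≤ C
    ∣c∣≤C = subst (_≤ C) (+-identityʳ ∣ c ∣) (+-monoʳ-≤ ∣ c ∣ 0≤1)

  ≈-rate : ∀ C {x y} → (∀ n → ∣ x n - y n ∣ ≤ C * fromℕ (suc n) ⁻¹) → x ≈ y
  ≈-rate C h = mk≈ λ ε 0<ε → let (N , p) = archimedean-≤ C 0<ε in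
    N , λ n k → ≤-trans (h n) (p n k)

  ≈-shift : ∀ {x y} → x ≈ y → (λ n → x (suc n)) ≈ (λ n → y (suc n))
  ≈-shift h = mk≈ λ ε 0<ε → let (N , p) = eventually h ε 0<ε in
    N , λ n k → p (suc n) (ℕₚ.≤-trans k (ℕₚ.n≤1+n n))

  ≈-suc : ∀ {x y} → (λ n → x (suc n)) ≈ (λ n → y (suc n)) → x ≈ y
  ≈-suc h = mk≈ λ ε 0<ε → let (N , p) = eventually h ε 0<ε in
    suc N , λ { (suc n) (ℕ.s≤s k) → p n k }

  -- This is how the Euler sum and the series of `summand` are shown to converge: they inherit it
  -- from their closed forms.
  IsCauchy-resp-≈ : ∀ {x y} → x ≈ y → IsCauchy y → IsCauchy x
  IsCauchy-resp-≈ {x} {y} h cy ε 0<ε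
    with eventually h (½ * (½ * ε)) (½ε (½ε 0<ε)) | cy (½ * ε) (½ε 0<ε)
  ... | M , p | N , q = M ℕ.⊔ N , λ m n k l → begin
    ∣ x m - x n ∣                                        ≤⟨ ∣p-r∣≤∣p-q∣+∣q-r∣ (x m) (y m) (x n) ⟩
    ∣ x m - y m ∣ + ∣ y m - x n ∣
      ≤⟨ +-mono-≤ (p m (⊔≤⇒ˡ k)) (∣p-r∣≤∣p-q∣+∣q-r∣ (y m) (y n) (x n)) ⟩
    ½ * (½ * ε) + (∣ y m - y n ∣ + ∣ y n - x n ∣)
      ≤⟨ +-monoʳ-≤ (½ * (½ * ε)) (+-mono-≤ (q m n (⊔≤⇒ʳ {M} k) (⊔≤⇒ʳ {M} l))
                                                              (≤-trans (≤-reflexive (∣p-q∣≡∣q-p∣ (y n) (x n))) (p n (⊔≤⇒ˡ l)))) ⟩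
    ½ * (½ * ε) + (½ * ε + ½ * (½ * ε))
      ≡⟨ solve 1 (λ e → con ½ :* (con ½ :* e) :+ (con ½ :* e :+ con ½ :* (con ½ :* e)) := e) refl ε ⟩
    ε                                                    ∎
    where open ≤-Reasoning

  ≈-subsequence : ∀ (x : ℕ → ℚ) → IsCauchy x → (f : ℕ → ℕ) → (∀ n → n ℕ.≤ f n) → (λ n → x (f n)) ≈ x
  ≈-subsequence x cx f h = mk≈ λ ε 0<ε → let (N , p) = cx ε 0<ε in
    N , λ n k → p (f n) n (ℕₚ.≤-trans k (h n)) k

  tail-rate⇒IsCauchy : ∀ C (x : ℕ → ℚ) → (∀ m d → ∣ x (m ℕ.+ d) - x m ∣ ≤ C * fromℕ (suc m) ⁻¹) → IsCauchy x
  tail-rate⇒IsCauchy C x h ε 0<ε = N , λ m n k l → ≤-trans (∣p-r∣≤∣p-q∣+∣q-r∣ (x m) (x N) (x n))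
    (≤-trans (+-mono-≤ (near m k) (≤-trans (≤-reflexive (∣p-q∣≡∣q-p∣ (x N) (x n))) (near n l)))
             (≤-reflexive (½ε+½ε ε)))
    where
    N : ℕ
    N = proj₁ (archimedean-≤ C (½ε 0<ε))
    near : ∀ m → N ℕ.≤ m → ∣ x m - x N ∣ ≤ ½ * ε
    near m k = ≤-trans (subst (λ i → ∣ x i - x N ∣ ≤ C * fromℕ (suc N) ⁻¹) (ℕₚ.m+[n∸m]≡n k) (h N (m ℕ.∸ N)))
                       (proj₂ (archimedean-≤ C (½ε 0<ε)) N ℕₚ.≤-refl)

  -- Tails of series and summation by parts

  ∑-tail : ∀ m d f → ∑ (m ℕ.+ d) f - ∑ m f ≡ ∑ d (λ i → f (m ℕ.+ i))
  ∑-tail m d f = trans (cong (_- ∑ m f) (∑-split m d f))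
    (solve 2 (λ a b → a :+ b :- a := b) refl (∑ m f) (∑ d (λ i → f (m ℕ.+ i))))

  -- Comparison with the series of 1/((i+1)(i+2)). The bound depends on the start `m` alone, as
  -- `tail-rate⇒IsCauchy` requires.
  ∑≤telescoped : ∀ C (a : ℕ → ℚ) → 0ℚ ≤ C →
    (∀ i → a i ≤ C * (fromℕ (suc i) ⁻¹ - fromℕ (suc (suc i)) ⁻¹)) →
    ∀ m d → ∑ d (λ i → a (m ℕ.+ i)) ≤ C * fromℕ (suc m) ⁻¹
  ∑≤telescoped C a 0≤C h m d = begin
    ∑ d (λ i → a (m ℕ.+ i))                              ≤⟨ ∑-mono d (λ i _ → step i) ⟩
    ∑ d (λ i → - C * (r (suc i) - r i))                  ≡⟨ ∑-*ˡ d (- C) (λ i → r (suc i) - r i) ⟩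
    - C * ∑ d (λ i → r (suc i) - r i)                    ≡⟨ cong (- C *_) (∑-telescope d r) ⟩
    - C * (r d - r 0)
      ≤⟨ gap⇒≤ (solve 3 (λ c a b → c :* b :- (:- c) :* (a :- b) := c :* a) refl C (r d) (r 0))
                                                              (0≤* 0≤C (<⇒≤ (0<p⁻¹ (0<1+fromℕ (m ℕ.+ d))))) ⟩
    C * r 0                                              ≡⟨ cong (λ k → C * fromℕ (suc k) ⁻¹) (ℕₚ.+-identityʳ m) ⟩
    C * fromℕ (suc m) ⁻¹                                 ∎
    where
    open ≤-Reasoning
    r : ℕ → ℚ
    r i = fromℕ (suc (m ℕ.+ i)) ⁻¹
    step : ∀ i → a (m ℕ.+ i) ≤ - C * (r (suc i) - r i)
    step i rewrite ℕₚ.+-suc m i = ≤-trans (h (m ℕ.+ i)) (≤-reflexive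
      (solve 3 (λ c a b → c :* (a :- b) := (:- c) :* (b :- a)) refl C (r i) (fromℕ (suc (suc (m ℕ.+ i))) ⁻¹)))

  ∑-IsCauchy : ∀ C (a : ℕ → ℚ) → 0ℚ ≤ C → (∀ i → 0ℚ ≤ a i) →
    (∀ i → a i ≤ C * (fromℕ (suc i) ⁻¹ - fromℕ (suc (suc i)) ⁻¹)) → IsCauchy (λ n → ∑ n a)
  ∑-IsCauchy C a 0≤C 0≤a h = tail-rate⇒IsCauchy C (λ n → ∑ n a) λ m d → subst (_≤ C * fromℕ (suc m) ⁻¹)
    (sym (trans (cong ∣_∣ (∑-tail m d a)) (0≤p⇒∣p∣≡p (0≤∑ d (λ i → 0≤a (m ℕ.+ i))))))
    (∑≤telescoped C a 0≤C h m d)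

  -- Peeling off the head leaves `b 0` minus the alternating sum of the shifted sequence, which lies
  -- between 0 and `b 1`; so the induction is over all sequences at once.
  alternating-bounds : ∀ (b : ℕ → ℚ) → (∀ i → 0ℚ ≤ b i) → (∀ i → b (suc i) ≤ b i) →
    ∀ d → 0ℚ ≤ ∑ d (λ i → sign i * b i) × ∑ d (λ i → sign i * b i) ≤ b 0
  alternating-bounds b 0≤b b↓ zero    = ≤-refl , 0≤b 0
  alternating-bounds b 0≤b b↓ (suc d)
    with alternating-bounds (λ i → b (suc i)) (λ i → 0≤b (suc i)) (λ i → b↓ (suc i)) d
  ... | lower , upper = subst (0ℚ ≤_) (sym eq) (≤⇒0≤gap (≤-trans upper (b↓ 0)))
                      , gap⇒≤ (trans (cong (λ s → b 0 - s) eq) (solve 2 (λ b a → b :- (b :- a) := a) refl (b 0) A)) lower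
    where
    A : ℚ
    A = ∑ d (λ i → sign i * b (suc i))
    eq : ∑ (suc d) (λ i → sign i * b i) ≡ b 0 - A
    eq = begin
      ∑ (suc d) (λ i → sign i * b i)                        ≡⟨ ∑-head d (λ i → sign i * b i) ⟩
      1ℚ * b 0 + ∑ d (λ i → - sign i * b (suc i))           ≡⟨ cong (1ℚ * b 0 +_) (trans (∑-cong d (λ i _ →
                                                                 solve 2 (λ s b → (:- s) :* b := (:- con 1ℚ) :* (s :* b)) refl (sign i) (b (suc i))))
                                                                 (∑-*ˡ d (- 1ℚ) (λ i → sign i * b (suc i)))) ⟩
      1ℚ * b 0 + - 1ℚ * A
        ≡⟨ solve 2 (λ b a → con 1ℚ :* b :+ (:- con 1ℚ) :* a := b :- a) refl (b 0) A ⟩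
      b 0 - A                                               ∎
      where open ≡-Reasoning

  alternating-tail : ∀ (b : ℕ → ℚ) → (∀ i → 0ℚ ≤ b i) → (∀ i → b (suc i) ≤ b i) →
    ∀ m d → ∣ ∑ (m ℕ.+ d) (λ i → sign i * b i) - ∑ m (λ i → sign i * b i) ∣ ≤ b m
  alternating-tail b 0≤b b↓ m d = begin
    ∣ ∑ (m ℕ.+ d) f - ∑ m f ∣                       ≡⟨ cong ∣_∣ (∑-tail m d f) ⟩
    ∣ ∑ d (λ i → sign (m ℕ.+ i) * b (m ℕ.+ i)) ∣
      ≡⟨ cong ∣_∣ (trans (∑-cong d (λ i _ → trans (cong (_* b (m ℕ.+ i)) (sign-+ m i))
                                                         (*-assoc (sign m) (sign i) (b (m ℕ.+ i))))) (∑-*ˡ d (sign m) g)) ⟩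
    ∣ sign m * ∑ d g ∣                              ≡⟨ ∣p*q∣≡∣p∣*∣q∣ (sign m) (∑ d g) ⟩
    ∣ sign m ∣ * ∣ ∑ d g ∣                          ≡⟨ cong₂ _*_ (∣sign∣ m) (0≤p⇒∣p∣≡p (proj₁ bounds)) ⟩
    1ℚ * ∑ d g                                      ≡⟨ *-identityˡ (∑ d g) ⟩
    ∑ d g                                           ≤⟨ proj₂ bounds ⟩
    b (m ℕ.+ 0)                                     ≡⟨ cong b (ℕₚ.+-identityʳ m) ⟩
    b m                                             ∎
    where
    open ≤-Reasoning
    f g : ℕ → ℚ
    f i = sign i * b i
    g i = sign i * b (m ℕ.+ i)
    bounds : 0ℚ ≤ ∑ d g × ∑ d g ≤ b (m ℕ.+ 0)
    bounds = alternating-bounds (λ i → b (m ℕ.+ i)) (λ i → 0≤b (m ℕ.+ i))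
      (λ i → subst (λ k → b k ≤ b (m ℕ.+ i)) (sym (ℕₚ.+-suc m i)) (b↓ (m ℕ.+ i))) d

  -- Abel's inequality. The factor `z` costs its total variation and its last value, each at most 1.
  -- Only partial sums of `e` enter, so conditionally convergent series are covered.
  abel-bound : ∀ (z e : ℕ → ℚ) δ → (∀ i → 0ℚ ≤ z i) → (∀ i → z i ≤ 1ℚ) → (∀ i → z i ≤ z (suc i)) →
    (∀ n → ∣ ∑ n e ∣ ≤ δ) → ∀ n → ∣ ∑ n (λ i → z i * e i) ∣ ≤ 2ℚ * δ
  abel-bound z e δ 0≤z z≤1 z↑ h n = begin
    ∣ Q n ∣
      ≡⟨ cong ∣_∣ (solve 2 (λ a b → a := a :- b :+ b) refl (Q n) (z n * ∑ n e)) ⟩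
    ∣ Q n - z n * ∑ n e + z n * ∑ n e ∣           ≤⟨ ∣p+q∣≤∣p∣+∣q∣ (Q n - z n * ∑ n e) (z n * ∑ n e) ⟩
    ∣ Q n - z n * ∑ n e ∣ + ∣ z n * ∑ n e ∣
      ≤⟨ +-mono-≤ (invariant n) (≤-trans (∣p*q∣≤∣q∣ (∑ n e) (0≤z n) (z≤1 n)) (h n)) ⟩
    z n * δ + δ
      ≤⟨ +-monoˡ-≤ δ (≤-trans (*-monoʳ 0≤δ (z≤1 n)) (≤-reflexive (*-identityˡ δ))) ⟩
    δ + δ                                         ≡⟨ solve 1 (λ d → d :+ d := con 2ℚ :* d) refl δ ⟩
    2ℚ * δ                                        ∎
    where
    open ≤-Reasoning
    Q : ℕ → ℚ
    Q n = ∑ n (λ i → z i * e i)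
    0≤δ : 0ℚ ≤ δ
    0≤δ = ≤-trans (0≤∣p∣ (∑ 0 e)) (h 0)
    -- By parts, the difference is minus the sum of (z (i+1) - z i) · `∑ (suc i) e`, so it is at
    -- most (z n - z 0) δ.
    invariant : ∀ n → ∣ Q n - z n * ∑ n e ∣ ≤ z n * δ
    invariant zero    = ≤-trans (≤-reflexive (cong ∣_∣ (solve 1 (λ z → con 0ℚ :- z :* con 0ℚ := con 0ℚ) refl (z 0))))
                                (0≤* (0≤z 0) 0≤δ)
    invariant (suc n) = begin
      ∣ Q n + z n * e n - z (suc n) * (∑ n e + e n) ∣                     ≡⟨ cong ∣_∣ (solve 5 (λ q z z′ e t →
                                                                              q :+ z :* e :- z′ :* (t :+ e) := (q :- z :* t) :+ (:- ((z′ :- z) :* (t :+ e))))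
                                                                              refl (Q n) (z n) (z (suc n)) (e n) (∑ n e)) ⟩
      ∣ (Q n - z n * ∑ n e) + - ((z (suc n) - z n) * ∑ (suc n) e) ∣
        ≤⟨ ∣p+q∣≤∣p∣+∣q∣ (Q n - z n * ∑ n e) (- ((z (suc n) - z n) * ∑ (suc n) e)) ⟩
      ∣ Q n - z n * ∑ n e ∣ + ∣ - ((z (suc n) - z n) * ∑ (suc n) e) ∣     ≤⟨ +-mono-≤ (invariant n) increment ⟩
      z n * δ + (z (suc n) - z n) * δ
        ≡⟨ solve 3 (λ z z′ d → z :* d :+ (z′ :- z) :* d := z′ :* d) refl (z n) (z (suc n)) δ ⟩
      z (suc n) * δ                                                       ∎
      where
      0≤gap : 0ℚ ≤ z (suc n) - z n
      0≤gap = ≤⇒0≤gap (z↑ n)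
      increment : ∣ - ((z (suc n) - z n) * ∑ (suc n) e) ∣ ≤ (z (suc n) - z n) * δ
      increment = begin
        ∣ - ((z (suc n) - z n) * ∑ (suc n) e) ∣    ≡⟨ ∣-p∣≡∣p∣ ((z (suc n) - z n) * ∑ (suc n) e) ⟩
        ∣ (z (suc n) - z n) * ∑ (suc n) e ∣        ≡⟨ ∣p*q∣≡∣p∣*∣q∣ (z (suc n) - z n) (∑ (suc n) e) ⟩
        ∣ z (suc n) - z n ∣ * ∣ ∑ (suc n) e ∣      ≡⟨ cong (_* ∣ ∑ (suc n) e ∣) (0≤p⇒∣p∣≡p 0≤gap) ⟩
        (z (suc n) - z n) * ∣ ∑ (suc n) e ∣        ≤⟨ *-monoˡ 0≤gap (h (suc n)) ⟩
        (z (suc n) - z n) * δ                      ∎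

  -- Summation by parts presents the weighted sums as averages of the partial
  -- sums, with the weight escaping to infinity.
  weighted-∑≈∑ : ∀ (y : ℕ → ℕ → ℚ) (e : ℕ → ℚ) →
    (∀ m i → 0ℚ ≤ y m i) → (∀ m i → y m i ≤ 1ℚ) → (∀ m i → y m (suc i) ≤ y m i) →
    (∀ i → (λ m → y m i) ≈ (λ _ → 1ℚ)) → IsCauchy (λ n → ∑ n e) →
    (λ n → ∑ n (λ i → y n i * e i)) ≈ (λ n → ∑ n e)
  weighted-∑≈∑ y e 0≤y y≤1 y↓ y→1 ce = mk≈ λ ε 0<ε → N ε 0<ε , bound ε 0<ε
    where
    -- The weight that is missing from 1. A head of fixed length tends to 0 because each of its
    -- weights does (`initial`); the rest is left to `abel-bound`, as `z` increases in the summation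
    -- index.
    z : ℕ → ℕ → ℚ
    z m i = 1ℚ - y m i
    initial : ∀ k → (λ m → ∑ k (λ i → z m i * e i)) ≈ (λ _ → 0ℚ)
    initial zero    = ≈-refl
    initial (suc k) = ≈-+ (initial k) (≈-trans
      (≈-reflexive (λ m → solve 2 (λ y e → (con 1ℚ :- y) :* e := (:- e) :* y :+ e) refl (y m k) (e k)))
      (≈-trans (≈-+ (≈-*ˡ (- e k) (y→1 k)) (≈-refl {λ _ → e k}))
        (≈-reflexive (λ _ → solve 1 (λ e → (:- e) :* con 1ℚ :+ e := con 0ℚ) refl (e k)))))
    module _ (ε : ℚ) (0<ε : 0ℚ < ε) where
      -- A quarter of `ε`: `abel-bound` doubles it, and the head takes the other half of `ε`.
      δ : ℚ
      δ = ½ * (½ * ε)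
      K N₁ N : ℕ
      K = proj₁ (ce δ (½ε (½ε 0<ε)))
      N₁ = proj₁ (eventually (initial K) (½ * ε) (½ε 0<ε))
      N = K ℕ.⊔ N₁
      late : ∀ n d → ∣ ∑ d (λ i → z n (K ℕ.+ i) * e (K ℕ.+ i)) ∣ ≤ 2ℚ * δ
      late n = abel-bound (λ i → z n (K ℕ.+ i)) (λ i → e (K ℕ.+ i)) δ
        (λ i → ≤⇒0≤gap (y≤1 n (K ℕ.+ i)))
        (λ i → gap⇒≤ (solve 1 (λ y → con 1ℚ :- (con 1ℚ :- y) := y) refl (y n (K ℕ.+ i))) (0≤y n (K ℕ.+ i)))
        (λ i → gap⇒≤ (trans (cong (λ j → z n j - z n (K ℕ.+ i)) (ℕₚ.+-suc K i))
                       (solve 2 (λ a b → (con 1ℚ :- a) :- (con 1ℚ :- b) := b :- a) refl (y n (suc (K ℕ.+ i))) (y n (K ℕ.+ i))))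
                     (≤⇒0≤gap (y↓ n (K ℕ.+ i))))
        (λ d → subst (λ s → ∣ s ∣ ≤ δ) (∑-tail K d e)
                 (proj₂ (ce δ (½ε (½ε 0<ε))) (K ℕ.+ d) K (ℕₚ.m≤m+n K d) ℕₚ.≤-refl))
      bound : ∀ n → N ℕ.≤ n → ∣ ∑ n (λ i → y n i * e i) - ∑ n e ∣ ≤ ε
      bound n N≤n = begin
        ∣ ∑ n (λ i → y n i * e i) - ∑ n e ∣              ≡⟨ cong ∣_∣ (sym (∑-- n (λ i → y n i * e i) e)) ⟩
        ∣ ∑ n (λ i → y n i * e i - e i) ∣
          ≡⟨ cong ∣_∣ (∑-cong n (λ i _ → solve 2 (λ y e → y :* e :- e := (:- con 1ℚ) :* ((con 1ℚ :- y) :* e))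
                                                              refl (y n i) (e i))) ⟩
        ∣ ∑ n (λ i → - 1ℚ * f i) ∣
          ≡⟨ cong ∣_∣ (trans (∑-*ˡ n (- 1ℚ) f) (solve 1 (λ s → (:- con 1ℚ) :* s := :- s) refl (∑ n f))) ⟩
        ∣ - ∑ n f ∣                                      ≡⟨ ∣-p∣≡∣p∣ (∑ n f) ⟩
        ∣ ∑ n f ∣
          ≡⟨ cong (λ k → ∣ ∑ k f ∣) (sym (ℕₚ.m+[n∸m]≡n (⊔≤⇒ˡ {K} {N₁} N≤n))) ⟩
        ∣ ∑ (K ℕ.+ d) f ∣                                ≡⟨ cong ∣_∣ (∑-split K d f) ⟩
        ∣ ∑ K f + ∑ d (λ i → f (K ℕ.+ i)) ∣              ≤⟨ ∣p+q∣≤∣p∣+∣q∣ (∑ K f) (∑ d (λ i → f (K ℕ.+ i))) ⟩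
        ∣ ∑ K f ∣ + ∣ ∑ d (λ i → f (K ℕ.+ i)) ∣          ≤⟨ +-mono-≤ early (late n d) ⟩
        ½ * ε + 2ℚ * δ
          ≡⟨ solve 1 (λ e → con ½ :* e :+ con 2ℚ :* (con ½ :* (con ½ :* e)) := e) refl ε ⟩
        ε                                                ∎
        where
        open ≤-Reasoning
        f : ℕ → ℚ
        f i = z n i * e i
        d : ℕ
        d = n ℕ.∸ K
        early : ∣ ∑ K f ∣ ≤ ½ * ε
        early = subst (λ s → ∣ s ∣ ≤ ½ * ε) (solve 1 (λ a → a :- con 0ℚ := a) refl (∑ K f))
          (proj₂ (eventually (initial K) (½ * ε) (½ε 0<ε)) n (⊔≤⇒ʳ {K} {N₁} N≤n))

-- The Wallis numbers and the weights C(2n,n+j)/C(2n,n)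

module Wallis where

  open import Data.Rational
  open import Data.Rational.Properties
  open import Data.Rational.Solver using (module +-*-Solver)
  open +-*-Solver
  open RationalLemmas
  open Sequences

  recip : ℕ → ℚ
  recip n = fromℕ (suc n) ⁻¹

  0≤recip : ∀ n → 0ℚ ≤ recip n
  0≤recip n = <⇒≤ (0<p⁻¹ (0<1+fromℕ n))

  odd : ℕ → ℚ
  odd n = 2ℚ * fromℕ n + 1ℚ

  0<odd : ∀ n → 0ℚ < odd n
  0<odd n = 0<+ (0≤* 0≤2 (0≤fromℕ n)) 0<1

  1+n≤odd : ∀ n → fromℕ (suc n) ≤ odd n
  1+n≤odd n = gap⇒≤ (solve 1 (λ n → con 2ℚ :* n :+ con 1ℚ :- (n :+ con 1ℚ) := n) refl (fromℕ n)) (0≤fromℕ n)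

  odd⁻¹≤[1+n]⁻¹ : ∀ n → odd n ⁻¹ ≤ fromℕ (suc n) ⁻¹
  odd⁻¹≤[1+n]⁻¹ n = ⁻¹-anti (0<1+fromℕ n) (1+n≤odd n)

  0≤odd⁻¹ : ∀ n → 0ℚ ≤ odd n ⁻¹
  0≤odd⁻¹ n = <⇒≤ (0<p⁻¹ (0<odd n))

  1⁻¹≡1 : 1ℚ ⁻¹ ≡ 1ℚ
  1⁻¹≡1 = sym (⁻¹-unique 0<1 refl)

  -- u n = (2n)!! / (2n+1)!!
  u : ℕ → ℚ
  u zero    = 1ℚ
  u (suc n) = u n * (2ℚ * fromℕ (suc n)) * odd (suc n) ⁻¹

  u-step : ∀ n → u (suc n) * odd (suc n) ≡ u n * (2ℚ * fromℕ (suc n))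
  u-step n = linear₁ (u n * (2ℚ * fromℕ (suc n)))
    (solve 3 (λ a o i → a :* i :* o :- a := a :* (o :* i :- con 1ℚ)) refl
      (u n * (2ℚ * fromℕ (suc n))) (odd (suc n)) (odd (suc n) ⁻¹))
    (p*p⁻¹ (0<odd (suc n)))

  0<u : ∀ n → 0ℚ < u n
  0<u zero    = 0<1
  0<u (suc n) = 0<* (0<* (0<u n) (0<* 0<2 (0<1+fromℕ n))) (0<p⁻¹ (0<odd (suc n)))

  -- w n j = n!² / ((n−j)! (n+j)!), which vanishes for j > n
  w : ℕ → ℕ → ℚ
  w n zero    = 1ℚ
  w n (suc j) = w n j * (fromℕ (n ℕ.∸ j) * fromℕ (suc (n ℕ.+ j)) ⁻¹)

  0≤w : ∀ n j → 0ℚ ≤ w n j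
  0≤w n zero    = 0≤1
  0≤w n (suc j) = 0≤* (0≤w n j) (0≤* (0≤fromℕ (n ℕ.∸ j)) (<⇒≤ (0<p⁻¹ (0<1+fromℕ (n ℕ.+ j)))))

  w-antitone : ∀ n j → w n (suc j) ≤ w n j
  w-antitone n j = ≤-trans (*-monoˡ (0≤w n j) factor≤1) (≤-reflexive (*-identityʳ (w n j)))
    where
    i : ℚ
    i = fromℕ (suc (n ℕ.+ j)) ⁻¹
    factor≤1 : fromℕ (n ℕ.∸ j) * i ≤ 1ℚ
    factor≤1 = ≤-trans
      (*-monoʳ (<⇒≤ (0<p⁻¹ (0<1+fromℕ (n ℕ.+ j))))
        (fromℕ-mono (ℕₚ.≤-trans (ℕₚ.m∸n≤m n j) (ℕₚ.≤-trans (ℕₚ.m≤m+n n j) (ℕₚ.n≤1+n (n ℕ.+ j))))))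
      (≤-reflexive (p*p⁻¹ (0<1+fromℕ (n ℕ.+ j))))

  w≤1 : ∀ n j → w n j ≤ 1ℚ
  w≤1 n zero    = ≤-refl
  w≤1 n (suc j) = ≤-trans (w-antitone n j) (w≤1 n j)

  w-vanishes : ∀ n j → n ℕ.< j → w n j ≡ 0ℚ
  w-vanishes n (suc j) (ℕ.s≤s n≤j) =
    trans (cong (λ k → w n j * (fromℕ k * fromℕ (suc (n ℕ.+ j)) ⁻¹)) (ℕₚ.m≤n⇒m∸n≡0 n≤j))
          (solve 2 (λ a i → a :* (con 0ℚ :* i) := con 0ℚ) refl (w n j) (fromℕ (suc (n ℕ.+ j)) ⁻¹))

  fromℕ-∸ : ∀ {m n} → n ℕ.≤ m → fromℕ (m ℕ.∸ n) ≡ fromℕ m - fromℕ n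
  fromℕ-∸ {m} {n} n≤m = linear₁ 1ℚ
    (solve 3 (λ d m n → d :- (m :- n) := con 1ℚ :* ((n :+ d) :- m)) refl (fromℕ (m ℕ.∸ n)) (fromℕ m) (fromℕ n))
    (trans (sym (fromℕ-+ n (m ℕ.∸ n))) (cong fromℕ (ℕₚ.m+[n∸m]≡n n≤m)))

  -- Truncated and true subtraction differ only for `j` above `n`, where the weight is zero.
  w*[n∸j] : ∀ n j → w n j * fromℕ (n ℕ.∸ j) ≡ w n j * (fromℕ n - fromℕ j)
  w*[n∸j] n j with ℕₚ.≤-<-connex j n
  ... | inj₁ j≤n = cong (w n j *_) (fromℕ-∸ j≤n)
  ... | inj₂ n<j = trans (cong (_* fromℕ (n ℕ.∸ j)) (w-vanishes n j n<j))
    (trans (*-zeroˡ (fromℕ (n ℕ.∸ j))) (sym (trans (cong (_* (fromℕ n - fromℕ j)) (w-vanishes n j n<j))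
      (*-zeroˡ (fromℕ n - fromℕ j)))))

  w-step : ∀ n j → w n (suc j) * (fromℕ n + fromℕ j + 1ℚ) ≡ w n j * (fromℕ n - fromℕ j)
  w-step n j = trans (cong (λ k → w n (suc j) * (k + 1ℚ)) (sym (fromℕ-+ n j))) (trans
    (linear₁ (w n j * d)
      (solve 4 (λ a d p i → a :* (d :* i) :* p :- a :* d := a :* d :* (p :* i :- con 1ℚ)) refl
        (w n j) d (fromℕ (suc (n ℕ.+ j))) (fromℕ (suc (n ℕ.+ j)) ⁻¹))
      (p*p⁻¹ (0<1+fromℕ (n ℕ.+ j))))
    (w*[n∸j] n j))
    where
    d : ℚ
    d = fromℕ (n ℕ.∸ j)

  -- Induction on `j`, with `w-step` applied in both rows. The form without denominators includes
  -- `j` above `n`, where both sides are zero.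
  w-row : ∀ n j → w (suc n) j * ((fromℕ (suc n) - fromℕ j) * (fromℕ (suc n) + fromℕ j))
                ≡ fromℕ (suc n) * fromℕ (suc n) * w n j
  w-row n zero    = solve 1 (λ m → con 1ℚ :* ((m :- con 0ℚ) :* (m :+ con 0ℚ)) := m :* m :* con 1ℚ) refl (fromℕ (suc n))
  w-row n (suc j) = *-cancelˡ-≡ (fromℕ j + fromℕ (suc n)) (0<+ (0≤fromℕ j) (0<1+fromℕ n))
    (linear₃ ((J + M) * (M - J - 1ℚ)) (M - J - 1ℚ) (- (M * M))
      (solve 6 (λ m j a′ a b′ b →
          (j :+ m) :* (a′ :* ((m :- (j :+ con 1ℚ)) :* (m :+ (j :+ con 1ℚ)))) :- (j :+ m) :* (m :* m :* b′)
          := (j :+ m) :* (m :- j :- con 1ℚ) :* (a′ :* (m :+ j :+ con 1ℚ) :- a :* (m :- j))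
             :+ (m :- j :- con 1ℚ) :* (a :* ((m :- j) :* (m :+ j)) :- m :* m :* b)
             :+ (:- (m :* m)) :* (b′ :* (m :- con 1ℚ :+ j :+ con 1ℚ) :- b :* (m :- con 1ℚ :- j)))
        refl M J (w (suc n) (suc j)) (w (suc n) j) (w n (suc j)) (w n j))
      (w-step (suc n) j) (w-row n j)
      (subst (λ k → w n (suc j) * (k + J + 1ℚ) ≡ w n j * (k - J))
             (solve 1 (λ n → n := n :+ con 1ℚ :- con 1ℚ) refl (fromℕ n)) (w-step n j)))
    where
    M J : ℚ
    M = fromℕ (suc n)
    J = fromℕ j

  -- For `j` below `n` this is n!²/((n-j-1)!(n+j)!), a multiple of C(2n-1,n+j) depending on `n`
  -- only.
  v : ℕ → ℕ → ℚ
  v n j = w n j * (fromℕ n - fromℕ j)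

  -- The right side is an antidifference of the summand. It vanishes at `k = n`, because `v n n`
  -- does.
  alternating-odd-v : ∀ n k → (fromℕ n - 1ℚ) * ∑ k (λ j → sign j * v n j * odd j)
    ≡ - (sign k * v n k * ((fromℕ n + fromℕ k) * fromℕ k))
  alternating-odd-v n zero    = solve 2 (λ n a → (n :- con 1ℚ) :* con 0ℚ := :- (a :* ((n :+ con 0ℚ) :* con 0ℚ)))
    refl (fromℕ n) (sign 0 * v n 0)
  alternating-odd-v n (suc k) = linear₂ 1ℚ (- (sign k * (fromℕ n - fromℕ k - 1ℚ) * (fromℕ k + 1ℚ)))
    (solve 6 (λ s n k z a a′ →
        (n :- con 1ℚ) :* (z :+ s :* (a :* (n :- k)) :* (con 2ℚ :* k :+ con 1ℚ))
          :- (:- ((:- s) :* (a′ :* (n :- (k :+ con 1ℚ))) :* ((n :+ (k :+ con 1ℚ)) :* (k :+ con 1ℚ))))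
        := con 1ℚ :* ((n :- con 1ℚ) :* z :- (:- (s :* (a :* (n :- k)) :* ((n :+ k) :* k))))
           :+ (:- (s :* (n :- k :- con 1ℚ) :* (k :+ con 1ℚ))) :* (a′ :* (n :+ k :+ con 1ℚ) :- a :* (n :- k)))
      refl (sign k) (fromℕ n) (fromℕ k) (∑ k (λ j → sign j * v n j * odd j)) (w n k) (w n (suc k)))
    (alternating-odd-v n k) (w-step n k)

  -- The rows begin at 2: in row 1 the sum is 1, and the factor n - 1 of `alternating-odd-v` cannot
  -- be cancelled.
  ∑-alternating-odd-v : ∀ n → ∑ (suc (suc n)) (λ j → sign j * v (suc (suc n)) j * odd j) ≡ 0ℚ
  ∑-alternating-odd-v n = *-cancelˡ-≡ (M - 1ℚ) (subst (0ℚ <_) (solve 1 (λ n → n := n :+ con 1ℚ :- con 1ℚ) refl (fromℕ (suc n))) (0<1+fromℕ n))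
    (trans (alternating-odd-v (suc (suc n)) (suc (suc n)))
      (solve 3 (λ s a m → :- (s :* (a :* (m :- m)) :* ((m :+ m) :* m)) := (m :- con 1ℚ) :* con 0ℚ)
        refl (sign (suc (suc n))) (w (suc (suc n)) (suc (suc n))) M))
    where
    M : ℚ
    M = fromℕ (suc (suc n))

  V : ℕ → ℚ
  V n = ∑ n (λ j → sign j * v n j * odd j ⁻¹)

  -- With m = n + 1, split (2m+1)² = (2j+1)² + 4(m-j)(m+j+1). The first part turns the division by
  -- 2j+1 into a multiplication, and the resulting sum is zero; the second lowers the row by
  -- `w-row`.
  V-term : ∀ n j → odd (suc n) * odd (suc n) * (sign j * v (suc (suc n)) j * odd j ⁻¹)
    ≡ sign j * v (suc (suc n)) j * odd j
      + 4ℚ * (fromℕ (suc (suc n)) * fromℕ (suc (suc n))) * (sign j * v (suc n) j * odd j ⁻¹)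
  V-term n j = linear₂ (4ℚ * sign j * (M - J) * i) (s * b′ * (M + 1ℚ - J) * odd j)
    (solve 6 (λ s m j b′ b i →
        (con 2ℚ :* m :+ con 1ℚ) :* (con 2ℚ :* m :+ con 1ℚ) :* (s :* (b′ :* (m :+ con 1ℚ :- j)) :* i)
          :- (s :* (b′ :* (m :+ con 1ℚ :- j)) :* (con 2ℚ :* j :+ con 1ℚ)
              :+ con 4ℚ :* ((m :+ con 1ℚ) :* (m :+ con 1ℚ)) :* (s :* (b :* (m :- j)) :* i))
        := con 4ℚ :* s :* (m :- j) :* i :* (b′ :* ((m :+ con 1ℚ :- j) :* (m :+ con 1ℚ :+ j)) :- (m :+ con 1ℚ) :* (m :+ con 1ℚ) :* b)
           :+ s :* b′ :* (m :+ con 1ℚ :- j) :* (con 2ℚ :* j :+ con 1ℚ) :* ((con 2ℚ :* j :+ con 1ℚ) :* i :- con 1ℚ))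
      refl s M J b′ (w (suc n) j) i)
    (w-row (suc n) j) (p*p⁻¹ (0<odd j))
    where
    s M J b′ i : ℚ
    s = sign j
    M = fromℕ (suc n)
    J = fromℕ j
    b′ = w (suc (suc n)) j
    i = odd j ⁻¹

  V-step : ∀ n → odd (suc n) * odd (suc n) * V (suc (suc n))
    ≡ 4ℚ * (fromℕ (suc (suc n)) * fromℕ (suc (suc n))) * V (suc n)
  V-step n = begin
    o² * V (suc (suc n))
      ≡⟨ sym (∑-*ˡ (suc (suc n)) o² (λ j → sign j * v (suc (suc n)) j * odd j ⁻¹)) ⟩
    ∑ (suc (suc n)) (λ j → o² * (sign j * v (suc (suc n)) j * odd j ⁻¹))
      ≡⟨ ∑-cong (suc (suc n)) (λ j _ → V-term n j) ⟩
    ∑ (suc (suc n)) (λ j → sign j * v (suc (suc n)) j * odd j + c * f j)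
      ≡⟨ ∑-+ (suc (suc n)) (λ j → sign j * v (suc (suc n)) j * odd j) (λ j → c * f j) ⟩
    ∑ (suc (suc n)) (λ j → sign j * v (suc (suc n)) j * odd j) + ∑ (suc (suc n)) (λ j → c * f j)
      ≡⟨ cong₂ _+_ (∑-alternating-odd-v n) (∑-*ˡ (suc (suc n)) c f) ⟩
    0ℚ + c * (V (suc n) + f (suc n))
      ≡⟨ solve 6 (λ c V s a m i → con 0ℚ :+ c :* (V :+ s :* (a :* (m :- m)) :* i) := c :* V) refl
           c (V (suc n)) (sign (suc n)) (w (suc n) (suc n)) (fromℕ (suc n)) (odd (suc n) ⁻¹) ⟩
    c * V (suc n)                                                  ∎
    where
    open ≡-Reasoning
    o² c : ℚ
    o² = odd (suc n) * odd (suc n)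
    c = 4ℚ * (fromℕ (suc (suc n)) * fromℕ (suc (suc n)))
    f : ℕ → ℚ
    f j = sign j * v (suc n) j * odd j ⁻¹

  -- Both sides obey the same first-order recurrence, by `V-step` and by the square of `u-step`.
  -- Divided by n + 1, this evaluates the weighted Leibniz sum.
  V≡[1+n]²u² : ∀ n → V (suc n) ≡ fromℕ (suc n) * fromℕ (suc n) * (u n * u n)
  V≡[1+n]²u² zero    = trans (cong (λ i → 0ℚ + 1ℚ * (1ℚ * (1ℚ - 0ℚ)) * i) 1⁻¹≡1) refl
  V≡[1+n]²u² (suc n) = *-cancelˡ-≡ (odd (suc n) * odd (suc n)) (0<* (0<odd (suc n)) (0<odd (suc n)))
    (linear₃ 1ℚ (4ℚ * (M′ * M′)) (- (M′ * M′ * (u (suc n) * odd (suc n) + u n * (2ℚ * M))))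
      (solve 7 (λ o V′ m V a′ a m′ →
          o :* o :* V′ :- o :* o :* (m′ :* m′ :* (a′ :* a′))
          := con 1ℚ :* (o :* o :* V′ :- con 4ℚ :* (m′ :* m′) :* V)
             :+ con 4ℚ :* (m′ :* m′) :* (V :- m :* m :* (a :* a))
             :+ (:- (m′ :* m′ :* (a′ :* o :+ a :* (con 2ℚ :* m)))) :* (a′ :* o :- a :* (con 2ℚ :* m)))
        refl (odd (suc n)) (V (suc (suc n))) M (V (suc n)) (u (suc n)) (u n) M′)
      (V-step n) (V≡[1+n]²u² n) (u-step n))
    where
    M M′ : ℚ
    M = fromℕ (suc n)
    M′ = fromℕ (suc (suc n))

  -- By `w-step`, passing from `j` to `j + 1` changes the weight by the fraction (2j+1)/(n+j+1) of
  -- itself, which is O(1/n) for fixed `j`.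
  w→1 : ∀ j → (λ n → w n j) ≈ (λ _ → 1ℚ)
  w→1 zero    = ≈-refl
  w→1 (suc j) = ≈-trans (≈-rate (odd j) λ n → let p = fromℕ n + fromℕ j + 1ℚ in begin
      ∣ w n (suc j) - w n j ∣            ≡⟨ cong ∣_∣ (linear₂ (p ⁻¹) (w n j - w n (suc j)) (solve 5 (λ a′ a n j i →
                                                (a′ :- a) :- (:- (a :* ((con 2ℚ :* j :+ con 1ℚ) :* i)))
                                                := i :* (a′ :* (n :+ j :+ con 1ℚ) :- a :* (n :- j))
                                                   :+ (a :- a′) :* ((n :+ j :+ con 1ℚ) :* i :- con 1ℚ)) refl
                                              (w n (suc j)) (w n j) (fromℕ n) (fromℕ j) (p ⁻¹))
                                              (w-step n j) (p*p⁻¹ (0<p n))) ⟩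
      ∣ - (w n j * (odd j * p ⁻¹)) ∣     ≡⟨ ∣-p∣≡∣p∣ (w n j * (odd j * p ⁻¹)) ⟩
      ∣ w n j * (odd j * p ⁻¹) ∣         ≤⟨ ∣p*q∣≤∣q∣ (odd j * p ⁻¹) (0≤w n j) (w≤1 n j) ⟩
      ∣ odd j * p ⁻¹ ∣                   ≡⟨ 0≤p⇒∣p∣≡p (0≤* (<⇒≤ (0<odd j)) (<⇒≤ (0<p⁻¹ (0<p n)))) ⟩
      odd j * p ⁻¹                       ≤⟨ *-monoˡ (<⇒≤ (0<odd j)) (⁻¹-anti (0<1+fromℕ n) (gap⇒≤
                                              (solve 2 (λ n j → n :+ j :+ con 1ℚ :- (n :+ con 1ℚ) := j) refl (fromℕ n) (fromℕ j)) (0≤fromℕ j))) ⟩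
      odd j * fromℕ (suc n) ⁻¹           ∎) (w→1 j)
    where
    open ≤-Reasoning
    0<p : ∀ n → 0ℚ < fromℕ n + fromℕ j + 1ℚ
    0<p n = 0<+ (0≤+ (0≤fromℕ n) (0≤fromℕ j)) 0<1

  -- The Leibniz series and its Wallis averages

  leibniz : ℕ → ℚ
  leibniz n = ∑ n (λ i → sign i * odd i ⁻¹)

  odd⁻¹-antitone : ∀ i → odd (suc i) ⁻¹ ≤ odd i ⁻¹
  odd⁻¹-antitone i = ⁻¹-anti (0<odd i) (gap⇒≤
    (solve 1 (λ i → con 2ℚ :* (i :+ con 1ℚ) :+ con 1ℚ :- (con 2ℚ :* i :+ con 1ℚ) := con 2ℚ) refl (fromℕ i)) 0≤2)

  leibniz-IsCauchy : IsCauchy leibniz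
  leibniz-IsCauchy = tail-rate⇒IsCauchy 1ℚ leibniz λ m d → ≤-trans
    (alternating-tail (λ i → odd i ⁻¹) 0≤odd⁻¹ odd⁻¹-antitone m d)
    (≤-trans (odd⁻¹≤[1+n]⁻¹ m) (≤-reflexive (sym (*-identityˡ (fromℕ (suc m) ⁻¹)))))

  -- The row n = 0 is a filler.
  leibnizWeight : ℕ → ℕ → ℚ
  leibnizWeight zero    j = 1ℚ
  leibnizWeight (suc n) j = w (suc n) j * fromℕ (suc n ℕ.∸ j) * fromℕ (suc n) ⁻¹

  0≤leibnizWeight : ∀ n j → 0ℚ ≤ leibnizWeight n j
  0≤leibnizWeight zero    j = 0≤1
  0≤leibnizWeight (suc n) j = 0≤* (0≤* (0≤w (suc n) j) (0≤fromℕ (suc n ℕ.∸ j))) (0≤recip n)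

  leibnizWeight-antitone : ∀ n j → leibnizWeight n (suc j) ≤ leibnizWeight n j
  leibnizWeight-antitone zero    j = ≤-refl
  leibnizWeight-antitone (suc n) j = *-monoʳ (0≤recip n)
    (*-mono (0≤w (suc n) (suc j)) (0≤fromℕ (suc n ℕ.∸ j)) (w-antitone (suc n) j)
            (fromℕ-mono (ℕₚ.∸-monoʳ-≤ (suc n) (ℕₚ.n≤1+n j))))

  leibnizWeight≤1 : ∀ n j → leibnizWeight n j ≤ 1ℚ
  leibnizWeight≤1 zero    j       = ≤-refl
  leibnizWeight≤1 (suc n) zero    = ≤-reflexive (trans (cong (_* fromℕ (suc n) ⁻¹) (*-identityˡ (fromℕ (suc n)))) (p*p⁻¹ (0<1+fromℕ n)))
  leibnizWeight≤1 (suc n) (suc j) = ≤-trans (leibnizWeight-antitone (suc n) j) (leibnizWeight≤1 (suc n) j)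

  leibnizWeight→1 : ∀ j → (λ n → leibnizWeight n j) ≈ (λ _ → 1ℚ)
  leibnizWeight→1 j = ≈-trans (≈-suc (≈-rate (fromℕ j) λ n → begin
      ∣ w (suc n) j * fromℕ (suc n ℕ.∸ j) * fromℕ (suc n) ⁻¹ - w (suc n) j ∣
        ≡⟨ cong (λ a → ∣ a * fromℕ (suc n) ⁻¹ - w (suc n) j ∣) (w*[n∸j] (suc n) j) ⟩
      ∣ w (suc n) j * (fromℕ (suc n) - fromℕ j) * fromℕ (suc n) ⁻¹ - w (suc n) j ∣
        ≡⟨ cong ∣_∣ (linear₁ (w (suc n) j) (solve 4 (λ a m j i → a :* (m :- j) :* i :- a :- (:- (a :* (j :* i))) := a :* (m :* i :- con 1ℚ)) refl
             (w (suc n) j) (fromℕ (suc n)) (fromℕ j) (fromℕ (suc n) ⁻¹)) (p*p⁻¹ (0<1+fromℕ n))) ⟩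
      ∣ - (w (suc n) j * (fromℕ j * fromℕ (suc n) ⁻¹)) ∣
        ≡⟨ ∣-p∣≡∣p∣ (w (suc n) j * (fromℕ j * fromℕ (suc n) ⁻¹)) ⟩
      ∣ w (suc n) j * (fromℕ j * fromℕ (suc n) ⁻¹) ∣
        ≤⟨ ∣p*q∣≤∣q∣ (fromℕ j * fromℕ (suc n) ⁻¹) (0≤w (suc n) j) (w≤1 (suc n) j) ⟩
      ∣ fromℕ j * fromℕ (suc n) ⁻¹ ∣                       ≡⟨ 0≤p⇒∣p∣≡p (0≤* (0≤fromℕ j) (0≤recip n)) ⟩
      fromℕ j * fromℕ (suc n) ⁻¹                           ∎)) (w→1 j)
    where open ≤-Reasoning

  ∑-leibnizWeight : ∀ n → ∑ (suc n) (λ i → leibnizWeight (suc n) i * (sign i * odd i ⁻¹))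
    ≡ fromℕ (suc n) * (u n * u n)
  ∑-leibnizWeight n = begin
    ∑ (suc n) (λ i → leibnizWeight (suc n) i * (sign i * odd i ⁻¹))
      ≡⟨ ∑-cong (suc n) (λ j _ → trans (cong (λ a → a * i * (sign j * odd j ⁻¹)) (w*[n∸j] (suc n) j))
           (solve 4 (λ a i s o → a :* i :* (s :* o) := i :* (s :* a :* o)) refl (v (suc n) j) i (sign j) (odd j ⁻¹))) ⟩
    ∑ (suc n) (λ j → i * (sign j * v (suc n) j * odd j ⁻¹))
      ≡⟨ ∑-*ˡ (suc n) i (λ j → sign j * v (suc n) j * odd j ⁻¹) ⟩
    i * V (suc n)
      ≡⟨ cong (i *_) (V≡[1+n]²u² n) ⟩
    i * (fromℕ (suc n) * fromℕ (suc n) * (u n * u n))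
      ≡⟨ linear₁ (fromℕ (suc n) * (u n * u n)) (solve 3 (λ i m a → i :* (m :* m :* a) :- m :* a := m :* a :* (m :* i :- con 1ℚ)) refl
           i (fromℕ (suc n)) (u n * u n)) (p*p⁻¹ (0<1+fromℕ n)) ⟩
    fromℕ (suc n) * (u n * u n) ∎
    where
    open ≡-Reasoning
    i : ℚ
    i = fromℕ (suc n) ⁻¹

  -- Both sides tend to π/4.
  wallis≈leibniz : (λ n → fromℕ (suc n) * (u n * u n)) ≈ leibniz
  wallis≈leibniz = ≈-trans (≈-reflexive (λ n → sym (∑-leibnizWeight n)))
    (≈-trans (≈-shift (weighted-∑≈∑ leibnizWeight (λ i → sign i * odd i ⁻¹) 0≤leibnizWeight leibnizWeight≤1
               leibnizWeight-antitone leibnizWeight→1 leibniz-IsCauchy))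
             (≈-subsequence leibniz leibniz-IsCauchy suc ℕₚ.n≤1+n))

-- The sum of uₙ²/(2n+1) as an averaged Euler sum

module EulerSum where

  open import Data.Rational
  open import Data.Rational.Properties
  open import Data.Rational.Solver using (module +-*-Solver)
  open +-*-Solver
  open RationalLemmas
  open Sequences
  open Wallis

  q : ℕ → ℚ
  q j = odd j ⁻¹ * odd j ⁻¹

  O : ℕ → ℚ
  O k = ∑ k q

  euler : ℕ → ℚ
  euler i = 2ℚ * (sign i * O (suc i) * fromℕ (suc i) ⁻¹)

  -- Summation by parts. With T j = `sign j * v m j * odd j`, `w-step` gives T i - T (i+1) = 2(2m-1)
  -- · `sign i * fromℕ (suc i) * w m (suc i)`, while T j · `q j` is the summand of `V`.
  ∑-alternating-w-O : ∀ m k → 2ℚ * (2ℚ * fromℕ m - 1ℚ) * ∑ k (λ i → sign i * fromℕ (suc i) * w m (suc i) * O (suc i))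
    ≡ ∑ k (λ j → sign j * v m j * odd j ⁻¹) - sign k * v m k * odd k * O k
  ∑-alternating-w-O m zero    = solve 2 (λ m a → con 2ℚ :* (con 2ℚ :* m :- con 1ℚ) :* con 0ℚ := con 0ℚ :- a :* con 0ℚ)
    refl (fromℕ m) (sign 0 * v m 0 * odd 0)
  ∑-alternating-w-O m (suc k) = linear₃ 1ℚ (s * (i + odd k * O k)) (a′ * s * (M + K + 1ℚ) * i)
    (solve 9 (λ s m k P Q a a′ O i →
        con 2ℚ :* (con 2ℚ :* m :- con 1ℚ) :* (P :+ s :* (k :+ con 1ℚ) :* a′ :* (O :+ i :* i))
          :- (Q :+ s :* (a :* (m :- k)) :* i :- (:- s) :* (a′ :* (m :- (k :+ con 1ℚ))) :* (con 2ℚ :* (k :+ con 1ℚ) :+ con 1ℚ) :* (O :+ i :* i))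
        := con 1ℚ :* (con 2ℚ :* (con 2ℚ :* m :- con 1ℚ) :* P :- (Q :- s :* (a :* (m :- k)) :* (con 2ℚ :* k :+ con 1ℚ) :* O))
           :+ s :* (i :+ (con 2ℚ :* k :+ con 1ℚ) :* O) :* (a′ :* (m :+ k :+ con 1ℚ) :- a :* (m :- k))
           :+ a′ :* s :* (m :+ k :+ con 1ℚ) :* i :* ((con 2ℚ :* k :+ con 1ℚ) :* i :- con 1ℚ))
      refl s M K (∑ k (λ i → sign i * fromℕ (suc i) * w m (suc i) * O (suc i))) (∑ k (λ j → sign j * v m j * odd j ⁻¹))
        (w m k) a′ (O k) i)
    (∑-alternating-w-O m k) (w-step m k) (p*p⁻¹ (0<odd k))
    where
    s M K a′ i : ℚ
    s = sign k
    M = fromℕ m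
    K = fromℕ k
    a′ = w m (suc k)
    i = odd k ⁻¹

  X : ℕ → ℚ
  X n = ∑ n (λ i → u i * u i * odd i ⁻¹)

  Y : ℕ → ℚ
  Y n = ∑ n (λ i → w n (suc i) * euler i)

  -- By `w-row` the weights of `k = i + 1` in rows n+1 and n differ by k²/(n+1)² times the former.
  -- This cancels the 1/k in `euler` and leaves the sum of `∑-alternating-w-O`, whose boundary term
  -- vanishes and whose value is `V (suc n)`.
  Y-step : ∀ n → odd n * (Y (suc n) - Y n) ≡ u n * u n
  Y-step n = *-cancelˡ-≡ (M * M) (0<* (0<1+fromℕ n) (0<1+fromℕ n)) (begin
    M * M * (odd n * (Y (suc n) - Y n))
      ≡⟨ cong (λ z → M * M * (odd n * (Y (suc n) - z))) (sym extend) ⟩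
    M * M * (odd n * (Y (suc n) - ∑ (suc n) g))
      ≡⟨ cong (λ z → M * M * (odd n * z)) (sym (∑-- (suc n) f g)) ⟩
    M * M * (odd n * ∑ (suc n) (λ i → f i - g i))
      ≡⟨ solve 3 (λ a b c → a :* (b :* c) := b :* (a :* c)) refl (M * M) (odd n) (∑ (suc n) (λ i → f i - g i)) ⟩
    odd n * (M * M * ∑ (suc n) (λ i → f i - g i))
      ≡⟨ cong (odd n *_) (trans (sym (∑-*ˡ (suc n) (M * M) (λ i → f i - g i))) (trans (∑-cong (suc n) (λ i _ → term i)) (∑-*ˡ (suc n) 2ℚ p))) ⟩
    odd n * (2ℚ * ∑ (suc n) p)
      ≡⟨ solve 2 (λ n P → (con 2ℚ :* n :+ con 1ℚ) :* (con 2ℚ :* P) := con 2ℚ :* (con 2ℚ :* (n :+ con 1ℚ) :- con 1ℚ) :* P) refl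
           (fromℕ n) (∑ (suc n) p) ⟩
    2ℚ * (2ℚ * M - 1ℚ) * ∑ (suc n) p
      ≡⟨ ∑-alternating-w-O (suc n) (suc n) ⟩
    V (suc n) - sign (suc n) * v (suc n) (suc n) * odd (suc n) * O (suc n)
      ≡⟨ solve 6 (λ V s a m o O → V :- s :* (a :* (m :- m)) :* o :* O := V) refl
           (V (suc n)) (sign (suc n)) (w (suc n) (suc n)) M (odd (suc n)) (O (suc n)) ⟩
    V (suc n)
      ≡⟨ V≡[1+n]²u² n ⟩
    M * M * (u n * u n) ∎)
    where
    open ≡-Reasoning
    M : ℚ
    M = fromℕ (suc n)
    f g p : ℕ → ℚ
    f i = w (suc n) (suc i) * euler i
    g i = w n (suc i) * euler i
    p i = sign i * fromℕ (suc i) * w (suc n) (suc i) * O (suc i)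
    -- A further term of weight zero gives both sums the same length.
    extend : ∑ (suc n) g ≡ Y n
    extend = trans (cong (λ a → ∑ n g + a * euler n) (w-vanishes n (suc n) ℕₚ.≤-refl))
      (solve 2 (λ y e → y :+ con 0ℚ :* e := y) refl (Y n) (euler n))
    term : ∀ i → M * M * (f i - g i) ≡ 2ℚ * p i
    term i = linear₂ (euler i) (2ℚ * sign i * O (suc i) * w (suc n) (suc i) * fromℕ (suc i))
      (solve 7 (λ m k s O r a′ a →
          m :* m :* (a′ :* (con 2ℚ :* (s :* O :* r)) :- a :* (con 2ℚ :* (s :* O :* r))) :- con 2ℚ :* (s :* k :* a′ :* O)
          := con 2ℚ :* (s :* O :* r) :* (a′ :* ((m :- k) :* (m :+ k)) :- m :* m :* a)
             :+ con 2ℚ :* s :* O :* a′ :* k :* (k :* r :- con 1ℚ))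
        refl M (fromℕ (suc i)) (sign i) (O (suc i)) (fromℕ (suc i) ⁻¹) (w (suc n) (suc i)) (w n (suc i)))
      (w-row n (suc i)) (p*p⁻¹ (0<1+fromℕ i))

  -- Lagrange interpolation at m² = 4k², evaluated at m = 0, of the expansion of
  -- sin(mφ)/(m cos φ) in powers of sin φ leads to this identity.
  X≡Y : ∀ n → X n ≡ Y n
  X≡Y zero    = refl
  X≡Y (suc n) = linear₃ 1ℚ (- odd n ⁻¹) (Y (suc n) - Y n)
    (solve 6 (λ X Y Y′ U o i → X :+ U :* i :- Y′ :=
        con 1ℚ :* (X :- Y) :+ (:- i) :* (o :* (Y′ :- Y) :- U) :+ (Y′ :- Y) :* (o :* i :- con 1ℚ))
      refl (X n) (Y n) (Y (suc n)) (u n * u n) (odd n) (odd n ⁻¹))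
    (X≡Y n) (Y-step n) (p*p⁻¹ (0<odd n))

  recip≤1 : ∀ n → recip n ≤ 1ℚ
  recip≤1 n = ≤-trans (⁻¹-anti 0<1 (fromℕ-mono (ℕ.s≤s (ℕ.z≤n {n})))) (≤-reflexive 1⁻¹≡1)

  recip-antitone : ∀ n → recip (suc n) ≤ recip n
  recip-antitone n = ⁻¹-anti (0<1+fromℕ n) (fromℕ-mono (ℕₚ.n≤1+n (suc n)))

  recip²≤ : ∀ n → recip n * recip n ≤ 2ℚ * (recip n - recip (suc n))
  recip²≤ n = gap⇒≤ (linear₂ (2ℚ * recip (suc n) - 2ℚ * (recip (suc n) * recip n)) (recip n * recip n - 2ℚ * recip n)
      (solve 3 (λ n r r′ →
          con 2ℚ :* (r :- r′) :- r :* r :- n :* r :* r :* r′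
          := (con 2ℚ :* r′ :- con 2ℚ :* (r′ :* r)) :* ((n :+ con 1ℚ) :* r :- con 1ℚ)
             :+ (r :* r :- con 2ℚ :* r) :* ((n :+ con 1ℚ :+ con 1ℚ) :* r′ :- con 1ℚ))
        refl (fromℕ n) (recip n) (recip (suc n)))
      (p*p⁻¹ (0<1+fromℕ n)) (p*p⁻¹ (0<1+fromℕ (suc n))))
    (0≤* (0≤* (0≤* (0≤fromℕ n) (0≤recip n)) (0≤recip n)) (0≤recip (suc n)))

  -- Symmetrisation of the Euler sum

  altHarmonic : ℕ → ℚ
  altHarmonic n = ∑ n (λ d → sign d * recip d)

  catalan : ℕ → ℚ
  catalan n = ∑ n (λ i → sign i * q i)

  oddCubes : ℕ → ℚ
  oddCubes n = ∑ n (λ i → q i * odd i ⁻¹)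

  -- Exchange of summations: `q j` occurs in `O (suc i)` for all i ≥ j, and so is multiplied by
  -- `altHarmonic n - altHarmonic j`.
  ∑euler : ∀ n → ∑ n euler ≡ 2ℚ * (O n * altHarmonic n - ∑ n (λ j → q j * altHarmonic j))
  ∑euler zero    = refl
  ∑euler (suc n) = linear₁ 1ℚ
    (solve 7 (λ E O q s r a S →
        E :+ con 2ℚ :* (s :* (O :+ q) :* r) :- con 2ℚ :* ((O :+ q) :* (a :+ s :* r) :- (S :+ q :* a))
        := con 1ℚ :* (E :- con 2ℚ :* (O :* a :- S)))
      refl (∑ n euler) (O n) (q n) (sign n) (recip n) (altHarmonic n) (∑ n (λ j → q j * altHarmonic j)))
    (∑euler n)

  -- The sum of `q j` · (-1)^d/(d+1) over j < k < n, where d = k - j - 1. With `q k` in place of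
  -- `q j` the same sum is `∑ n (λ k → q k * altHarmonic k)`.
  reversed : ℕ → ℚ
  reversed n = ∑ n (λ j → q j * altHarmonic (n ℕ.∸ suc j))

  -- Partial fractions for 1/((2j+1)²(2n+1)) + 1/((2n+1)²(2j+1)), where n = m + 1 + j.
  partial-fraction : ∀ m j → let n = m ℕ.+ suc j in
    (q j - q n) * (sign m * recip m) ≡ - 2ℚ * sign n * (sign j * q j * odd n ⁻¹ + q n * (sign j * odd j ⁻¹))
  partial-fraction m j = trans
    (linear₂ ((iⱼ + iₙ) * r * sign m) (2ℚ * iⱼ * iₙ * (iⱼ + iₙ) * sign m)
      (solve 5 (λ a b s N r →
          (a :* a :- b :* b) :* (s :* r) :- con 2ℚ :* s :* (a :* a :* b :+ b :* b :* a)
          := (a :+ b) :* r :* s :* ((a :- b) :- con 2ℚ :* a :* b :* N) :+ con 2ℚ :* a :* b :* (a :+ b) :* s :* (N :* r :- con 1ℚ))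
        refl iⱼ iₙ (sign m) (fromℕ (suc m)) r)
      difference (p*p⁻¹ (0<1+fromℕ m)))
    (linear₂ (- 2ℚ * sign m * (iⱼ * iⱼ * iₙ + iₙ * iₙ * iⱼ)) (2ℚ * sign j * (iⱼ * iⱼ * iₙ + iₙ * iₙ * iⱼ))
      (solve 5 (λ a b s t z →
          con 2ℚ :* s :* (a :* a :* b :+ b :* b :* a) :- (:- con 2ℚ) :* z :* (t :* (a :* a) :* b :+ b :* b :* (t :* a))
          := (:- con 2ℚ) :* s :* (a :* a :* b :+ b :* b :* a) :* (t :* t :- con 1ℚ)
             :+ con 2ℚ :* t :* (a :* a :* b :+ b :* b :* a) :* (z :- s :* (:- t)))
        refl iⱼ iₙ (sign m) (sign j) (sign (m ℕ.+ suc j)))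
      (sign² j) (sign-+ m (suc j)))
    where
    iⱼ iₙ r : ℚ
    iⱼ = odd j ⁻¹
    iₙ = odd (m ℕ.+ suc j) ⁻¹
    r = recip m
    difference : iⱼ - iₙ ≡ 2ℚ * iⱼ * iₙ * fromℕ (suc m)
    difference = linear₃ iₙ (- iⱼ) (2ℚ * iⱼ * iₙ)
      (solve 5 (λ a b m j n →
          (a :- b) :- con 2ℚ :* a :* b :* (m :+ con 1ℚ)
          := b :* ((con 2ℚ :* j :+ con 1ℚ) :* a :- con 1ℚ) :+ (:- a) :* ((con 2ℚ :* n :+ con 1ℚ) :* b :- con 1ℚ)
             :+ con 2ℚ :* a :* b :* (n :- (m :+ (j :+ con 1ℚ))))
        refl iⱼ iₙ (fromℕ m) (fromℕ j) (fromℕ (m ℕ.+ suc j)))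
      (p*p⁻¹ (0<odd j)) (p*p⁻¹ (0<odd (m ℕ.+ suc j))) (fromℕ-+ m (suc j))

  reversed-step : ∀ n → reversed (suc n) ≡ reversed n + ∑ n (λ j → q j * (sign (n ℕ.∸ suc j) * recip (n ℕ.∸ suc j)))
  reversed-step n = begin
    ∑ n (λ j → q j * altHarmonic (n ℕ.∸ j)) + q n * altHarmonic (n ℕ.∸ n)
      ≡⟨ cong (λ k → ∑ n (λ j → q j * altHarmonic (n ℕ.∸ j)) + q n * altHarmonic k) (ℕₚ.n∸n≡0 n) ⟩
    ∑ n (λ j → q j * altHarmonic (n ℕ.∸ j)) + q n * 0ℚ
      ≡⟨ trans (cong (∑ n (λ j → q j * altHarmonic (n ℕ.∸ j)) +_) (*-zeroʳ (q n))) (+-identityʳ (∑ n (λ j → q j * altHarmonic (n ℕ.∸ j)))) ⟩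
    ∑ n (λ j → q j * altHarmonic (n ℕ.∸ j))
      ≡⟨ ∑-cong n (λ j j<n → trans (cong (λ k → q j * altHarmonic k) (ℕₚ.+-∸-assoc 1 j<n))
           (*-distribˡ-+ (q j) (altHarmonic (n ℕ.∸ suc j)) (sign (n ℕ.∸ suc j) * recip (n ℕ.∸ suc j)))) ⟩
    ∑ n (λ j → q j * altHarmonic (n ℕ.∸ suc j) + q j * (sign (n ℕ.∸ suc j) * recip (n ℕ.∸ suc j)))
      ≡⟨ ∑-+ n (λ j → q j * altHarmonic (n ℕ.∸ suc j)) (λ j → q j * (sign (n ℕ.∸ suc j) * recip (n ℕ.∸ suc j))) ⟩
    reversed n + ∑ n (λ j → q j * (sign (n ℕ.∸ suc j) * recip (n ℕ.∸ suc j))) ∎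
    where open ≡-Reasoning

  -- These are the pairs whose larger index is `n`. Reversing `altHarmonic n` indexes its terms by
  -- the smaller one, so that `partial-fraction` applies termwise and separates the two indices.
  cross-terms : ∀ n → ∑ n (λ j → q j * (sign (n ℕ.∸ suc j) * recip (n ℕ.∸ suc j))) - q n * altHarmonic n
    ≡ - 2ℚ * sign n * (catalan n * odd n ⁻¹ + q n * leibniz n)
  cross-terms n = begin
    ∑ n (λ j → q j * t j) - q n * altHarmonic n
      ≡⟨ cong (λ a → ∑ n (λ j → q j * t j) - a) (trans (cong (q n *_) (∑-reverse n (λ d → sign d * recip d))) (sym (∑-*ˡ n (q n) t))) ⟩
    ∑ n (λ j → q j * t j) - ∑ n (λ j → q n * t j)
      ≡⟨ sym (∑-- n (λ j → q j * t j) (λ j → q n * t j)) ⟩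
    ∑ n (λ j → q j * t j - q n * t j)
      ≡⟨ ∑-cong n (λ j j<n → trans (solve 3 (λ a b t → a :* t :- b :* t := (a :- b) :* t) refl (q j) (q n) (t j))
           (subst (λ k → (q j - q k) * t j ≡ - 2ℚ * sign k * (sign j * q j * odd k ⁻¹ + q k * (sign j * odd j ⁻¹)))
                  (ℕₚ.m∸n+n≡m j<n) (partial-fraction (n ℕ.∸ suc j) j))) ⟩
    ∑ n (λ j → - 2ℚ * sign n * (sign j * q j * odd n ⁻¹ + q n * (sign j * odd j ⁻¹)))
      ≡⟨ ∑-*ˡ n (- 2ℚ * sign n) (λ j → sign j * q j * odd n ⁻¹ + q n * (sign j * odd j ⁻¹)) ⟩
    - 2ℚ * sign n * ∑ n (λ j → sign j * q j * odd n ⁻¹ + q n * (sign j * odd j ⁻¹))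
      ≡⟨ cong (- 2ℚ * sign n *_) (trans (∑-+ n (λ j → sign j * q j * odd n ⁻¹) (λ j → q n * (sign j * odd j ⁻¹)))
           (cong₂ _+_ (∑-*ʳ n (odd n ⁻¹) (λ j → sign j * q j)) (∑-*ˡ n (q n) (λ j → sign j * odd j ⁻¹)))) ⟩
    - 2ℚ * sign n * (catalan n * odd n ⁻¹ + q n * leibniz n) ∎
    where
    open ≡-Reasoning
    t : ℕ → ℚ
    t j = sign (n ℕ.∸ suc j) * recip (n ℕ.∸ suc j)

  -- The off-diagonal terms of the product of the two series, paired by symmetry.
  2[C-GL] : ∀ n → 2ℚ * (oddCubes n - catalan n * leibniz n) ≡ reversed n - ∑ n (λ j → q j * altHarmonic j)
  2[C-GL] zero    = refl
  2[C-GL] (suc n) = linear₃ 1ℚ (- 1ℚ) (- (2ℚ * (i * i * i)))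
    (trans (cong (λ b → 2ℚ * (oddCubes (suc n) - catalan (suc n) * leibniz (suc n)) - (b - ∑ (suc n) (λ j → q j * altHarmonic j))) (reversed-step n))
    (solve 9 (λ C G L s i B T S a →
        con 2ℚ :* (C :+ i :* i :* i :- (G :+ s :* (i :* i)) :* (L :+ s :* i)) :- (B :+ T :- (S :+ i :* i :* a))
        := con 1ℚ :* (con 2ℚ :* (C :- G :* L) :- (B :- S))
           :+ (:- con 1ℚ) :* (T :- i :* i :* a :- (:- con 2ℚ) :* s :* (G :* i :+ i :* i :* L))
           :+ (:- (con 2ℚ :* (i :* i :* i))) :* (s :* s :- con 1ℚ))
      refl (oddCubes n) (catalan n) (leibniz n) (sign n) i (reversed n)
        (∑ n (λ j → q j * (sign (n ℕ.∸ suc j) * recip (n ℕ.∸ suc j)))) (∑ n (λ j → q j * altHarmonic j)) (altHarmonic n)))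
    (2[C-GL] n) (cross-terms n) (sign² n)
    where
    i : ℚ
    i = odd n ⁻¹

  -- The sum of `q j * altHarmonic j` occurs in both `2[C-GL]` and `∑euler` and cancels. What
  -- remains is small: either `q j` is small, or the tail of the alternating harmonic series starts
  -- late.
  4[C-GL]-∑euler : ∀ n → 4ℚ * (oddCubes n - catalan n * leibniz n) - ∑ n euler
    ≡ 2ℚ * ∑ n (λ j → q j * (altHarmonic (n ℕ.∸ suc j) - altHarmonic n))
  4[C-GL]-∑euler n = trans (linear₂ 2ℚ (- 1ℚ)
    (solve 6 (λ D E B S O a →
        con 4ℚ :* D :- E :- con 2ℚ :* (B :- O :* a)
        := con 2ℚ :* (con 2ℚ :* D :- (B :- S)) :+ (:- con 1ℚ) :* (E :- con 2ℚ :* (O :* a :- S)))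
      refl (oddCubes n - catalan n * leibniz n) (∑ n euler) (reversed n) (∑ n (λ j → q j * altHarmonic j)) (O n) (altHarmonic n))
    (2[C-GL] n) (∑euler n))
    (cong (2ℚ *_) (sym (trans
      (∑-cong n (λ j _ → solve 3 (λ q a b → q :* (a :- b) := q :* a :- q :* b) refl (q j) (altHarmonic (n ℕ.∸ suc j)) (altHarmonic n)))
      (trans (∑-- n (λ j → q j * altHarmonic (n ℕ.∸ suc j)) (λ j → q j * altHarmonic n))
             (cong (λ z → reversed n - z) (∑-*ʳ n (altHarmonic n) q))))))

  q≤recip² : ∀ j → q j ≤ recip j * recip j
  q≤recip² j = square-mono (0≤odd⁻¹ j) (odd⁻¹≤[1+n]⁻¹ j)

  0≤q : ∀ j → 0ℚ ≤ q j
  0≤q j = 0≤square (odd j ⁻¹)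

  ∑recip²≤2 : ∀ n → ∑ n (λ j → recip j * recip j) ≤ 2ℚ
  ∑recip²≤2 n = ≤-trans (∑≤telescoped 2ℚ (λ j → recip j * recip j) 0≤2 recip²≤ 0 n)
    (≤-reflexive (cong (2ℚ *_) 1⁻¹≡1))

  -- Two uses of 1/(xy) = (1/x + 1/y)/(x+y) with x = j+1 and y = m+1, which extract the factor
  -- 1/(x+y) that is common to all `j` of one sum.
  q*recip≤ : ∀ m j → q j * recip m ≤ (recip j * recip j + 2ℚ * recip (m ℕ.+ suc j)) * recip (m ℕ.+ suc j)
  q*recip≤ m j = begin
    q j * r                           ≤⟨ *-monoʳ (0≤recip m) (q≤recip² j) ⟩
    p * p * r                         ≡⟨ *-assoc p p r ⟩
    p * (p * r)                       ≡⟨ cong (p *_) split ⟩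
    p * ((p + r) * t)
      ≡⟨ solve 3 (λ p r t → p :* ((p :+ r) :* t) := (p :* p :+ p :* r) :* t) refl p r t ⟩
    (p * p + p * r) * t
      ≤⟨ *-monoʳ (0≤recip (m ℕ.+ suc j)) (+-monoʳ-≤ (p * p) (≤-trans (≤-reflexive split)
                                           (*-monoʳ (0≤recip (m ℕ.+ suc j)) (+-mono-≤ (recip≤1 j) (recip≤1 m))))) ⟩
    (p * p + 2ℚ * t) * t              ∎
    where
    open ≤-Reasoning
    p r t : ℚ
    p = recip j
    r = recip m
    t = recip (m ℕ.+ suc j)
    split : p * r ≡ (p + r) * t
    split = linear₃ (- (p * r)) (r * t) (p * t)
      (solve 5 (λ m j p r t →
          p :* r :- (p :+ r) :* t
          := (:- (p :* r)) :* ((m :+ (j :+ con 1ℚ) :+ con 1ℚ) :* t :- con 1ℚ)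
             :+ r :* t :* ((j :+ con 1ℚ) :* p :- con 1ℚ) :+ p :* t :* ((m :+ con 1ℚ) :* r :- con 1ℚ))
        refl (fromℕ m) (fromℕ j) p r t)
      (trans (cong (λ z → (z + 1ℚ) * t) (sym (fromℕ-+ m (suc j)))) (p*p⁻¹ (0<1+fromℕ (m ℕ.+ suc j))))
      (p*p⁻¹ (0<1+fromℕ j)) (p*p⁻¹ (0<1+fromℕ m))

  altHarmonic-tail : ∀ m j → ∣ altHarmonic m - altHarmonic (m ℕ.+ suc j) ∣ ≤ recip m
  altHarmonic-tail m j = ≤-trans (≤-reflexive (∣p-q∣≡∣q-p∣ (altHarmonic m) (altHarmonic (m ℕ.+ suc j))))
    (alternating-tail recip 0≤recip recip-antitone m (suc j))

  4[C-GL]≈∑euler : (λ n → 4ℚ * (oddCubes n - catalan n * leibniz n)) ≈ (λ n → ∑ n euler)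
  -- 8 = 2(2 + 2): the outer factor, the bound for the sum of 1/(j+1)², and `n` copies of 2/(n+1).
  4[C-GL]≈∑euler = ≈-rate 8ℚ λ n → begin
    ∣ 4ℚ * (oddCubes n - catalan n * leibniz n) - ∑ n euler ∣
      ≡⟨ cong ∣_∣ (4[C-GL]-∑euler n) ⟩
    ∣ 2ℚ * ∑ n (f n) ∣
      ≡⟨ ∣p*q∣≡∣p∣*∣q∣ 2ℚ (∑ n (f n)) ⟩
    2ℚ * ∣ ∑ n (f n) ∣
      ≤⟨ *-monoˡ 0≤2 (∣∑∣≤∑∣∣ n (f n)) ⟩
    2ℚ * ∑ n (λ j → ∣ f n j ∣)
      ≤⟨ *-monoˡ 0≤2 (∑-mono n (λ j j<n → subst
           (λ k → ∣ q j * (altHarmonic (n ℕ.∸ suc j) - altHarmonic k) ∣ ≤ (recip j * recip j + 2ℚ * recip k) * recip k)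
           (ℕₚ.m∸n+n≡m j<n) (bound (n ℕ.∸ suc j) j))) ⟩
    2ℚ * ∑ n (λ j → (recip j * recip j + 2ℚ * recip n) * recip n)
      ≡⟨ cong (2ℚ *_) (trans (∑-*ʳ n (recip n) (λ j → recip j * recip j + 2ℚ * recip n)) (cong (_* recip n)
           (trans (∑-+ n (λ j → recip j * recip j) (λ _ → 2ℚ * recip n)) (cong (∑ n (λ j → recip j * recip j) +_) (∑-const n (2ℚ * recip n)))))) ⟩
    2ℚ * ((∑ n (λ j → recip j * recip j) + fromℕ n * (2ℚ * recip n)) * recip n)
      ≤⟨ *-monoˡ 0≤2 (*-monoʳ (0≤recip n) (+-mono-≤ (∑recip²≤2 n) (n*recip≤ n))) ⟩
    2ℚ * ((2ℚ + 2ℚ) * recip n)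
      ≡⟨ solve 1 (λ r → con 2ℚ :* ((con 2ℚ :+ con 2ℚ) :* r) := con 8ℚ :* r) refl (recip n) ⟩
    8ℚ * recip n ∎
    where
    open ≤-Reasoning
    f : ℕ → ℕ → ℚ
    f n j = q j * (altHarmonic (n ℕ.∸ suc j) - altHarmonic n)
    bound : ∀ m j → ∣ q j * (altHarmonic m - altHarmonic (m ℕ.+ suc j)) ∣
      ≤ (recip j * recip j + 2ℚ * recip (m ℕ.+ suc j)) * recip (m ℕ.+ suc j)
    bound m j = ≤-trans (≤-reflexive (trans (∣p*q∣≡∣p∣*∣q∣ (q j) (altHarmonic m - altHarmonic (m ℕ.+ suc j)))
        (cong (_* ∣ altHarmonic m - altHarmonic (m ℕ.+ suc j) ∣) (0≤p⇒∣p∣≡p (0≤q j)))))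
      (≤-trans (*-monoˡ (0≤q j) (altHarmonic-tail m j)) (q*recip≤ m j))
    ∑-const : ∀ n c → ∑ n (λ _ → c) ≡ fromℕ n * c
    ∑-const zero    c = sym (*-zeroˡ c)
    ∑-const (suc n) c = trans (cong (_+ c) (∑-const n c)) (solve 2 (λ n c → n :* c :+ c := (n :+ con 1ℚ) :* c) refl (fromℕ n) c)
    n*recip≤ : ∀ n → fromℕ n * (2ℚ * recip n) ≤ 2ℚ
    n*recip≤ n = gap⇒≤ (linear₁ (- 2ℚ) (solve 2 (λ n r →
        con 2ℚ :- n :* (con 2ℚ :* r) :- con 2ℚ :* r := (:- con 2ℚ) :* ((n :+ con 1ℚ) :* r :- con 1ℚ)) refl (fromℕ n) (recip n))
        (p*p⁻¹ (0<1+fromℕ n)))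
      (0≤* 0≤2 (0≤recip n))

  recip³≤ : ∀ n → recip n * recip n * recip n ≤ 2ℚ * (recip n - recip (suc n))
  recip³≤ n = ≤-trans (≤-trans (*-monoˡ (0≤* (0≤recip n) (0≤recip n)) (recip≤1 n)) (≤-reflexive (*-identityʳ (recip n * recip n)))) (recip²≤ n)

  -- Convergence of the constituent series and the value of the Euler sum

  cubes : ℕ → ℚ
  cubes n = ∑ n (λ i → recip i * recip i * recip i)

  cubes-IsCauchy : IsCauchy cubes
  cubes-IsCauchy = ∑-IsCauchy 2ℚ (λ i → recip i * recip i * recip i) 0≤2
    (λ i → 0≤* (0≤* (0≤recip i) (0≤recip i)) (0≤recip i)) recip³≤

  catalan-IsCauchy : IsCauchy catalan
  catalan-IsCauchy = tail-rate⇒IsCauchy 1ℚ catalan λ m d → ≤-trans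
    (alternating-tail q 0≤q (λ i → square-mono (0≤odd⁻¹ (suc i)) (odd⁻¹-antitone i)) m d)
    (≤-trans (q≤recip² m) (≤-trans (*-monoʳ (0≤recip m) (recip≤1 m)) ≤-refl))

  double : ℕ → ℕ
  double zero    = zero
  double (suc n) = suc (suc (double n))

  n≤double : ∀ n → n ℕ.≤ double n
  n≤double zero    = ℕ.z≤n
  n≤double (suc n) = ℕ.s≤s (ℕₚ.m≤n⇒m≤1+n (n≤double n))

  fromℕ-double : ∀ n → fromℕ (double n) ≡ 2ℚ * fromℕ n
  fromℕ-double zero    = refl
  fromℕ-double (suc n) = trans (cong (λ k → k + 1ℚ + 1ℚ) (fromℕ-double n))
    (solve 1 (λ n → con 2ℚ :* n :+ con 1ℚ :+ con 1ℚ := con 2ℚ :* (n :+ con 1ℚ)) refl (fromℕ n))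

  ⅛ ⅞ : ℚ
  ⅛ = ℤ.+ 1 / 8
  ⅞ = ℤ.+ 7 / 8

  cubes-double : ∀ n → cubes (double n) ≡ oddCubes n + ⅛ * cubes n
  cubes-double zero    = refl
  cubes-double (suc n) = begin
    cubes (double n) + a * a * a + b * b * b
      ≡⟨ cong₂ (λ a b → cubes (double n) + a * a * a + b * b * b) a≡ b≡ ⟩
    cubes (double n) + i * i * i + (½ * r) * (½ * r) * (½ * r)
      ≡⟨ cong (λ c → c + i * i * i + (½ * r) * (½ * r) * (½ * r)) (cubes-double n) ⟩
    oddCubes n + ⅛ * cubes n + i * i * i + (½ * r) * (½ * r) * (½ * r)
      ≡⟨ solve 4 (λ C Z i r → C :+ con ⅛ :* Z :+ i :* i :* i :+ (con ½ :* r) :* (con ½ :* r) :* (con ½ :* r)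
           := C :+ i :* i :* i :+ con ⅛ :* (Z :+ r :* r :* r)) refl (oddCubes n) (cubes n) i r ⟩
    oddCubes n + i * i * i + ⅛ * (cubes n + r * r * r) ∎
    where
    open ≡-Reasoning
    a b i r : ℚ
    a = recip (double n)
    b = recip (suc (double n))
    i = odd n ⁻¹
    r = recip n
    a≡ : a ≡ i
    a≡ = cong (λ k → (k + 1ℚ) ⁻¹) (fromℕ-double n)
    b≡ : b ≡ ½ * r
    b≡ = trans (cong (λ k → (k + 1ℚ + 1ℚ) ⁻¹) (fromℕ-double n)) (sym (⁻¹-unique
      (0<+ (<⇒≤ (0<odd n)) 0<1)
      (linear₁ 1ℚ (solve 2 (λ n r → (con 2ℚ :* n :+ con 1ℚ :+ con 1ℚ) :* (con ½ :* r) :- con 1ℚ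
          := con 1ℚ :* ((n :+ con 1ℚ) :* r :- con 1ℚ)) refl (fromℕ n) r)
        (p*p⁻¹ (0<1+fromℕ n)))))

  -- The even denominators up to 2n contribute an eighth of `cubes n`, and `cubes (double n)` has
  -- the same limit as `cubes n`.
  oddCubes≈⅞cubes : oddCubes ≈ (λ n → ⅞ * cubes n)
  oddCubes≈⅞cubes = ≈-trans
    (≈-reflexive (λ n → linear₁ (- 1ℚ) (solve 3 (λ C D Z → C :- (D :+ con (- ⅛) :* Z) := (:- con 1ℚ) :* (D :- (C :+ con ⅛ :* Z)))
      refl (oddCubes n) (cubes (double n)) (cubes n)) (cubes-double n)))
    (≈-trans (≈-+ (≈-subsequence cubes cubes-IsCauchy double n≤double) (≈-refl {λ n → - ⅛ * cubes n}))
      (≈-reflexive (λ n → solve 1 (λ Z → Z :+ con (- ⅛) :* Z := con ⅞ :* Z) refl (cubes n))))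

  limit : ℕ → ℚ
  limit n = 4ℚ * (⅞ * cubes n - catalan n * leibniz n)

  -- `limit` is definitionally the sequence of a real built from three others, so the operations on
  -- ℝ supply the proof.
  limit-IsCauchy : IsCauchy limit
  limit-IsCauchy = R.cauchy (R.ι 4ℚ R.* (R.ι ⅞ R.* R.mkℝ cubes cubes-IsCauchy
    R.- R.mkℝ catalan catalan-IsCauchy R.* R.mkℝ leibniz leibniz-IsCauchy))

  ∑euler≈limit : (λ n → ∑ n euler) ≈ limit
  ∑euler≈limit = ≈-trans (≈-sym 4[C-GL]≈∑euler)
    (≈-*ˡ 4ℚ (≈-+ oddCubes≈⅞cubes (≈-refl {λ n → - (catalan n * leibniz n)})))

  -- The removal of the weights in `X≈limit` needs this, so the Euler sum has to be evaluated before
  -- it is averaged.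
  ∑euler-IsCauchy : IsCauchy (λ n → ∑ n euler)
  ∑euler-IsCauchy = IsCauchy-resp-≈ ∑euler≈limit limit-IsCauchy

  X≈limit : X ≈ limit
  X≈limit = ≈-trans (≈-reflexive X≡Y) (≈-trans
    (weighted-∑≈∑ (λ m i → w m (suc i)) euler (λ m i → 0≤w m (suc i)) (λ m i → w≤1 m (suc i))
      (λ m i → w-antitone m (suc i)) (λ i → w→1 (suc i)) ∑euler-IsCauchy)
    ∑euler≈limit)

-- The staircase with steps C(2k,k)/4ᵏ

module Circle where

  open import Data.Rational
  open import Data.Rational.Properties
  open import Data.Rational.Solver using (module +-*-Solver)
  open +-*-Solver
  open RationalLemmas
  open Sequences
  open Wallis

  -- a k = C(2k,k)/4ᵏ
  a : ℕ → ℚ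
  a zero    = 1ℚ
  a (suc k) = a k * odd k * (2ℚ * fromℕ (suc k)) ⁻¹

  private
    0<2+2k : ∀ k → 0ℚ < 2ℚ * fromℕ (suc k)
    0<2+2k k = 0<* 0<2 (0<1+fromℕ k)

  a-step : ∀ k → a (suc k) * (2ℚ * fromℕ (suc k)) ≡ a k * odd k
  a-step k = linear₁ (a k * odd k)
    (solve 3 (λ b o i → b :* i :* o :- b := b :* (o :* i :- con 1ℚ)) refl
      (a k * odd k) (2ℚ * fromℕ (suc k)) ((2ℚ * fromℕ (suc k)) ⁻¹))
    (p*p⁻¹ (0<2+2k k))

  0<a : ∀ k → 0ℚ < a k
  0<a zero    = 0<1
  0<a (suc k) = 0<* (0<* (0<a k) (0<odd k)) (0<p⁻¹ (0<2+2k k))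

  s : ℕ → ℚ
  s k = ∑ k a

  0≤s : ∀ k → 0ℚ ≤ s k
  0≤s k = 0≤∑ k (λ i → <⇒≤ (0<a i))

  s≡2k*a : ∀ k → s k ≡ 2ℚ * fromℕ k * a k
  s≡2k*a zero    = refl
  s≡2k*a (suc k) = linear₂ 1ℚ (- 1ℚ)
    (solve 4 (λ s k b b′ → s :+ b :- con 2ℚ :* (k :+ con 1ℚ) :* b′
        := con 1ℚ :* (s :- con 2ℚ :* k :* b) :+ (:- con 1ℚ) :* (b′ :* (con 2ℚ :* (k :+ con 1ℚ)) :- b :* (con 2ℚ :* k :+ con 1ℚ)))
      refl (s k) (fromℕ k) (a k) (a (suc k)))
    (s≡2k*a k) (a-step k)

  s-suc : ∀ k → s (suc k) ≡ odd k * a k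
  s-suc k = trans (cong (_+ a k) (s≡2k*a k))
    (solve 2 (λ k b → con 2ℚ :* k :* b :+ b := (con 2ℚ :* k :+ con 1ℚ) :* b) refl (fromℕ k) (a k))

  s*u≡1 : ∀ k → s (suc k) * u k ≡ 1ℚ
  s*u≡1 zero    = refl
  s*u≡1 (suc k) = trans (cong (_* u (suc k)) (s-suc (suc k))) (linear₂ 1ℚ (a (suc k))
    (solve 5 (λ U U′ o k b → o :* b :* U′ :- con 1ℚ :=
        con 1ℚ :* (con 2ℚ :* k :* b :* U :- con 1ℚ) :+ b :* (U′ :* o :- U :* (con 2ℚ :* k)))
      refl (u k) (u (suc k)) (odd (suc k)) (fromℕ (suc k)) (a (suc k)))
    (trans (cong (_* u k) (sym (s≡2k*a (suc k)))) (s*u≡1 k)) (u-step k))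

  convolution : ℕ → ℚ
  convolution n = ∑ (suc n) (λ k → a k * a (n ℕ.∸ k))

  -- The finite form of 2(1 - x)A′ = A for the generating function A of `a`. The symmetry k ↔ n - k
  -- and the recurrence `a-step` give two values for twice the moment at n + 1; comparing them shows
  -- that the convolution does not depend on `n`.
  moment : ℕ → ℚ
  moment n = ∑ (suc n) (λ k → fromℕ k * (a k * a (n ℕ.∸ k)))

  2*moment : ∀ n → 2ℚ * moment n ≡ fromℕ n * convolution n
  2*moment n = begin
    2ℚ * moment n                    ≡⟨ solve 1 (λ m → con 2ℚ :* m := m :+ m) refl (moment n) ⟩
    moment n + moment n
      ≡⟨ cong (moment n +_) (∑-reverse (suc n) (λ k → fromℕ k * (a k * a (n ℕ.∸ k)))) ⟩
    moment n + ∑ (suc n) (λ k → fromℕ (n ℕ.∸ k) * (a (n ℕ.∸ k) * a (n ℕ.∸ (n ℕ.∸ k))))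
      ≡⟨ sym (∑-+ (suc n) (λ k → fromℕ k * (a k * a (n ℕ.∸ k))) (λ k → fromℕ (n ℕ.∸ k) * (a (n ℕ.∸ k) * a (n ℕ.∸ (n ℕ.∸ k))))) ⟩
    ∑ (suc n) (λ k → fromℕ k * (a k * a (n ℕ.∸ k)) + fromℕ (n ℕ.∸ k) * (a (n ℕ.∸ k) * a (n ℕ.∸ (n ℕ.∸ k))))
      ≡⟨ ∑-cong (suc n) (λ { k (ℕ.s≤s k≤n) → trans
           (cong₂ (λ x y → fromℕ k * (a k * a (n ℕ.∸ k)) + x * (a (n ℕ.∸ k) * a y)) (fromℕ-∸ k≤n) (ℕₚ.m∸[m∸n]≡n k≤n))
           (solve 4 (λ k n b c → k :* (b :* c) :+ (n :- k) :* (c :* b) := n :* (b :* c)) refl (fromℕ k) (fromℕ n) (a k) (a (n ℕ.∸ k))) }) ⟩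
    ∑ (suc n) (λ k → fromℕ n * (a k * a (n ℕ.∸ k)))
      ≡⟨ ∑-*ˡ (suc n) (fromℕ n) (λ k → a k * a (n ℕ.∸ k)) ⟩
    fromℕ n * convolution n          ∎
    where open ≡-Reasoning

  2*moment-suc : ∀ n → 2ℚ * moment (suc n) ≡ fromℕ (suc n) * convolution n
  2*moment-suc n = begin
    2ℚ * moment (suc n)
      ≡⟨ cong (2ℚ *_) (∑-head (suc n) (λ k → fromℕ k * (a k * a (suc n ℕ.∸ k)))) ⟩
    2ℚ * (0ℚ * (1ℚ * a (suc n)) + ∑ (suc n) (λ k → fromℕ (suc k) * (a (suc k) * a (n ℕ.∸ k))))
      ≡⟨ solve 2 (λ b m → con 2ℚ :* (con 0ℚ :* b :+ m) := con 2ℚ :* m) refl (1ℚ * a (suc n)) (∑ (suc n) (λ k → fromℕ (suc k) * (a (suc k) * a (n ℕ.∸ k)))) ⟩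
    2ℚ * ∑ (suc n) (λ k → fromℕ (suc k) * (a (suc k) * a (n ℕ.∸ k)))
      ≡⟨ sym (∑-*ˡ (suc n) 2ℚ (λ k → fromℕ (suc k) * (a (suc k) * a (n ℕ.∸ k)))) ⟩
    ∑ (suc n) (λ k → 2ℚ * (fromℕ (suc k) * (a (suc k) * a (n ℕ.∸ k))))
      ≡⟨ ∑-cong (suc n) (λ k _ → linear₁ (a (n ℕ.∸ k)) (solve 4 (λ k b′ b c →
           con 2ℚ :* ((k :+ con 1ℚ) :* (b′ :* c)) :- (con 2ℚ :* (k :* (b :* c)) :+ b :* c)
           := c :* (b′ :* (con 2ℚ :* (k :+ con 1ℚ)) :- b :* (con 2ℚ :* k :+ con 1ℚ)))
           refl (fromℕ k) (a (suc k)) (a k) (a (n ℕ.∸ k))) (a-step k)) ⟩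
    ∑ (suc n) (λ k → 2ℚ * (fromℕ k * (a k * a (n ℕ.∸ k))) + a k * a (n ℕ.∸ k))
      ≡⟨ ∑-+ (suc n) (λ k → 2ℚ * (fromℕ k * (a k * a (n ℕ.∸ k)))) (λ k → a k * a (n ℕ.∸ k)) ⟩
    ∑ (suc n) (λ k → 2ℚ * (fromℕ k * (a k * a (n ℕ.∸ k)))) + convolution n
      ≡⟨ cong (_+ convolution n) (trans (∑-*ˡ (suc n) 2ℚ (λ k → fromℕ k * (a k * a (n ℕ.∸ k)))) (2*moment n)) ⟩
    fromℕ n * convolution n + convolution n
      ≡⟨ solve 2 (λ n c → n :* c :+ c := (n :+ con 1ℚ) :* c) refl (fromℕ n) (convolution n) ⟩
    fromℕ (suc n) * convolution n ∎
    where open ≡-Reasoning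

  convolution≡1 : ∀ n → convolution n ≡ 1ℚ
  convolution≡1 zero    = refl
  convolution≡1 (suc n) = trans
    (*-cancelˡ-≡ (fromℕ (suc n)) (0<1+fromℕ n) (trans (sym (2*moment (suc n))) (2*moment-suc n)))
    (convolution≡1 n)

  -- The rectangles a k × a l at (s k , s l) with k + l = n have total area 1, and
  -- their corners all lie near one circle.
  staircase-area : ∀ m → ∑ m (λ k → a k * s (m ℕ.∸ k)) ≡ fromℕ m
  staircase-area zero    = refl
  staircase-area (suc m) = begin
    ∑ (suc m) (λ k → a k * s (suc m ℕ.∸ k))
      ≡⟨ ∑-cong (suc m) (λ { k (ℕ.s≤s k≤m) → trans (cong (λ d → a k * s d) (ℕₚ.+-∸-assoc 1 k≤m))
           (*-distribˡ-+ (a k) (s (m ℕ.∸ k)) (a (m ℕ.∸ k))) }) ⟩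
    ∑ (suc m) (λ k → a k * s (m ℕ.∸ k) + a k * a (m ℕ.∸ k))
      ≡⟨ ∑-+ (suc m) (λ k → a k * s (m ℕ.∸ k)) (λ k → a k * a (m ℕ.∸ k)) ⟩
    ∑ m (λ k → a k * s (m ℕ.∸ k)) + a m * s (m ℕ.∸ m) + convolution m
      ≡⟨ cong₂ _+_ (cong₂ _+_ (staircase-area m) (trans (cong (λ d → a m * s d) (ℕₚ.n∸n≡0 m)) (*-zeroʳ (a m)))) (convolution≡1 m) ⟩
    fromℕ m + 0ℚ + 1ℚ
      ≡⟨ cong (_+ 1ℚ) (+-identityʳ (fromℕ m)) ⟩
    fromℕ (suc m) ∎
    where open ≡-Reasoning

  -- Squared radii. `f m`/m increases and `f m`/(2m-1) decreases for positive `m`, so `f` is nearly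
  -- linear; hence corners with k + l fixed are nearly at one distance from the origin.
  f : ℕ → ℚ
  f k = s k * s k

  f-ratio-increasing : ∀ m → fromℕ (suc m) * f m ≤ fromℕ m * f (suc m)
  f-ratio-increasing m = gap⇒≤
    (trans (cong₂ (λ x y → fromℕ m * (x * x) - fromℕ (suc m) * (y * y)) (s-suc m) (s≡2k*a m))
      (solve 2 (λ m b → m :* ((con 2ℚ :* m :+ con 1ℚ) :* b :* ((con 2ℚ :* m :+ con 1ℚ) :* b)) :- (m :+ con 1ℚ) :* (con 2ℚ :* m :* b :* (con 2ℚ :* m :* b))
        := m :* (b :* b)) refl (fromℕ m) (a m)))
    (0≤* (0≤fromℕ m) (0≤square (a m)))

  f-ratio-decreasing : ∀ m → (2ℚ * fromℕ m - 1ℚ) * f (suc m) ≤ odd m * f m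
  f-ratio-decreasing m = gap⇒≤
    (trans (cong₂ (λ x y → odd m * (y * y) - (2ℚ * fromℕ m - 1ℚ) * (x * x)) (s-suc m) (s≡2k*a m))
      (solve 2 (λ m b → (con 2ℚ :* m :+ con 1ℚ) :* (con 2ℚ :* m :* b :* (con 2ℚ :* m :* b))
          :- (con 2ℚ :* m :- con 1ℚ) :* ((con 2ℚ :* m :+ con 1ℚ) :* b :* ((con 2ℚ :* m :+ con 1ℚ) :* b))
        := (con 2ℚ :* m :+ con 1ℚ) :* (b :* b)) refl (fromℕ m) (a m)))
    (0≤* (<⇒≤ (0<odd m)) (0≤square (a m)))

  0≤f : ∀ k → 0ℚ ≤ f k
  0≤f k = 0≤square (s k)

  f-upper : ∀ {k m} → k ℕ.≤′ m → fromℕ m * f k ≤ fromℕ k * f m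
  f-upper ℕ.≤′-refl = ≤-refl
  f-upper {zero}  {suc m} (ℕ.≤′-step k≤m) = ≤-reflexive (trans (*-zeroʳ (fromℕ (suc m))) (sym (*-zeroˡ (f (suc m)))))
  f-upper {suc k} {suc m} (ℕ.≤′-step k≤m) = *-cancelˡ-≤ (fromℕ m) 0<m (begin
    fromℕ m * (fromℕ (suc m) * f (suc k))
      ≡⟨ solve 3 (λ a b c → a :* (b :* c) := b :* (a :* c)) refl (fromℕ m) (fromℕ (suc m)) (f (suc k)) ⟩
    fromℕ (suc m) * (fromℕ m * f (suc k))       ≤⟨ *-monoˡ (0≤fromℕ (suc m)) (f-upper k≤m) ⟩
    fromℕ (suc m) * (fromℕ (suc k) * f m)
      ≡⟨ solve 3 (λ a b c → a :* (b :* c) := b :* (a :* c)) refl (fromℕ (suc m)) (fromℕ (suc k)) (f m) ⟩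
    fromℕ (suc k) * (fromℕ (suc m) * f m)       ≤⟨ *-monoˡ (0≤fromℕ (suc k)) (f-ratio-increasing m) ⟩
    fromℕ (suc k) * (fromℕ m * f (suc m))
      ≡⟨ solve 3 (λ a b c → a :* (b :* c) := b :* (a :* c)) refl (fromℕ (suc k)) (fromℕ m) (f (suc m)) ⟩
    fromℕ m * (fromℕ (suc k) * f (suc m))       ∎)
    where
    open ≤-Reasoning
    0<m : 0ℚ < fromℕ m
    0<m = <-≤-trans (0<1+fromℕ k) (fromℕ-mono (ℕₚ.≤′⇒≤ k≤m))

  0<2m-1 : ∀ {m} → 0 ℕ.< m → 0ℚ < 2ℚ * fromℕ m - 1ℚ
  0<2m-1 {suc m} _ = subst (0ℚ <_) (solve 1 (λ m → con 2ℚ :* m :+ con 1ℚ := con 2ℚ :* (m :+ con 1ℚ) :- con 1ℚ) refl (fromℕ m)) (0<odd m)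

  f-lower : ∀ {k m} → 0 ℕ.< m → k ℕ.≤′ m → (2ℚ * fromℕ k - 1ℚ) * f m ≤ (2ℚ * fromℕ m - 1ℚ) * f k
  f-lower _ ℕ.≤′-refl = ≤-refl
  f-lower {zero}  {suc m} _ (ℕ.≤′-step k≤m) = gap⇒≤
    (solve 2 (λ m f → (con 2ℚ :* m :- con 1ℚ) :* con 0ℚ :- (con 2ℚ :* con 0ℚ :- con 1ℚ) :* f := f) refl (fromℕ (suc m)) (f (suc m)))
    (0≤f (suc m))
  f-lower {suc k} {suc m} _ (ℕ.≤′-step k≤m) = *-cancelˡ-≤ p (0<2m-1 0<m) (begin
    p * (κ * f (suc m))             ≡⟨ solve 3 (λ a b c → a :* (b :* c) := b :* (a :* c)) refl p κ (f (suc m)) ⟩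
    κ * (p * f (suc m))             ≤⟨ *-monoˡ (<⇒≤ (0<2m-1 {suc k} (ℕ.s≤s ℕ.z≤n))) (f-ratio-decreasing m) ⟩
    κ * (odd m * f m)               ≡⟨ solve 3 (λ a b c → a :* (b :* c) := b :* (a :* c)) refl κ (odd m) (f m) ⟩
    odd m * (κ * f m)               ≤⟨ *-monoˡ (<⇒≤ (0<odd m)) (f-lower 0<m k≤m) ⟩
    odd m * (p * f (suc k))         ≡⟨ solve 2 (λ m f → (con 2ℚ :* m :+ con 1ℚ) :* ((con 2ℚ :* m :- con 1ℚ) :* f)
                                         := (con 2ℚ :* m :- con 1ℚ) :* ((con 2ℚ :* (m :+ con 1ℚ) :- con 1ℚ) :* f)) refl (fromℕ m) (f (suc k)) ⟩
    p * ((2ℚ * fromℕ (suc m) - 1ℚ) * f (suc k)) ∎)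
    where
    open ≤-Reasoning
    0<m : 0 ℕ.< m
    0<m = ℕₚ.≤-trans (ℕ.s≤s ℕ.z≤n) (ℕₚ.≤′⇒≤ k≤m)
    p κ : ℚ
    p = 2ℚ * fromℕ m - 1ℚ
    κ = 2ℚ * fromℕ (suc k) - 1ℚ

  -- From `f k` ≤ (k/m) `f m` and the same for `l`. It keeps outer corners of the staircase inside a
  -- disc.
  f-superadditive : ∀ {k l m} → k ℕ.+ l ℕ.≤ m → f k + f l ≤ f m
  f-superadditive {zero}  {zero} {zero} h = ≤-refl
  f-superadditive {suc k} {l}    {zero} ()
  f-superadditive {k} {l} {suc m} h = *-cancelˡ-≤ (fromℕ (suc m)) (0<1+fromℕ m) (begin
    fromℕ (suc m) * (f k + f l)                     ≡⟨ *-distribˡ-+ (fromℕ (suc m)) (f k) (f l) ⟩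
    fromℕ (suc m) * f k + fromℕ (suc m) * f l       ≤⟨ +-mono-≤ (f-upper (ℕₚ.≤⇒≤′ (ℕₚ.≤-trans (ℕₚ.m≤m+n k l) h)))
                                                         (f-upper (ℕₚ.≤⇒≤′ (ℕₚ.≤-trans (ℕₚ.m≤n+m l k) h))) ⟩
    fromℕ k * f (suc m) + fromℕ l * f (suc m)
      ≡⟨ trans (sym (*-distribʳ-+ (f (suc m)) (fromℕ k) (fromℕ l))) (cong (_* f (suc m)) (sym (fromℕ-+ k l))) ⟩
    fromℕ (k ℕ.+ l) * f (suc m)                     ≤⟨ *-monoʳ (0≤f (suc m)) (fromℕ-mono h) ⟩
    fromℕ (suc m) * f (suc m)                       ∎)
    where open ≤-Reasoning

  -- Adding `f-lower` for `k` and `l` gives the numerator 2(k+l) - 2 ≥ 2m over 2m + 1. The lost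
  -- factor 2m/(2m+1) has to be made up by rescaling.
  f-sum-lower : ∀ {k l m} → k ℕ.≤ suc m → l ℕ.≤ suc m → suc m ℕ.≤ k ℕ.+ l →
    2ℚ * fromℕ m * f (suc m) ≤ odd m * (f k + f l)
  f-sum-lower {k} {l} {m} k≤ l≤ h = begin
    2ℚ * fromℕ m * F
      ≡⟨ solve 2 (λ m F → con 2ℚ :* m :* F := (con 2ℚ :* (m :+ con 1ℚ) :- con 2ℚ) :* F) refl (fromℕ m) F ⟩
    (2ℚ * fromℕ (suc m) - 2ℚ) * F
      ≤⟨ *-monoʳ (0≤f (suc m)) (+-monoˡ-≤ (- 2ℚ) (*-monoˡ 0≤2 (fromℕ-mono h))) ⟩
    (2ℚ * fromℕ (k ℕ.+ l) - 2ℚ) * F               ≡⟨ trans (cong (λ z → (2ℚ * z - 2ℚ) * F) (fromℕ-+ k l))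
                                                       (solve 3 (λ k l F → (con 2ℚ :* (k :+ l) :- con 2ℚ) :* F := (con 2ℚ :* k :- con 1ℚ) :* F :+ (con 2ℚ :* l :- con 1ℚ) :* F)
                                                         refl (fromℕ k) (fromℕ l) F) ⟩
    (2ℚ * fromℕ k - 1ℚ) * F + (2ℚ * fromℕ l - 1ℚ) * F
                                                  ≤⟨ +-mono-≤ (f-lower (ℕ.s≤s ℕ.z≤n) (ℕₚ.≤⇒≤′ k≤)) (f-lower (ℕ.s≤s ℕ.z≤n) (ℕₚ.≤⇒≤′ l≤)) ⟩
    (2ℚ * fromℕ (suc m) - 1ℚ) * f k + (2ℚ * fromℕ (suc m) - 1ℚ) * f l
                                                  ≡⟨ solve 3 (λ m a b → (con 2ℚ :* (m :+ con 1ℚ) :- con 1ℚ) :* a :+ (con 2ℚ :* (m :+ con 1ℚ) :- con 1ℚ) :* b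
                                                       := (con 2ℚ :* m :+ con 1ℚ) :* (a :+ b)) refl (fromℕ m) (f k) (f l) ⟩
    odd m * (f k + f l)                           ∎
    where
    open ≤-Reasoning
    F : ℚ
    F = f (suc m)

  s-mono : ∀ {k m} → k ℕ.≤′ m → s k ≤ s m
  s-mono ℕ.≤′-refl           = ≤-refl
  s-mono {m = suc m} (ℕ.≤′-step h) = ≤-trans (s-mono h) (subst (_≤ s (suc m)) (+-identityʳ (s m)) (+-monoʳ-≤ (s m) (<⇒≤ (0<a m))))

-- Comparison of grid cells with staircase rectangles

module Grid where

  open import Data.Rational
  open import Data.Rational.Properties
  open import Data.Rational.Solver using (module +-*-Solver)
  open +-*-Solver
  open RationalLemmas
  open Sequences
  open Wallis
  open Circle

  𝟙 : ∀ {P : Set} → Dec P → ℚ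
  𝟙 (yes _) = 1ℚ
  𝟙 (no _)  = 0ℚ

  0≤𝟙 : ∀ {P : Set} (d : Dec P) → 0ℚ ≤ 𝟙 d
  0≤𝟙 (yes _) = 0≤1
  0≤𝟙 (no _)  = ≤-refl

  𝟙-true : ∀ {P : Set} (d : Dec P) → P → 𝟙 d ≡ 1ℚ
  𝟙-true (yes _) _ = refl
  𝟙-true (no ¬p) p = contradiction p ¬p

  𝟙-false : ∀ {P : Set} (d : Dec P) → ¬ P → 𝟙 d ≡ 0ℚ
  𝟙-false (yes p) ¬p = contradiction p ¬p
  𝟙-false (no _)  _  = refl

  ∑ₗ : ∀ {A : Set} → List A → (A → ℚ) → ℚ
  ∑ₗ []       g = 0ℚ
  ∑ₗ (x ∷ xs) g = g x + ∑ₗ xs g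

  ∑ₗ-++ : ∀ {A : Set} (xs ys : List A) g → ∑ₗ (xs ++ ys) g ≡ ∑ₗ xs g + ∑ₗ ys g
  ∑ₗ-++ []       ys g = sym (+-identityˡ (∑ₗ ys g))
  ∑ₗ-++ (x ∷ xs) ys g = trans (cong (g x +_) (∑ₗ-++ xs ys g)) (sym (+-assoc (g x) (∑ₗ xs g) (∑ₗ ys g)))

  ∑ₗ-map : ∀ {A B : Set} (h : A → B) xs g → ∑ₗ (List.map h xs) g ≡ ∑ₗ xs (λ x → g (h x))
  ∑ₗ-map h []       g = refl
  ∑ₗ-map h (x ∷ xs) g = cong (g (h x) +_) (∑ₗ-map h xs g)

  ∑ₗ-cartesianProduct : ∀ {A B : Set} (xs : List A) (ys : List B) g →
    ∑ₗ (cartesianProduct xs ys) g ≡ ∑ₗ xs (λ x → ∑ₗ ys (λ y → g (x , y)))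
  ∑ₗ-cartesianProduct []       ys g = refl
  ∑ₗ-cartesianProduct (x ∷ xs) ys g = trans (∑ₗ-++ (List.map (x ,_) ys) (cartesianProduct xs ys) g)
    (cong₂ _+_ (∑ₗ-map (x ,_) ys g) (∑ₗ-cartesianProduct xs ys g))

  ∑ₗ-applyUpTo : ∀ {A : Set} (h : ℕ → A) n g → ∑ₗ (applyUpTo h n) g ≡ ∑ n (λ i → g (h i))
  ∑ₗ-applyUpTo h zero    g = refl
  ∑ₗ-applyUpTo h (suc n) g = trans (cong (g (h 0) +_) (∑ₗ-applyUpTo (λ i → h (suc i)) n g)) (sym (∑-head n (λ i → g (h i))))

  length-filter : ∀ {A : Set} {P : Pred A _} (P? : Decidable P) xs →
    fromℕ (length (filter P? xs)) ≡ ∑ₗ xs (λ x → 𝟙 (P? x))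
  length-filter P? []       = refl
  length-filter P? (x ∷ xs) with P? x
  ... | yes _ = trans (cong (_+ 1ℚ) (length-filter P? xs)) (+-comm (∑ₗ xs (λ x → 𝟙 (P? x))) 1ℚ)
  ... | no _  = trans (length-filter P? xs) (sym (+-identityˡ (∑ₗ xs (λ x → 𝟙 (P? x)))))

  inDisc : ℕ → ℕ → ℕ → ℚ
  inDisc n i j = 𝟙 (suc i ℕ.^ 2 ℕ.+ suc j ℕ.^ 2 ℕ.≤? n ℕ.^ 2)

  cells≡∑inDisc : ∀ n → fromℕ (cellsInQuarterDisc n) ≡ ∑ n (λ i → ∑ n (λ j → inDisc n i j))
  cells≡∑inDisc n = trans
    (length-filter (λ (i , j) → suc i ℕ.^ 2 ℕ.+ suc j ℕ.^ 2 ℕ.≤? n ℕ.^ 2) (cartesianProduct (upTo n) (upTo n)))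
    (trans (∑ₗ-cartesianProduct (upTo n) (upTo n) _)
    (trans (∑ₗ-applyUpTo (λ i → i) n _)
           (∑-cong n (λ i _ → ∑ₗ-applyUpTo (λ j → j) n _))))

  ∑-product : ∀ m n g h → ∑ m g * ∑ n h ≡ ∑ m (λ k → ∑ n (λ l → g k * h l))
  ∑-product m n g h = trans (sym (∑-*ʳ m (∑ n h) g)) (∑-cong m (λ k _ → sym (∑-*ˡ n (g k) h)))

  ∑-swap₄ : ∀ n m (G : ℕ → ℕ → ℕ → ℕ → ℚ) →
    ∑ n (λ i → ∑ n (λ j → ∑ m (λ k → ∑ m (λ l → G i j k l)))) ≡
    ∑ m (λ k → ∑ m (λ l → ∑ n (λ i → ∑ n (λ j → G i j k l))))
  ∑-swap₄ n m G = begin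
    ∑ n (λ i → ∑ n (λ j → ∑ m (λ k → ∑ m (λ l → G i j k l))))
      ≡⟨ ∑-cong n (λ i _ → ∑-swap n m (λ j k → ∑ m (λ l → G i j k l))) ⟩
    ∑ n (λ i → ∑ m (λ k → ∑ n (λ j → ∑ m (λ l → G i j k l))))
      ≡⟨ ∑-swap n m (λ i k → ∑ n (λ j → ∑ m (λ l → G i j k l))) ⟩
    ∑ m (λ k → ∑ n (λ i → ∑ n (λ j → ∑ m (λ l → G i j k l))))
      ≡⟨ ∑-cong m (λ k _ → trans (∑-cong n (λ i _ → ∑-swap n m (λ j l → G i j k l)))
                                 (∑-swap n m (λ i l → ∑ n (λ j → G i j k l)))) ⟩
    ∑ m (λ k → ∑ m (λ l → ∑ n (λ i → ∑ n (λ j → G i j k l)))) ∎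
    where open ≡-Reasoning

  -- Two unions of boxes from different product partitions, with indicators χ and
  -- θ: if boxes of χ meet only boxes of θ, then the area of χ is at most that of θ.
  overlap-≤ : ∀ n m (ℓ : ℕ → ℕ → ℚ) (χ θ : ℕ → ℕ → ℚ) →
    (∀ i j k l → i ℕ.< n → j ℕ.< n → k ℕ.< m → l ℕ.< m → χ i j * (ℓ i k * ℓ j l) ≤ θ k l * (ℓ i k * ℓ j l)) →
    ∑ n (λ i → ∑ n (λ j → χ i j * (∑ m (ℓ i) * ∑ m (ℓ j)))) ≤
    ∑ m (λ k → ∑ m (λ l → θ k l * (∑ n (λ i → ℓ i k) * ∑ n (λ i → ℓ i l))))
  overlap-≤ n m ℓ χ θ h = begin
    ∑ n (λ i → ∑ n (λ j → χ i j * (∑ m (ℓ i) * ∑ m (ℓ j))))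
      ≡⟨ ∑-cong n (λ i _ → ∑-cong n (λ j _ → expand m (χ i j) (ℓ i) (ℓ j))) ⟩
    ∑ n (λ i → ∑ n (λ j → ∑ m (λ k → ∑ m (λ l → χ i j * (ℓ i k * ℓ j l)))))
      ≤⟨ ∑-mono n (λ i i< → ∑-mono n (λ j j< → ∑-mono m (λ k k< → ∑-mono m (λ l l< → h i j k l i< j< k< l<)))) ⟩
    ∑ n (λ i → ∑ n (λ j → ∑ m (λ k → ∑ m (λ l → θ k l * (ℓ i k * ℓ j l)))))
      ≡⟨ ∑-swap₄ n m (λ i j k l → θ k l * (ℓ i k * ℓ j l)) ⟩
    ∑ m (λ k → ∑ m (λ l → ∑ n (λ i → ∑ n (λ j → θ k l * (ℓ i k * ℓ j l)))))
      ≡⟨ ∑-cong m (λ k _ → ∑-cong m (λ l _ → sym (expand n (θ k l) (λ i → ℓ i k) (λ j → ℓ j l)))) ⟩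
    ∑ m (λ k → ∑ m (λ l → θ k l * (∑ n (λ i → ℓ i k) * ∑ n (λ i → ℓ i l)))) ∎
    where
    open ≤-Reasoning
    expand : ∀ m c g h → c * (∑ m g * ∑ m h) ≡ ∑ m (λ k → ∑ m (λ l → c * (g k * h l)))
    expand m c g h = trans (cong (c *_) (∑-product m m g h)) (trans (sym (∑-*ˡ m c (λ k → ∑ m (λ l → g k * h l))))
      (∑-cong m (λ k _ → sym (∑-*ˡ m c (λ l → g k * h l)))))

  -- For a ≤ b, `x ⊓ b - x ⊓ a` is the length of the part of [a, b] to the left of `x`.
  x⊓b-x⊓a-mono : ∀ {x x′ a b} → a ≤ b → x ≤ x′ → x ⊓ b - x ⊓ a ≤ x′ ⊓ b - x′ ⊓ a
  x⊓b-x⊓a-mono {x} {x′} {a} {b} a≤b x≤x′ with ≤-total x a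
  ... | inj₁ x≤a = ≤-trans
    (≤-reflexive (trans (cong₂ _-_ (p≤q⇒p⊓q≡p (≤-trans x≤a a≤b)) (p≤q⇒p⊓q≡p x≤a)) (+-inverseʳ x)))
    (≤⇒0≤gap (⊓-monoʳ-≤ x′ a≤b))
  ... | inj₂ a≤x = ≤-trans
    (+-monoˡ-≤ (- (x ⊓ a)) (⊓-monoˡ-≤ b x≤x′))
    (≤-reflexive (cong (λ z → x′ ⊓ b - z) (trans (p≥q⇒p⊓q≡q a≤x) (sym (p≥q⇒p⊓q≡q (≤-trans a≤x x≤x′))))))

  x⊓b-x⊓a≤b-a : ∀ {x a b} → a ≤ b → x ⊓ b - x ⊓ a ≤ b - a
  x⊓b-x⊓a≤b-a {x} {a} {b} a≤b with ≤-total x a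
  ... | inj₁ x≤a = ≤-trans
    (≤-reflexive (trans (cong₂ _-_ (p≤q⇒p⊓q≡p (≤-trans x≤a a≤b)) (p≤q⇒p⊓q≡p x≤a)) (+-inverseʳ x)))
    (≤⇒0≤gap a≤b)
  ... | inj₂ a≤x = ≤-trans (≤-reflexive (cong (λ z → x ⊓ b - z) (p≥q⇒p⊓q≡q a≤x))) (+-monoˡ-≤ (- a) (p⊓q≤q x b))

  [1+x]⊓b-x⊓b≤1 : ∀ x b → (x + 1ℚ) ⊓ b - x ⊓ b ≤ 1ℚ
  [1+x]⊓b-x⊓b≤1 x b with ≤-total x b
  ... | inj₁ x≤b = ≤-trans (+-mono-≤ (p⊓q≤p (x + 1ℚ) b) (≤-reflexive (cong -_ (p≤q⇒p⊓q≡p x≤b))))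
    (≤-reflexive (solve 1 (λ x → x :+ con 1ℚ :- x := con 1ℚ) refl x))
  ... | inj₂ b≤x = ≤-trans (+-mono-≤ (p⊓q≤q (x + 1ℚ) b) (≤-reflexive (cong -_ (p≥q⇒p⊓q≡q b≤x))))
    (≤-trans (≤-reflexive (+-inverseʳ b)) 0≤1)

  -- ℓ i k is the length of [i, i+1] ∩ [yₖ, yₖ₊₁].
  module Overlap (y : ℕ → ℚ) (y₀≡0 : y 0 ≡ 0ℚ) (y-mono : ∀ k → y k ≤ y (suc k)) where

    clamp : ℚ → ℕ → ℚ
    clamp x k = x ⊓ y (suc k) - x ⊓ y k

    ℓ : ℕ → ℕ → ℚ
    ℓ i k = clamp (fromℕ (suc i)) k - clamp (fromℕ i) k

    private
      i≤1+i : ∀ i → fromℕ i ≤ fromℕ (suc i)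
      i≤1+i i = fromℕ-mono (ℕₚ.n≤1+n i)

      0≤y : ∀ k → 0ℚ ≤ y k
      0≤y zero    = ≤-reflexive (sym y₀≡0)
      0≤y (suc k) = ≤-trans (0≤y k) (y-mono k)

    0≤ℓ : ∀ i k → 0ℚ ≤ ℓ i k
    0≤ℓ i k = ≤⇒0≤gap (x⊓b-x⊓a-mono (y-mono k) (i≤1+i i))

    clamp-below : ∀ {x} k → x ≤ y k → clamp x k ≡ 0ℚ
    clamp-below {x} k h = trans (cong₂ _-_ (p≤q⇒p⊓q≡p (≤-trans h (y-mono k))) (p≤q⇒p⊓q≡p h)) (+-inverseʳ x)

    clamp-above : ∀ {x} k → y (suc k) ≤ x → clamp x k ≡ y (suc k) - y k
    clamp-above {x} k h = cong₂ _-_ (p≥q⇒p⊓q≡q h) (p≥q⇒p⊓q≡q (≤-trans (y-mono k) h))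

    ℓ-below : ∀ i k → fromℕ (suc i) ≤ y k → ℓ i k ≡ 0ℚ
    ℓ-below i k h = cong₂ _-_ (clamp-below k h) (clamp-below k (≤-trans (i≤1+i i) h))

    ℓ-above : ∀ i k → y (suc k) ≤ fromℕ i → ℓ i k ≡ 0ℚ
    ℓ-above i k h = trans (cong₂ _-_ (clamp-above k (≤-trans h (i≤1+i i))) (clamp-above k h)) (+-inverseʳ (y (suc k) - y k))

    -- `clamp` is a difference in `k`, and `ℓ` is a difference of clamps in `i`, so sums over either
    -- index telescope.
    row : ∀ m i → ∑ m (ℓ i) ≡ fromℕ (suc i) ⊓ y m - fromℕ i ⊓ y m
    row m i = begin
      ∑ m (ℓ i)
        ≡⟨ ∑-- m (clamp (fromℕ (suc i))) (clamp (fromℕ i)) ⟩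
      ∑ m (clamp (fromℕ (suc i))) - ∑ m (clamp (fromℕ i))
        ≡⟨ cong₂ _-_ (telescoped (suc i)) (telescoped i) ⟩
      fromℕ (suc i) ⊓ y m - fromℕ i ⊓ y m                                ∎
      where
      open ≡-Reasoning
      telescoped : ∀ i → ∑ m (clamp (fromℕ i)) ≡ fromℕ i ⊓ y m
      telescoped i = trans (∑-telescope m (λ k → fromℕ i ⊓ y k))
        (trans (cong (λ z → fromℕ i ⊓ y m - z) (trans (cong (fromℕ i ⊓_) y₀≡0) (p≥q⇒p⊓q≡q (0≤fromℕ i))))
               (+-identityʳ (fromℕ i ⊓ y m)))

    row≡1 : ∀ m i → fromℕ (suc i) ≤ y m → ∑ m (ℓ i) ≡ 1ℚ
    row≡1 m i h = trans (row m i) (trans (cong₂ _-_ (p≤q⇒p⊓q≡p h) (p≤q⇒p⊓q≡p (≤-trans (i≤1+i i) h)))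
      (solve 1 (λ x → x :+ con 1ℚ :- x := con 1ℚ) refl (fromℕ i)))

    row≤1 : ∀ m i → ∑ m (ℓ i) ≤ 1ℚ
    row≤1 m i = ≤-trans (≤-reflexive (row m i)) ([1+x]⊓b-x⊓b≤1 (fromℕ i) (y m))

    column : ∀ n k → ∑ n (λ i → ℓ i k) ≡ clamp (fromℕ n) k
    column n k = trans (∑-telescope n (λ i → clamp (fromℕ i) k))
      (trans (cong (λ z → clamp (fromℕ n) k - z) (clamp-below k (0≤y k))) (+-identityʳ (clamp (fromℕ n) k)))

    column≤ : ∀ n k → ∑ n (λ i → ℓ i k) ≤ y (suc k) - y k
    column≤ n k = ≤-trans (≤-reflexive (column n k)) (x⊓b-x⊓a≤b-a {fromℕ n} (y-mono k))

    column≡ : ∀ n k → y (suc k) ≤ fromℕ n → ∑ n (λ i → ℓ i k) ≡ y (suc k) - y k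
    column≡ n k h = trans (column n k) (clamp-above {fromℕ n} k h)

  inStaircase : ℕ → ℕ → ℕ → ℚ
  inStaircase m k l = 𝟙 (k ℕ.+ l ℕ.<? m)

  ∑inStaircase : ∀ m k (g : ℕ → ℚ) → k ℕ.≤ m → ∑ m (λ l → inStaircase m k l * g l) ≡ ∑ (m ℕ.∸ k) g
  ∑inStaircase m k g k≤m = begin
    ∑ m (λ l → inStaircase m k l * g l)
      ≡⟨ cong (λ d → ∑ d (λ l → inStaircase m k l * g l)) (sym (ℕₚ.m∸n+n≡m k≤m)) ⟩
    ∑ (m ℕ.∸ k ℕ.+ k) (λ l → inStaircase m k l * g l)
      ≡⟨ ∑-split (m ℕ.∸ k) k (λ l → inStaircase m k l * g l) ⟩
    ∑ (m ℕ.∸ k) (λ l → inStaircase m k l * g l) + ∑ k (λ l → inStaircase m k (m ℕ.∸ k ℕ.+ l) * g (m ℕ.∸ k ℕ.+ l))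
      ≡⟨ cong₂ _+_ (∑-cong (m ℕ.∸ k) inside) (trans (∑-cong k (λ l _ → outside l)) (∑-0 k)) ⟩
    ∑ (m ℕ.∸ k) g + 0ℚ
      ≡⟨ +-identityʳ (∑ (m ℕ.∸ k) g) ⟩
    ∑ (m ℕ.∸ k) g ∎
    where
    open ≡-Reasoning
    inside : ∀ l → l ℕ.< m ℕ.∸ k → inStaircase m k l * g l ≡ g l
    inside l l< = trans (cong (_* g l) (𝟙-true (k ℕ.+ l ℕ.<? m)
      (subst (k ℕ.+ l ℕ.<_) (ℕₚ.m+[n∸m]≡n k≤m) (ℕₚ.+-monoʳ-< k l<)))) (*-identityˡ (g l))
    outside : ∀ l → inStaircase m k (m ℕ.∸ k ℕ.+ l) * g (m ℕ.∸ k ℕ.+ l) ≡ 0ℚ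
    outside l = trans (cong (_* g (m ℕ.∸ k ℕ.+ l)) (𝟙-false (k ℕ.+ (m ℕ.∸ k ℕ.+ l) ℕ.<? m)
      (λ h → ℕₚ.<⇒≱ h (ℕₚ.≤-trans (ℕₚ.m≤m+n m l) (ℕₚ.≤-reflexive
        (trans (cong (ℕ._+ l) (sym (ℕₚ.m+[n∸m]≡n k≤m))) (ℕₚ.+-assoc k (m ℕ.∸ k) l))))))) (*-zeroˡ (g (m ℕ.∸ k ℕ.+ l)))

  scaled-staircase-area : ∀ m c → ∑ m (λ k → ∑ m (λ l → inStaircase m k l * (c * a k * (c * a l)))) ≡ c * c * fromℕ m
  scaled-staircase-area m c = begin
    ∑ m (λ k → ∑ m (λ l → inStaircase m k l * (c * a k * (c * a l))))
      ≡⟨ ∑-cong m (λ k k<m → trans (∑inStaircase m k (λ l → c * a k * (c * a l)) (ℕₚ.<⇒≤ k<m))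
           (trans (∑-*ˡ (m ℕ.∸ k) (c * a k) (λ l → c * a l)) (trans (cong (c * a k *_) (∑-*ˡ (m ℕ.∸ k) c a))
             (solve 3 (λ c b S → c :* b :* (c :* S) := c :* c :* (b :* S)) refl c (a k) (s (m ℕ.∸ k)))))) ⟩
    ∑ m (λ k → c * c * (a k * s (m ℕ.∸ k)))
      ≡⟨ ∑-*ˡ m (c * c) (λ k → a k * s (m ℕ.∸ k)) ⟩
    c * c * ∑ m (λ k → a k * s (m ℕ.∸ k))
      ≡⟨ cong (c * c *_) (staircase-area m) ⟩
    c * c * fromℕ m ∎
    where open ≡-Reasoning

  module ScaledOverlap (c : ℚ) (0≤c : 0ℚ ≤ c) where

    y : ℕ → ℚ
    y k = c * s k

    y-gap : ∀ k → y (suc k) - y k ≡ c * a k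
    y-gap k = solve 3 (λ c s b → c :* (s :+ b) :- c :* s := c :* b) refl c (s k) (a k)

    y-mono : ∀ {k m} → k ℕ.≤ m → y k ≤ y m
    y-mono h = *-monoˡ 0≤c (s-mono (ℕₚ.≤⇒≤′ h))

    0≤y : ∀ k → 0ℚ ≤ y k
    0≤y k = 0≤* 0≤c (0≤s k)

    open Overlap y (*-zeroʳ c) (λ k → y-mono (ℕₚ.n≤1+n k)) public

  *-zero-product : ∀ {p q} r → p ≡ 0ℚ ⊎ q ≡ 0ℚ → r * (p * q) ≡ 0ℚ
  *-zero-product {p} {q} r (inj₁ refl) = solve 2 (λ q r → r :* (con 0ℚ :* q) := con 0ℚ) refl q r
  *-zero-product {p} {q} r (inj₂ refl) = solve 2 (λ p r → r :* (p :* con 0ℚ) := con 0ℚ) refl p r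

  𝟙*≤𝟙* : ∀ {P Q : Set} (d : Dec P) (e : Dec Q) {p q} → 0ℚ ≤ p → 0ℚ ≤ q →
    (P → ¬ Q → p ≡ 0ℚ ⊎ q ≡ 0ℚ) → 𝟙 d * (p * q) ≤ 𝟙 e * (p * q)
  𝟙*≤𝟙* (no _)  e       {p} {q} 0≤p 0≤q h = ≤-trans (≤-reflexive (*-zeroˡ (p * q))) (0≤* (0≤𝟙 e) (0≤* 0≤p 0≤q))
  𝟙*≤𝟙* (yes _) (yes _) {p} {q} 0≤p 0≤q h = ≤-refl
  𝟙*≤𝟙* (yes x) (no ¬y) {p} {q} 0≤p 0≤q h = ≤-reflexive (trans (*-zero-product 1ℚ (h x ¬y)) (sym (*-zeroˡ (p * q))))

  -- The factor (m+1)/m in the scale pushes the rectangles with k + l > m outside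
  -- the disc of radius n.
  cells-upper : ∀ n m → 0 ℕ.< m → let c = fromℕ n * u m * (fromℕ (suc m) * fromℕ m ⁻¹) in
    fromℕ (cellsInQuarterDisc n) ≤ c * c * fromℕ (suc m)
  cells-upper n m@(suc m′) _ = begin
    fromℕ (cellsInQuarterDisc n)
      ≡⟨ cells≡∑inDisc n ⟩
    ∑ n (λ i → ∑ n (λ j → inDisc n i j))
      ≡⟨ ∑-cong n (λ i i<n → ∑-cong n (λ j j<n → sym (trans
           (cong₂ (λ x z → inDisc n i j * (x * z)) (row≡1 (suc m) i (covered i i<n)) (row≡1 (suc m) j (covered j j<n)))
           (solve 1 (λ x → x :* (con 1ℚ :* con 1ℚ) := x) refl (inDisc n i j))))) ⟩
    ∑ n (λ i → ∑ n (λ j → inDisc n i j * (∑ (suc m) (ℓ i) * ∑ (suc m) (ℓ j))))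
      ≤⟨ overlap-≤ n (suc m) ℓ (inDisc n) (inStaircase (suc m)) (λ i j k l _ _ k< l< →
           𝟙*≤𝟙* (suc i ℕ.^ 2 ℕ.+ suc j ℕ.^ 2 ℕ.≤? n ℕ.^ 2) (k ℕ.+ l ℕ.<? suc m) (0≤ℓ i k) (0≤ℓ j l) (disjoint i j k l k< l<)) ⟩
    ∑ (suc m) (λ k → ∑ (suc m) (λ l → inStaircase (suc m) k l * (∑ n (λ i → ℓ i k) * ∑ n (λ i → ℓ i l))))
      ≤⟨ ∑-mono (suc m) (λ k _ → ∑-mono (suc m) (λ l _ → *-monoˡ (0≤𝟙 (k ℕ.+ l ℕ.<? suc m))
           (*-mono (0≤∑ n (λ i → 0≤ℓ i k)) (0≤* 0≤c (<⇒≤ (0<a l))) (column≤c*a k) (column≤c*a l)))) ⟩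
    ∑ (suc m) (λ k → ∑ (suc m) (λ l → inStaircase (suc m) k l * (c * a k * (c * a l))))
      ≡⟨ scaled-staircase-area (suc m) c ⟩
    c * c * fromℕ (suc m) ∎
    where
    open ≤-Reasoning
    ρ c : ℚ
    ρ = fromℕ (suc m) * fromℕ m ⁻¹
    c = fromℕ n * u m * ρ
    0<m : 0ℚ < fromℕ m
    0<m = 0<1+fromℕ m′
    0≤m⁻¹ : 0ℚ ≤ fromℕ m ⁻¹
    0≤m⁻¹ = <⇒≤ (0<p⁻¹ 0<m)
    1≤ρ : 1ℚ ≤ ρ
    1≤ρ = gap⇒≤ (linear₁ 1ℚ (solve 2 (λ m i → (m :+ con 1ℚ) :* i :- con 1ℚ :- i := con 1ℚ :* (m :* i :- con 1ℚ)) refl (fromℕ m) (fromℕ m ⁻¹)) (p*p⁻¹ 0<m)) 0≤m⁻¹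
    0≤c : 0ℚ ≤ c
    0≤c = 0≤* (0≤* (0≤fromℕ n) (<⇒≤ (0<u m))) (≤-trans 0≤1 1≤ρ)
    open ScaledOverlap c 0≤c
    y-end : y (suc m) ≡ fromℕ n * ρ
    y-end = linear₁ (fromℕ n * ρ) (solve 4 (λ n u r s → n :* u :* r :* s :- n :* r := n :* r :* (s :* u :- con 1ℚ)) refl (fromℕ n) (u m) ρ (s (suc m))) (s*u≡1 m)
    n≤y-end : fromℕ n ≤ y (suc m)
    n≤y-end = ≤-trans (≤-trans (≤-reflexive (sym (*-identityʳ (fromℕ n)))) (*-monoˡ (0≤fromℕ n) 1≤ρ)) (≤-reflexive (sym y-end))
    covered : ∀ i → i ℕ.< n → fromℕ (suc i) ≤ y (suc m)
    covered i i<n = ≤-trans (fromℕ-mono i<n) n≤y-end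
    column≤c*a : ∀ k → ∑ n (λ i → ℓ i k) ≤ c * a k
    column≤c*a k = ≤-trans (column≤ n k) (≤-reflexive (y-gap k))
    -- The square of (m+1)/m exceeds (2m+1)/(2m), the factor lost in `f-sum-lower`.
    odd≤2mρ² : odd m ≤ 2ℚ * fromℕ m * (ρ * ρ)
    odd≤2mρ² = gap⇒≤ (linear₁ (2ℚ * (fromℕ m * i * (fromℕ m + 2ℚ) + i + (fromℕ m + 2ℚ)))
        (solve 2 (λ m i → con 2ℚ :* m :* ((m :+ con 1ℚ) :* i :* ((m :+ con 1ℚ) :* i)) :- (con 2ℚ :* m :+ con 1ℚ) :- (con 3ℚ :+ con 2ℚ :* i)
          := con 2ℚ :* (m :* i :* (m :+ con 2ℚ) :+ i :+ (m :+ con 2ℚ)) :* (m :* i :- con 1ℚ))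
          refl (fromℕ m) i) (p*p⁻¹ 0<m))
      (0≤+ (<⇒≤ (positive⁻¹ 3ℚ)) (0≤* 0≤2 0≤m⁻¹))
      where
      i : ℚ
      i = fromℕ m ⁻¹
    far : ∀ k l → k ℕ.≤ suc m → l ℕ.≤ suc m → suc m ℕ.≤ k ℕ.+ l → fromℕ n * fromℕ n ≤ y k * y k + y l * y l
    far k l k≤ l≤ h = *-cancelˡ-≤ (odd m) (0<odd m) (begin
      odd m * (N * N)                             ≤⟨ *-monoʳ (0≤square N) odd≤2mρ² ⟩
      2ℚ * fromℕ m * (ρ * ρ) * (N * N)
        ≡⟨ solve 3 (λ m r n → con 2ℚ :* m :* (r :* r) :* (n :* n) := con 2ℚ :* m :* (n :* r :* (n :* r))) refl (fromℕ m) ρ N ⟩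
      2ℚ * fromℕ m * (N * ρ * (N * ρ))            ≡⟨ cong (λ z → 2ℚ * fromℕ m * (z * z)) (sym y-end) ⟩
      2ℚ * fromℕ m * (y (suc m) * y (suc m))
        ≡⟨ solve 3 (λ m c s → con 2ℚ :* m :* (c :* s :* (c :* s)) := c :* c :* (con 2ℚ :* m :* (s :* s))) refl (fromℕ m) c (s (suc m)) ⟩
      c * c * (2ℚ * fromℕ m * f (suc m))          ≤⟨ *-monoˡ (0≤square c) (f-sum-lower k≤ l≤ h) ⟩
      c * c * (odd m * (f k + f l))
        ≡⟨ solve 4 (λ c o s t → c :* c :* (o :* (s :* s :+ t :* t)) := o :* (c :* s :* (c :* s) :+ c :* t :* (c :* t))) refl c (odd m) (s k) (s l) ⟩
      odd m * (y k * y k + y l * y l)             ∎)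
      where
      N : ℚ
      N = fromℕ n
    disjoint : ∀ i j k l → k ℕ.< suc m → l ℕ.< suc m → suc i ℕ.^ 2 ℕ.+ suc j ℕ.^ 2 ℕ.≤ n ℕ.^ 2 →
      ¬ (k ℕ.+ l ℕ.< suc m) → ℓ i k ≡ 0ℚ ⊎ ℓ j l ≡ 0ℚ
    -- If both overlaps had positive length, the outer corner of the cell would lie strictly beyond
    -- the inner corner of the rectangle, which by `far` is not inside the disc.
    disjoint i j k l k< l< h ¬h with fromℕ (suc i) ≤? y k | fromℕ (suc j) ≤? y l
    ... | yes p | _     = inj₁ (ℓ-below i k p)
    ... | no _  | yes p = inj₂ (ℓ-below j l p)
    ... | no p  | no p′ = contradiction (≤-<-trans (far k l (ℕₚ.<⇒≤ k<) (ℕₚ.<⇒≤ l<) (ℕₚ.≮⇒≥ ¬h))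
        (+-mono-<-≤ (square-mono-< (0≤y k) (≰⇒> p)) (square-mono (0≤y l) (<⇒≤ (≰⇒> p′)))))
        (λ lt → <-irrefl refl (<-≤-trans lt (≤-trans
          (≤-reflexive (trans (cong₂ _+_ (sym (fromℕ-^2 (suc i))) (sym (fromℕ-^2 (suc j)))) (sym (fromℕ-+ (suc i ℕ.^ 2) (suc j ℕ.^ 2)))))
          (≤-trans (fromℕ-mono h) (≤-reflexive (fromℕ-^2 n))))))
      where
      square-mono-< : ∀ {p q} → 0ℚ ≤ p → p < q → p * p < q * q
      square-mono-< {p} {q} 0≤p p<q = ≤-<-trans (*-monoˡ 0≤p (<⇒≤ p<q)) (*-monoˡ-<-pos q {{positive (≤-<-trans 0≤p p<q)}} p<q)

  -- The slack of 2 in the radius absorbs the diagonal of a cell.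
  cells-lower : ∀ n m → let c = fromℕ n * u m in
    c * c * fromℕ m ≤ fromℕ (cellsInQuarterDisc (2 ℕ.+ n))
  cells-lower n m = begin
    c * c * fromℕ m
      ≡⟨ sym (scaled-staircase-area m c) ⟩
    ∑ m (λ k → ∑ m (λ l → inStaircase m k l * (c * a k * (c * a l))))
      ≡⟨ ∑-cong m (λ k k<m → ∑-cong m (λ l l<m → cong₂ (λ x z → inStaircase m k l * (x * z)) (sym (column≡c*a k k<m)) (sym (column≡c*a l l<m)))) ⟩
    ∑ m (λ k → ∑ m (λ l → inStaircase m k l * (∑ n′ (λ i → ℓ i k) * ∑ n′ (λ i → ℓ i l))))
      -- The same overlap lengths with the two partitions interchanged.
      ≤⟨ overlap-≤ m n′ (λ k i → ℓ i k) (inStaircase m) (inDisc n′) (λ k l i j _ _ _ _ →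
           𝟙*≤𝟙* (k ℕ.+ l ℕ.<? m) (suc i ℕ.^ 2 ℕ.+ suc j ℕ.^ 2 ℕ.≤? n′ ℕ.^ 2) (0≤ℓ i k) (0≤ℓ j l) (disjoint i j k l)) ⟩
    ∑ n′ (λ i → ∑ n′ (λ j → inDisc n′ i j * (∑ m (ℓ i) * ∑ m (ℓ j))))
      ≤⟨ ∑-mono n′ (λ i _ → ∑-mono n′ (λ j _ → ≤-trans
           (*-monoˡ (0≤𝟙 (suc i ℕ.^ 2 ℕ.+ suc j ℕ.^ 2 ℕ.≤? n′ ℕ.^ 2)) (*-mono (0≤∑ m (0≤ℓ i)) 0≤1 (row≤1 m i) (row≤1 m j)))
           (≤-reflexive (solve 1 (λ x → x :* (con 1ℚ :* con 1ℚ) := x) refl (inDisc n′ i j))))) ⟩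
    ∑ n′ (λ i → ∑ n′ (λ j → inDisc n′ i j))
      ≡⟨ sym (cells≡∑inDisc n′) ⟩
    fromℕ (cellsInQuarterDisc n′) ∎
    where
    open ≤-Reasoning
    n′ : ℕ
    n′ = 2 ℕ.+ n
    N c : ℚ
    N = fromℕ n
    c = N * u m
    0≤c : 0ℚ ≤ c
    0≤c = 0≤* (0≤fromℕ n) (<⇒≤ (0<u m))
    open ScaledOverlap c 0≤c
    y-end : y (suc m) ≡ N
    y-end = linear₁ N (solve 3 (λ n u s → n :* u :* s :- n := n :* (s :* u :- con 1ℚ)) refl N (u m) (s (suc m))) (s*u≡1 m)
    column≡c*a : ∀ k → k ℕ.< m → ∑ n′ (λ i → ℓ i k) ≡ c * a k
    column≡c*a k k<m = trans (column≡ n′ k (≤-trans (y-mono (ℕ.s≤s (ℕₚ.<⇒≤ k<m))) (≤-trans (≤-reflexive y-end)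
      (fromℕ-mono (ℕₚ.m≤n+m n 2))))) (y-gap k)
    -- The strict bound on k + l leaves (k+1) + (l+1) ≤ m + 1, so it is `y (suc m)`, not `y m`, that
    -- is scaled to the radius `N`.
    near : ∀ k l → k ℕ.+ l ℕ.< m → y (suc k) * y (suc k) + y (suc l) * y (suc l) ≤ N * N
    near k l h = begin
      y (suc k) * y (suc k) + y (suc l) * y (suc l)
        ≡⟨ solve 3 (λ c s t → c :* s :* (c :* s) :+ c :* t :* (c :* t) := c :* c :* (s :* s :+ t :* t)) refl c (s (suc k)) (s (suc l)) ⟩
      c * c * (f (suc k) + f (suc l))
        ≤⟨ *-monoˡ (0≤square c) (f-superadditive {suc k} {suc l} (ℕ.s≤s (ℕₚ.≤-trans (ℕₚ.≤-reflexive (ℕₚ.+-suc k l)) h))) ⟩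
      c * c * f (suc m)
        ≡⟨ solve 2 (λ c s → c :* c :* (s :* s) := c :* s :* (c :* s)) refl c (s (suc m)) ⟩
      y (suc m) * y (suc m)                            ≡⟨ cong (λ z → z * z) y-end ⟩
      N * N                                            ∎
    y≤N : ∀ k l → k ℕ.+ l ℕ.< m → y (suc k) ≤ N × y (suc l) ≤ N
    y≤N k l h = ≤-trans (y-mono (ℕ.s≤s (ℕₚ.≤-trans (ℕₚ.m≤m+n k l) (ℕₚ.<⇒≤ h)))) (≤-reflexive y-end)
              , ≤-trans (y-mono (ℕ.s≤s (ℕₚ.≤-trans (ℕₚ.m≤n+m l k) (ℕₚ.<⇒≤ h)))) (≤-reflexive y-end)
    corner : ∀ i j k l → k ℕ.+ l ℕ.< m → fromℕ i ≤ y (suc k) → fromℕ j ≤ y (suc l) →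
      fromℕ (suc i ℕ.^ 2 ℕ.+ suc j ℕ.^ 2) ≤ fromℕ (n′ ℕ.^ 2)
    corner i j k l h hi hj = begin
      fromℕ (suc i ℕ.^ 2 ℕ.+ suc j ℕ.^ 2)
        ≡⟨ trans (fromℕ-+ (suc i ℕ.^ 2) (suc j ℕ.^ 2)) (cong₂ _+_ (fromℕ-^2 (suc i)) (fromℕ-^2 (suc j))) ⟩
      fromℕ (suc i) * fromℕ (suc i) + fromℕ (suc j) * fromℕ (suc j)
        ≤⟨ +-mono-≤ (square-mono (0≤fromℕ (suc i)) (+-monoˡ-≤ 1ℚ hi)) (square-mono (0≤fromℕ (suc j)) (+-monoˡ-≤ 1ℚ hj)) ⟩
      (p + 1ℚ) * (p + 1ℚ) + (q + 1ℚ) * (q + 1ℚ)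
        ≡⟨ solve 2 (λ p q → (p :+ con 1ℚ) :* (p :+ con 1ℚ) :+ (q :+ con 1ℚ) :* (q :+ con 1ℚ)
             := (p :* p :+ q :* q) :+ con 2ℚ :* (p :+ q) :+ con 2ℚ) refl p q ⟩
      (p * p + q * q) + 2ℚ * (p + q) + 2ℚ
        ≤⟨ +-monoˡ-≤ 2ℚ (+-mono-≤ (near k l h) (*-monoˡ 0≤2 (+-mono-≤ (proj₁ (y≤N k l h)) (proj₂ (y≤N k l h))))) ⟩
      N * N + 2ℚ * (N + N) + 2ℚ
        ≤⟨ gap⇒≤ (solve 1 (λ n → (n :+ con 1ℚ :+ con 1ℚ) :* (n :+ con 1ℚ :+ con 1ℚ) :- (n :* n :+ con 2ℚ :* (n :+ n) :+ con 2ℚ) := con 2ℚ) refl N) 0≤2 ⟩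
      fromℕ n′ * fromℕ n′                             ≡⟨ sym (fromℕ-^2 n′) ⟩
      fromℕ (n′ ℕ.^ 2)                                ∎
      where
      p q : ℚ
      p = y (suc k)
      q = y (suc l)
    disjoint : ∀ i j k l → k ℕ.+ l ℕ.< m → ¬ (suc i ℕ.^ 2 ℕ.+ suc j ℕ.^ 2 ℕ.≤ n′ ℕ.^ 2) → ℓ i k ≡ 0ℚ ⊎ ℓ j l ≡ 0ℚ
    -- If the cell does not start past the rectangle in either direction, its outer corner is within
    -- one unit of the rectangle in each coordinate, and `corner` puts it in the enlarged disc.
    disjoint i j k l h ¬h with ≤-total (y (suc k)) (fromℕ i) | ≤-total (y (suc l)) (fromℕ j)
    ... | inj₁ p | _      = inj₁ (ℓ-above i k p)
    ... | inj₂ _ | inj₁ p = inj₂ (ℓ-above j l p)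
    ... | inj₂ p | inj₂ r = contradiction (corner i j k l h p r) (λ le → <-irrefl refl (<-≤-trans (fromℕ-mono-< (ℕₚ.≰⇒> ¬h)) le))

-- The area of the quarter disc by the Wallis product

module Area where

  open import Data.Rational
  open import Data.Rational.Properties
  open import Data.Rational.Solver using (module +-*-Solver)
  open +-*-Solver
  open RationalLemmas
  open Sequences
  open Wallis
  open EulerSum
  open Circle
  open Grid

  wallis : ℕ → ℚ
  wallis n = fromℕ (suc n) * (u n * u n)

  -- As `f 1` is 1, `f-upper` from 1 to n + 1 says that n + 1 is at most `f (suc n)`, the reciprocal
  -- of uₙ².
  wallis≤1 : ∀ n → wallis n ≤ 1ℚ
  wallis≤1 n = begin
    fromℕ (suc n) * (u n * u n)              ≡⟨ cong (_* (u n * u n)) (sym (*-identityʳ (fromℕ (suc n)))) ⟩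
    fromℕ (suc n) * f 1 * (u n * u n)
      ≤⟨ *-monoʳ (0≤square (u n)) (f-upper {1} {suc n} (ℕₚ.≤⇒≤′ (ℕ.s≤s ℕ.z≤n))) ⟩
    fromℕ 1 * f (suc n) * (u n * u n)
      ≡⟨ linear₁ (s (suc n) * u n + 1ℚ) (solve 2 (λ s u → con 1ℚ :* (s :* s) :* (u :* u) :- con 1ℚ
                                                  := (s :* u :+ con 1ℚ) :* (s :* u :- con 1ℚ)) refl (s (suc n)) (u n)) (s*u≡1 n) ⟩
    1ℚ                                       ∎
    where open ≤-Reasoning

  u²≤recip : ∀ n → u n * u n ≤ recip n
  u²≤recip n = *-cancelˡ-≤ (fromℕ (suc n)) (0<1+fromℕ n)
    (≤-trans (wallis≤1 n) (≤-reflexive (sym (p*p⁻¹ (0<1+fromℕ n)))))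

  area : ℕ → ℚ
  area k = fromℕ (cellsInQuarterDisc (suc k)) * (recip k * recip k)

  -- `cells-upper` is used with n = m = N, where N = k + 1. Its bound is (1 + 1/N)² times the Wallis
  -- term, an excess of at most 3/N; the 5 is shared with `area-lower`.
  area-upper : ∀ k → area k - wallis (suc k) ≤ 5ℚ * recip k
  area-upper k = begin
    area k - W
      ≤⟨ +-monoˡ-≤ (- W) (*-monoʳ (0≤square i) (cells-upper (suc k) (suc k) (ℕ.s≤s ℕ.z≤n))) ⟩
    c * c * (N + 1ℚ) * (i * i) - W
      ≡⟨ cong (λ x → x * x * (N + 1ℚ) * (i * i) - W) c≡ ⟩
    (N + 1ℚ) * U * ((N + 1ℚ) * U) * (N + 1ℚ) * (i * i) - W
      ≡⟨ linear₁ (W * (N * i + 1ℚ + 2ℚ * i)) (solve 3 (λ n u i →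
           (n :+ con 1ℚ) :* u :* ((n :+ con 1ℚ) :* u) :* (n :+ con 1ℚ) :* (i :* i) :- (n :+ con 1ℚ) :* (u :* u)
             :- (n :+ con 1ℚ) :* (u :* u) :* ((con 2ℚ :+ i) :* i)
           := (n :+ con 1ℚ) :* (u :* u) :* (n :* i :+ con 1ℚ :+ con 2ℚ :* i) :* (n :* i :- con 1ℚ)) refl N U i) (p*p⁻¹ (0<1+fromℕ k)) ⟩
    W * ((2ℚ + i) * i)
      ≤⟨ *-mono (0≤* (0≤fromℕ (suc (suc k))) (0≤square U)) (0≤* (<⇒≤ (positive⁻¹ 5ℚ)) (0≤recip k)) (wallis≤1 (suc k))
           (*-monoʳ (0≤recip k) (≤-trans (+-monoʳ-≤ 2ℚ (recip≤1 k)) (gap⇒≤ refl 0≤2))) ⟩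
    1ℚ * (5ℚ * i)                     ≡⟨ *-identityˡ (5ℚ * i) ⟩
    5ℚ * i                            ∎
    where
    open ≤-Reasoning
    N U i W c : ℚ
    N = fromℕ (suc k)
    U = u (suc k)
    i = recip k
    W = wallis (suc k)
    c = N * U * ((N + 1ℚ) * i)
    c≡ : c ≡ (N + 1ℚ) * U
    c≡ = linear₁ ((N + 1ℚ) * U) (solve 3 (λ n u i → n :* u :* ((n :+ con 1ℚ) :* i) :- (n :+ con 1ℚ) :* u
      := (n :+ con 1ℚ) :* u :* (n :* i :- con 1ℚ)) refl N U i) (p*p⁻¹ (0<1+fromℕ k))

  -- `cells-lower` speaks of grids of size at least 2, so size 1 is treated crudely. For size N the
  -- radius is N - 2 and there are N steps; N + 1 - (N-2)²/N = 5 - 4/N gives the constant.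
  area-lower : ∀ k → wallis (suc k) - area k ≤ 5ℚ * recip k
  area-lower zero    = begin
    wallis 1 - area 0      ≤⟨ gap⇒≤ (solve 2 (λ w a → w :- (w :- a) := a) refl (wallis 1) (area 0))
                                (0≤* (0≤fromℕ (cellsInQuarterDisc 1)) (0≤square (recip 0))) ⟩
    wallis 1               ≤⟨ wallis≤1 1 ⟩
    1ℚ                     ≤⟨ gap⇒≤ {1ℚ} {5ℚ} refl (<⇒≤ (positive⁻¹ 4ℚ)) ⟩
    5ℚ                     ≡⟨ trans (sym (*-identityʳ 5ℚ)) (cong (5ℚ *_) (sym 1⁻¹≡1)) ⟩
    5ℚ * recip 0           ∎
    where open ≤-Reasoning
  area-lower (suc k) = begin
    W - area (suc k)
      ≤⟨ +-monoʳ-≤ W (neg-antimono-≤ (*-monoʳ (0≤square i) (cells-lower k (suc (suc k))))) ⟩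
    W - K * U * (K * U) * N * (i * i)
      ≡⟨ linear₁ (- (U * U * (K * K * i) + U * U * (N - 4ℚ))) (solve 3 (λ k u i →
                                                  let n = k :+ con 1ℚ :+ con 1ℚ in
                                                  (n :+ con 1ℚ) :* (u :* u) :- k :* u :* (k :* u) :* n :* (i :* i) :- u :* u :* (con 5ℚ :- con 4ℚ :* i)
                                                  := (:- (u :* u :* (k :* k :* i) :+ u :* u :* (n :- con 4ℚ))) :* (n :* i :- con 1ℚ)) refl K U i) (p*p⁻¹ (0<1+fromℕ (suc k))) ⟩
    U * U * (5ℚ - 4ℚ * i)
      ≤⟨ *-monoˡ (0≤square U) (gap⇒≤ (solve 1 (λ i → con 5ℚ :- (con 5ℚ :- con 4ℚ :* i) := con 4ℚ :* i) refl i)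
                                                  (0≤* (<⇒≤ (positive⁻¹ 4ℚ)) (0≤recip (suc k)))) ⟩
    U * U * 5ℚ
      ≤⟨ *-monoʳ (<⇒≤ (positive⁻¹ 5ℚ)) (≤-trans (u²≤recip (suc (suc k))) (recip-antitone (suc k))) ⟩
    i * 5ℚ                                    ≡⟨ *-comm i 5ℚ ⟩
    5ℚ * i                                    ∎
    where
    open ≤-Reasoning
    K N U i W : ℚ
    K = fromℕ k
    N = fromℕ (suc (suc k))
    U = u (suc (suc k))
    i = recip (suc k)
    W = wallis (suc (suc k))

  area≈leibniz : area ≈ leibniz
  area≈leibniz = ≈-trans
    (≈-rate 5ℚ λ k → ∣p∣≤⁺ (area-upper k)
      (≤-trans (≤-reflexive (solve 2 (λ a w → :- (a :- w) := w :- a) refl (area k) (wallis (suc k)))) (area-lower k)))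
    (≈-trans (≈-shift wallis≈leibniz) (≈-subsequence leibniz leibniz-IsCauchy suc ℕₚ.n≤1+n))

-- Central binomial terms through the Wallis numbers

module Series where

  open import Data.Nat.Combinatorics using (_C_; nCk≡n!/k![n-k]!; k![n∸k]!∣n!)
  open import Data.Rational
  open import Data.Rational.Properties
  open import Data.Rational.Solver using (module +-*-Solver)
  open +-*-Solver
  open RationalLemmas
  open Sequences
  open Wallis
  open EulerSum
  open Area
  open RawSemiringDefinitions +-*-rawSemiring using () renaming (_^_ to _^ℚ_)

  27ℚ : ℚ
  27ℚ = ℤ.+ 27 / 1

  4^ : ℕ → ℚ
  4^ n = fromℕ (4 ℕ.^ n)

  fromℕ-16^ : ∀ n → fromℕ (16 ℕ.^ n) ≡ 4^ n * 4^ n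
  fromℕ-16^ zero    = refl
  fromℕ-16^ (suc n) = begin
    fromℕ (16 ℕ.^ suc n)                ≡⟨ trans (fromℕ-* 16 (16 ℕ.^ n)) (cong (fromℕ 16 *_) (fromℕ-16^ n)) ⟩
    fromℕ 16 * (4^ n * 4^ n)
      ≡⟨ solve 1 (λ p → con (fromℕ 16) :* (p :* p) := con 4ℚ :* p :* (con 4ℚ :* p)) refl (4^ n) ⟩
    4ℚ * 4^ n * (4ℚ * 4^ n)             ≡⟨ cong (λ z → z * z) (sym (fromℕ-* 4 (4 ℕ.^ n))) ⟩
    4^ (suc n) * 4^ (suc n)             ∎
    where open ≡-Reasoning

  2*suc : ∀ n → 2 ℕ.* suc n ≡ suc (suc (2 ℕ.* n))
  2*suc n = cong suc (ℕₚ.+-suc n (n ℕ.+ 0))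

  fromℕ-2* : ∀ n → fromℕ (2 ℕ.* n) ≡ 2ℚ * fromℕ n
  fromℕ-2* n = trans (fromℕ-* 2 n) refl

  u-factorial : ∀ n → u n * odd n * fromℕ ((2 ℕ.* n) !) ≡ 4^ n * (fromℕ (n !) * fromℕ (n !))
  u-factorial zero    = refl
  u-factorial (suc n) = begin
    u (suc n) * odd (suc n) * fromℕ ((2 ℕ.* suc n) !)
      ≡⟨ cong (λ k → u (suc n) * odd (suc n) * fromℕ (k !)) (2*suc n) ⟩
    u (suc n) * odd (suc n) * fromℕ (suc (suc (2 ℕ.* n)) !)
      ≡⟨ cong₂ _*_ (u-step n) (trans (fromℕ-* (suc (suc (2 ℕ.* n))) (suc (2 ℕ.* n) !))
           (trans (cong (fromℕ (suc (suc (2 ℕ.* n))) *_) (fromℕ-* (suc (2 ℕ.* n)) ((2 ℕ.* n) !)))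
             (cong (λ z → (z + 1ℚ + 1ℚ) * ((z + 1ℚ) * fromℕ ((2 ℕ.* n) !))) (fromℕ-2* n)))) ⟩
    u n * (2ℚ * fromℕ (suc n)) * ((2ℚ * fromℕ n + 1ℚ + 1ℚ) * ((2ℚ * fromℕ n + 1ℚ) * fromℕ ((2 ℕ.* n) !)))
      ≡⟨ solve 3 (λ u n g → u :* (con 2ℚ :* (n :+ con 1ℚ)) :* ((con 2ℚ :* n :+ con 1ℚ :+ con 1ℚ) :* ((con 2ℚ :* n :+ con 1ℚ) :* g))
           := con 4ℚ :* ((n :+ con 1ℚ) :* (n :+ con 1ℚ)) :* (u :* (con 2ℚ :* n :+ con 1ℚ) :* g)) refl (u n) (fromℕ n) (fromℕ ((2 ℕ.* n) !)) ⟩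
    4ℚ * (fromℕ (suc n) * fromℕ (suc n)) * (u n * odd n * fromℕ ((2 ℕ.* n) !))
      ≡⟨ cong (4ℚ * (fromℕ (suc n) * fromℕ (suc n)) *_) (u-factorial n) ⟩
    4ℚ * (fromℕ (suc n) * fromℕ (suc n)) * (4^ n * (fromℕ (n !) * fromℕ (n !)))
      ≡⟨ solve 3 (λ m p g → con 4ℚ :* (m :* m) :* (p :* (g :* g)) := con 4ℚ :* p :* (m :* g :* (m :* g))) refl (fromℕ (suc n)) (4^ n) (fromℕ (n !)) ⟩
    4ℚ * 4^ n * (fromℕ (suc n) * fromℕ (n !) * (fromℕ (suc n) * fromℕ (n !)))
      ≡⟨ cong₂ (λ x y → x * (y * y)) (sym (fromℕ-* 4 (4 ℕ.^ n))) (sym (fromℕ-* (suc n) (n !))) ⟩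
    4^ (suc n) * (fromℕ (suc n !) * fromℕ (suc n !)) ∎
    where open ≡-Reasoning

  0<fromℕ-! : ∀ n → 0ℚ < fromℕ (n !)
  0<fromℕ-! n = <-≤-trans 0<1 (fromℕ-mono {1} (ℕₚ.1≤n! n))

  central-factorial : ∀ n → fromℕ ((2 ℕ.* n) C n) * (fromℕ (n !) * fromℕ (n !)) ≡ fromℕ ((2 ℕ.* n) !)
  central-factorial n = trans (cong (fromℕ ((2 ℕ.* n) C n) *_) (sym (fromℕ-* (n !) (n !))))
    (trans (sym (fromℕ-* ((2 ℕ.* n) C n) (n ! ℕ.* n !))) (cong fromℕ (begin
      ((2 ℕ.* n) C n) ℕ.* (n ! ℕ.* n !)
        ≡⟨ cong (λ k → ((2 ℕ.* n) C n) ℕ.* (n ! ℕ.* k !)) (sym 2n∸n≡n) ⟩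
      ((2 ℕ.* n) C n) ℕ.* d                              ≡⟨ cong (ℕ._* d) (nCk≡n!/k![n-k]! n≤2n) ⟩
      ((2 ℕ.* n) ! ℕ./ d) {{d≢0}} ℕ.* d                ≡⟨ m/n*n≡m {{d≢0}} (k![n∸k]!∣n! n≤2n) ⟩
      (2 ℕ.* n) !                                      ∎)))
    where
    open ≡-Reasoning
    d : ℕ
    d = n ! ℕ.* (2 ℕ.* n ℕ.∸ n) !
    d≢0 : ℕ.NonZero d
    d≢0 = ℕₚ._!*_!≢0 n (2 ℕ.* n ℕ.∸ n)
    n≤2n : n ℕ.≤ 2 ℕ.* n
    n≤2n = ℕₚ.m≤m+n n (n ℕ.+ 0)
    2n∸n≡n : 2 ℕ.* n ℕ.∸ n ≡ n
    2n∸n≡n = trans (ℕₚ.m+n∸m≡n n (n ℕ.+ 0)) (ℕₚ.+-identityʳ n)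

  -- The square identifies 16ⁿ/((2n+1)² C(2n,n)²) with uₙ².
  u*odd*central≡4^ : ∀ n → u n * odd n * fromℕ ((2 ℕ.* n) C n) ≡ 4^ n
  u*odd*central≡4^ n = *-cancelˡ-≡ (g * g) (0<* (0<fromℕ-! n) (0<fromℕ-! n)) (linear₂ 1ℚ (u n * odd n)
    (solve 5 (λ x b g h p → g :* g :* (x :* b) :- g :* g :* p := con 1ℚ :* (x :* h :- p :* (g :* g)) :+ x :* (b :* (g :* g) :- h))
      refl (u n * odd n) (fromℕ ((2 ℕ.* n) C n)) g (fromℕ ((2 ℕ.* n) !)) (4^ n))
    (u-factorial n) (central-factorial n))
    where
    g : ℚ
    g = fromℕ (n !)

  summand : ℕ → ℚ
  summand n = u n * u n * (odd (suc n) ⁻¹ * odd (suc n) ⁻¹ * odd (suc n) ⁻¹)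

  fromℕ-centralDenominator : ∀ n → let o = odd (suc n); b = odd n * fromℕ ((2 ℕ.* n) C n) in
    fromℕ (centralDenominator n) ≡ o * o * o * (b * b)
  fromℕ-centralDenominator n = begin
    fromℕ (x ℕ.^ 3 ℕ.* y ℕ.^ 2 ℕ.* z ℕ.^ 2)
      ≡⟨ trans (fromℕ-* (x ℕ.^ 3 ℕ.* y ℕ.^ 2) (z ℕ.^ 2)) (cong (_* fromℕ (z ℕ.^ 2)) (fromℕ-* (x ℕ.^ 3) (y ℕ.^ 2))) ⟩
    fromℕ (x ℕ.^ 3) * fromℕ (y ℕ.^ 2) * fromℕ (z ℕ.^ 2)
      ≡⟨ cong₂ _*_ (cong₂ _*_ (trans (fromℕ-* x (x ℕ.^ 2)) (cong (fromℕ x *_) (fromℕ-^2 x))) (fromℕ-^2 y)) (fromℕ-^2 z) ⟩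
    fromℕ x * (fromℕ x * fromℕ x) * (fromℕ y * fromℕ y) * (fromℕ z * fromℕ z)
      ≡⟨ cong₂ (λ o p → o * (o * o) * (p * p) * (fromℕ z * fromℕ z)) x≡ y≡ ⟩
    odd (suc n) * (odd (suc n) * odd (suc n)) * (odd n * odd n) * (fromℕ z * fromℕ z)
      ≡⟨ solve 3 (λ o p z → o :* (o :* o) :* (p :* p) :* (z :* z) := o :* o :* o :* (p :* z :* (p :* z))) refl (odd (suc n)) (odd n) (fromℕ z) ⟩
    odd (suc n) * odd (suc n) * odd (suc n) * (odd n * fromℕ z * (odd n * fromℕ z)) ∎
    where
    open ≡-Reasoning
    x y z : ℕ
    x = 3 ℕ.+ 2 ℕ.* n
    y = 1 ℕ.+ 2 ℕ.* n
    z = (2 ℕ.* n) C n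
    y≡ : fromℕ y ≡ odd n
    y≡ = cong (_+ 1ℚ) (fromℕ-2* n)
    x≡ : fromℕ x ≡ odd (suc n)
    x≡ = trans (cong (λ z → z + 1ℚ + 1ℚ + 1ℚ) (fromℕ-2* n))
      (solve 1 (λ n → con 2ℚ :* n :+ con 1ℚ :+ con 1ℚ :+ con 1ℚ := con 2ℚ :* (n :+ con 1ℚ) :+ con 1ℚ) refl (fromℕ n))

  0<fromℕ : ∀ n .{{_ : ℕ.NonZero n}} → 0ℚ < fromℕ n
  0<fromℕ (suc n) = 0<1+fromℕ n

  centralTerm≡summand : ∀ n → centralTerm n ≡ summand n
  centralTerm≡summand n = trans (i/d≡i/1*d⁻¹ (ℤ.+ (16 ℕ.^ n)) (centralDenominator n) {{centralDenominator≢0 n}})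
    (trans (cong (_* D ⁻¹) (trans (sym (fromℕ≡/1 (16 ℕ.^ n))) (trans (fromℕ-16^ n)
              (trans (cong (λ z → z * z) (sym (u*odd*central≡4^ n))) numerator))))
      (linear₁ (summand n) (solve 3 (λ x d i → x :* d :* i :- x := x :* (d :* i :- con 1ℚ)) refl (summand n) D (D ⁻¹))
        (p*p⁻¹ (0<fromℕ (centralDenominator n) {{centralDenominator≢0 n}}))))
    where
    D o i : ℚ
    D = fromℕ (centralDenominator n)
    o = odd (suc n)
    i = o ⁻¹
    numerator : u n * odd n * fromℕ ((2 ℕ.* n) C n) * (u n * odd n * fromℕ ((2 ℕ.* n) C n)) ≡ summand n * D
    numerator = trans
      (linear₁ (- (u n * u n * (b * b) * (o * i * (o * i) + o * i + 1ℚ))) (solve 5 (λ u p z o i →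
          u :* p :* z :* (u :* p :* z) :- u :* u :* (i :* i :* i) :* (o :* o :* o :* (p :* z :* (p :* z)))
          := (:- (u :* u :* (p :* z :* (p :* z)) :* (o :* i :* (o :* i) :+ o :* i :+ con 1ℚ))) :* (o :* i :- con 1ℚ))
        refl (u n) (odd n) (fromℕ ((2 ℕ.* n) C n)) o i) (p*p⁻¹ (0<odd (suc n))))
      (cong (summand n *_) (sym (fromℕ-centralDenominator n)))
      where
      b : ℚ
      b = odd n * fromℕ ((2 ℕ.* n) C n)

  -- Hypergeometric terms through the Wallis numbers

  5/2ℚ 3/2ℚ ⅓ : ℚ
  5/2ℚ = ℤ.+ 5 / 2
  3/2ℚ = ℤ.+ 3 / 2
  ⅓ = ℤ.+ 1 / 3

  pochhammer-1 : ∀ n → pochhammer 1ℚ n ≡ fromℕ (n !)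
  pochhammer-1 zero    = refl
  pochhammer-1 (suc n) = trans (cong₂ (λ x y → x * (1ℚ + y)) (pochhammer-1 n) (sym (fromℕ≡/1 n)))
    (trans (solve 2 (λ g n → g :* (con 1ℚ :+ n) := (n :+ con 1ℚ) :* g) refl (fromℕ (n !)) (fromℕ n)) (sym (fromℕ-* (suc n) (n !))))

  0<pochhammer-3/2 : ∀ n → 0ℚ < pochhammer 3/2ℚ n
  0<pochhammer-3/2 zero    = 0<1
  0<pochhammer-3/2 (suc n) = 0<* (0<pochhammer-3/2 n)
    (subst (0ℚ <_) (trans (+-comm (fromℕ n) 3/2ℚ) (cong (3/2ℚ +_) (fromℕ≡/1 n))) (0<+ (0≤fromℕ n) (positive⁻¹ 3/2ℚ)))

  -- The quotient of the two rising factorials telescopes to (3/2 + n)/(3/2). The three lower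
  -- parameters thus yield (2n+3)³ and, from the three thirds, the factor 27.
  pochhammer-5/2 : ∀ n → pochhammer 5/2ℚ n ≡ pochhammer 3/2ℚ n * odd (suc n) * ⅓
  pochhammer-5/2 zero    = refl
  pochhammer-5/2 (suc n) = trans (cong₂ (λ x y → x * (5/2ℚ + y)) (pochhammer-5/2 n) (sym (fromℕ≡/1 n)))
    (trans (solve 2 (λ t n → t :* (con 2ℚ :* (n :+ con 1ℚ) :+ con 1ℚ) :* con ⅓ :* (con 5/2ℚ :+ n)
        := t :* (con 3/2ℚ :+ n) :* (con 2ℚ :* (n :+ con 1ℚ :+ con 1ℚ) :+ con 1ℚ) :* con ⅓) refl (pochhammer 3/2ℚ n) (fromℕ n))
      (cong (λ y → pochhammer 3/2ℚ n * (3/2ℚ + y) * odd (suc (suc n)) * ⅓) (fromℕ≡/1 n)))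

  u*pochhammer-3/2 : ∀ n → u n * pochhammer 3/2ℚ n ≡ fromℕ (n !)
  u*pochhammer-3/2 zero    = refl
  u*pochhammer-3/2 (suc n) = trans (cong (λ y → u (suc n) * (pochhammer 3/2ℚ n * (3/2ℚ + y))) (sym (fromℕ≡/1 n)))
    (trans (linear₂ (½ * pochhammer 3/2ℚ n) (fromℕ n + 1ℚ) (solve 5 (λ u′ u t n g →
        u′ :* (t :* (con 3/2ℚ :+ n)) :- (n :+ con 1ℚ) :* g
        := con ½ :* t :* (u′ :* (con 2ℚ :* (n :+ con 1ℚ) :+ con 1ℚ) :- u :* (con 2ℚ :* (n :+ con 1ℚ))) :+ (n :+ con 1ℚ) :* (u :* t :- g))
      refl (u (suc n)) (u n) (pochhammer 3/2ℚ n) (fromℕ n) (fromℕ (n !))) (u-step n) (u*pochhammer-3/2 n))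
    (sym (fromℕ-* (suc n) (n !))))

  ÷≡*⁻¹ : ∀ p q .{{_ : NonZero q}} → 0ℚ < q → p ÷ q ≡ p * q ⁻¹
  ÷≡*⁻¹ p q 0<q = cong (p *_) (⁻¹-unique 0<q (*-inverseʳ q))

  1^ℚ : ∀ n → 1ℚ ^ℚ n ≡ 1ℚ
  1^ℚ zero    = refl
  1^ℚ (suc n) = trans (*-identityˡ (1ℚ ^ℚ n)) (1^ℚ n)

  hypergeometricTerm : ℕ → ℚ
  hypergeometricTerm = R.₄F₃-term 1ℚ 1ℚ 1ℚ 3/2ℚ 5/2ℚ 5/2ℚ 5/2ℚ 1ℚ

  -- After cancellation the term is 27 (n!/(3/2)ₙ)²/(2n+3)³, and n!/(3/2)ₙ is `u n` by
  -- `u*pochhammer-3/2`.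
  hypergeometricTerm≡27*summand : ∀ n → hypergeometricTerm n ≡ 27ℚ * summand n
  hypergeometricTerm≡27*summand n = begin
    hypergeometricTerm n                 ≡⟨ trans (cong (num ÷den *_) (1^ℚ n)) (*-identityʳ (num ÷den)) ⟩
    num ÷den                             ≡⟨ ÷≡*⁻¹ num den {{R.₄F₃-denominator≢0 5/2ℚ 5/2ℚ 5/2ℚ n}} 0<den ⟩
    num * den ⁻¹                         ≡⟨ cong (_* den ⁻¹) num≡ ⟩
    27ℚ * summand n * den * den ⁻¹
      ≡⟨ linear₁ (27ℚ * summand n) (solve 3 (λ x d i → x :* d :* i :- x := x :* (d :* i :- con 1ℚ))
                                              refl (27ℚ * summand n) den (den ⁻¹)) (p*p⁻¹ 0<den) ⟩
    27ℚ * summand n                      ∎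
    where
    open ≡-Reasoning
    P T E g o i num den : ℚ
    P = pochhammer 1ℚ n
    T = pochhammer 3/2ℚ n
    E = pochhammer 5/2ℚ n
    g = fromℕ (n !)
    o = odd (suc n)
    i = o ⁻¹
    num = P * P * P * T
    den = R.₄F₃-denominator 5/2ℚ 5/2ℚ 5/2ℚ n
    _÷den : ℚ → ℚ
    x ÷den = (x ÷ den) {{R.₄F₃-denominator≢0 5/2ℚ 5/2ℚ 5/2ℚ n}}
    den≡ : den ≡ g * (T * o * ⅓ * (T * o * ⅓) * (T * o * ⅓))
    den≡ = cong₂ (λ x e → x * (e * e * e)) (sym (fromℕ≡/1 (n !))) (pochhammer-5/2 n)
    0<E : 0ℚ < T * o * ⅓
    0<E = 0<* (0<* (0<pochhammer-3/2 n) (0<odd (suc n))) (positive⁻¹ ⅓)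
    0<den : 0ℚ < den
    0<den = subst (0ℚ <_) (sym den≡) (0<* (0<fromℕ-! n) (0<* (0<* 0<E 0<E) 0<E))
    num≡ : num ≡ 27ℚ * summand n * den
    num≡ = begin
      P * P * P * T                    ≡⟨ cong (λ p → p * p * p * T) (pochhammer-1 n) ⟩
      g * g * g * T                    ≡⟨ cong (λ x → g * x * x * T) (sym (u*pochhammer-3/2 n)) ⟩
      g * (u n * T) * (u n * T) * T
        ≡⟨ linear₁ (- (g * T * T * T * (u n * u n) * (o * i * (o * i) + o * i + 1ℚ))) (solve 5 (λ g u t o i →
                                            g :* (u :* t) :* (u :* t) :* t
                                              :- con 27ℚ :* (u :* u :* (i :* i :* i)) :* (g :* (t :* o :* con ⅓ :* (t :* o :* con ⅓) :* (t :* o :* con ⅓)))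
                                            := (:- (g :* t :* t :* t :* (u :* u) :* (o :* i :* (o :* i) :+ o :* i :+ con 1ℚ))) :* (o :* i :- con 1ℚ))
                                            refl g (u n) T o i) (p*p⁻¹ (0<odd (suc n))) ⟩
      27ℚ * summand n * (g * (T * o * ⅓ * (T * o * ⅓) * (T * o * ⅓)))    ≡⟨ cong (27ℚ * summand n *_) (sym den≡) ⟩
      27ℚ * summand n * den            ∎

  -- The terms defining ζ(3), G and π

  1/[1+n]³ : ∀ n → (ℤ.+ 1 / suc n ℕ.^ 3) {{ℕₚ.m^n≢0 (suc n) 3}} ≡ recip n * recip n * recip n
  1/[1+n]³ n = trans (i/d≡i/1*d⁻¹ (ℤ.+ 1) (suc n ℕ.^ 3) {{ℕₚ.m^n≢0 (suc n) 3}}) (trans (*-identityˡ (fromℕ (suc n ℕ.^ 3) ⁻¹))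
    (sym (⁻¹-unique (0<fromℕ (suc n ℕ.^ 3) {{ℕₚ.m^n≢0 (suc n) 3}}) (trans (cong (_* (r * r * r)) cube)
      (linear₁ (N * r * (N * r) + N * r + 1ℚ) (solve 2 (λ n r → n :* (n :* n) :* (r :* r :* r) :- con 1ℚ
        := (n :* r :* (n :* r) :+ n :* r :+ con 1ℚ) :* (n :* r :- con 1ℚ)) refl N r) (p*p⁻¹ (0<1+fromℕ n)))))))
    where
    N r : ℚ
    N = fromℕ (suc n)
    r = recip n
    cube : fromℕ (suc n ℕ.^ 3) ≡ N * (N * N)
    cube = trans (fromℕ-* (suc n) (suc n ℕ.^ 2)) (cong (N *_) (fromℕ-^2 (suc n)))

  z/d² : ∀ z d .{{_ : ℕ.NonZero d}} → (z / d ℕ.^ 2) {{ℕₚ.m^n≢0 d 2}} ≡ z / 1 * (fromℕ d ⁻¹ * fromℕ d ⁻¹)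
  z/d² z d = trans (i/d≡i/1*d⁻¹ z (d ℕ.^ 2) {{ℕₚ.m^n≢0 d 2}}) (cong (z / 1 *_)
    (sym (⁻¹-unique (0<fromℕ (d ℕ.^ 2) {{ℕₚ.m^n≢0 d 2}}) (trans (cong (_* (r * r)) (fromℕ-^2 d))
      (linear₁ (N * r + 1ℚ) (solve 2 (λ n r → n :* n :* (r :* r) :- con 1ℚ := (n :* r :+ con 1ℚ) :* (n :* r :- con 1ℚ)) refl N r)
        (p*p⁻¹ (0<fromℕ d)))))))
    where
    N r : ℚ
    N = fromℕ d
    r = N ⁻¹

  -1^n≡sign : ∀ n → ℤ.-1ℤ ℤ.^ n / 1 ≡ sign n
  -1^n≡sign zero    = refl
  -1^n≡sign (suc n) = trans (cong (_/ 1) (ℤₚ.-1*i≡-i (ℤ.-1ℤ ℤ.^ n))) (trans (neg-/1 (ℤ.-1ℤ ℤ.^ n)) (cong -_ (-1^n≡sign n)))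
    where
    neg-/1 : ∀ i → (ℤ.- i) / 1 ≡ - (i / 1)
    neg-/1 (ℤ.+ zero)  = refl
    neg-/1 (ℤ.+ suc n) = refl
    neg-/1 ℤ.-[1+ n ]  = solve 1 (λ x → x := :- (:- x)) refl (ℤ.+ suc n / 1)

  catalanTerm : ∀ n → (ℤ.-1ℤ ℤ.^ n / (1 ℕ.+ 2 ℕ.* n) ℕ.^ 2) {{ℕₚ.m^n≢0 (1 ℕ.+ 2 ℕ.* n) 2}} ≡ sign n * q n
  catalanTerm n = trans (z/d² (ℤ.-1ℤ ℤ.^ n) (1 ℕ.+ 2 ℕ.* n))
    (cong₂ (λ x y → x * ((y + 1ℚ) ⁻¹ * (y + 1ℚ) ⁻¹)) (-1^n≡sign n) (fromℕ-2* n))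

  4cells/n² : ∀ k → (ℤ.+ (4 ℕ.* cellsInQuarterDisc (suc k)) / suc k ℕ.^ 2) {{ℕₚ.m^n≢0 (suc k) 2}} ≡ 4ℚ * area k
  4cells/n² k = trans (z/d² (ℤ.+ (4 ℕ.* cellsInQuarterDisc (suc k))) (suc k))
    (trans (cong (_* (recip k * recip k)) (trans (sym (fromℕ≡/1 (4 ℕ.* cellsInQuarterDisc (suc k)))) (fromℕ-* 4 (cellsInQuarterDisc (suc k)))))
           (*-assoc 4ℚ (fromℕ (cellsInQuarterDisc (suc k))) (recip k * recip k)))

  -- The first term, which tends to 3π/2, comes from Gosper summation.
  ∑summand : ∀ n → ∑ n summand ≡ u n * u n * (6ℚ * fromℕ n + 5ℚ) + X (suc n) - 6ℚ
  ∑summand zero    = sym (trans (cong (λ i → 1ℚ * 1ℚ * (6ℚ * 0ℚ + 5ℚ) + (0ℚ + 1ℚ * 1ℚ * i) - 6ℚ) 1⁻¹≡1) refl)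
  ∑summand (suc n) = trans
    (linear₂ 1ℚ (U * (6ℚ - 3ℚ * i))
      (solve 5 (λ S X u n i →
          S :+ u :* u :* (i :* i :* i)
            :- (u :* (con 1ℚ :- i) :* (u :* (con 1ℚ :- i)) :* (con 6ℚ :* (n :+ con 1ℚ) :+ con 5ℚ)
                :+ (X :+ u :* (con 1ℚ :- i) :* (u :* (con 1ℚ :- i)) :* i) :- con 6ℚ)
          := con 1ℚ :* (S :- (u :* u :* (con 6ℚ :* n :+ con 5ℚ) :+ X :- con 6ℚ))
             :+ u :* u :* (con 6ℚ :- con 3ℚ :* i) :* ((con 2ℚ :* (n :+ con 1ℚ) :+ con 1ℚ) :* i :- con 1ℚ))
        refl (∑ n summand) (X (suc n)) (u n) (fromℕ n) i)
      (∑summand n) (p*p⁻¹ (0<odd (suc n))))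
    (cong (λ w → w * w * (6ℚ * fromℕ (suc n) + 5ℚ) + (X (suc n) + w * w * i) - 6ℚ) (sym u′≡))
    where
    i U : ℚ
    i = odd (suc n) ⁻¹
    U = u n * u n
    -- Since 2n + 2 = (2n+3) - 1; the step then becomes a polynomial identity modulo (2n+3)i = 1.
    u′≡ : u (suc n) ≡ u n * (1ℚ - i)
    u′≡ = linear₂ i (u n - u (suc n))
      (solve 4 (λ u′ u n i → u′ :- u :* (con 1ℚ :- i) := i :* (u′ :* (con 2ℚ :* (n :+ con 1ℚ) :+ con 1ℚ) :- u :* (con 2ℚ :* (n :+ con 1ℚ)))
          :+ (u :- u′) :* ((con 2ℚ :* (n :+ con 1ℚ) :+ con 1ℚ) :* i :- con 1ℚ)) refl (u (suc n)) (u n) (fromℕ n) i)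
      (u-step n) (p*p⁻¹ (0<odd (suc n)))

  u²≈0 : (λ n → u n * u n) ≈ (λ _ → 0ℚ)
  u²≈0 = ≈-rate 1ℚ λ n → ≤-trans
    (≤-reflexive (trans (cong ∣_∣ (solve 1 (λ x → x :- con 0ℚ := x) refl (u n * u n))) (0≤p⇒∣p∣≡p (0≤square (u n)))))
    (≤-trans (u²≤recip n) (≤-reflexive (sym (*-identityˡ (recip n)))))

  -- The constants as reals and the closed form

  ζ3 G L : R.ℝ
  ζ3 = R.mkℝ cubes cubes-IsCauchy
  G = R.mkℝ catalan catalan-IsCauchy
  L = R.mkℝ leibniz leibniz-IsCauchy

  π closedForm : R.ℝ
  π = R.ι 4ℚ R.* L
  closedForm = R.ι 7ℚ R.* ζ3 R.+ (R.ι 3ℚ R.- R.ι 2ℚ R.* G) R.* π R.- R.ι (ℤ.+ 12 / 1)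

  -- With π = 4L the contributions are 6L = 3π/2 from the telescoped part, 7/2 ζ(3) - πG from `X`,
  -- and -6. The factor ½ turns 27 into 27/2.
  ∑summand≈½closedForm : (λ n → ∑ n summand) ≈ (λ n → ½ * R.seq closedForm n)
  ∑summand≈½closedForm = ≈-trans
    (≈-reflexive (λ n → trans (∑summand n) (solve 3 (λ U n X → U :* (con 6ℚ :* n :+ con 5ℚ) :+ X :- con 6ℚ
      := con 6ℚ :* ((n :+ con 1ℚ) :* U) :+ con (- 1ℚ) :* U :+ (X :+ con (- 6ℚ))) refl (u n * u n) (fromℕ n) (X (suc n)))))
    (≈-trans
      (≈-+ (≈-+ (≈-*ˡ 6ℚ wallis≈leibniz) (≈-*ˡ (- 1ℚ) u²≈0))
           (≈-+ (≈-trans (≈-shift X≈limit) (≈-subsequence limit limit-IsCauchy suc ℕₚ.n≤1+n)) (≈-refl {λ _ → - 6ℚ})))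
      (≈-reflexive (λ n → solve 3 (λ Z G L →
          con 6ℚ :* L :+ con (- 1ℚ) :* con 0ℚ :+ (con 4ℚ :* (con ⅞ :* Z :- G :* L) :+ con (- 6ℚ))
          := con ½ :* (con 7ℚ :* Z :+ (con 3ℚ :+ (:- (con 2ℚ :* G))) :* (con 4ℚ :* L) :+ (:- con (ℤ.+ 12 / 1))))
        refl (cubes n) (catalan n) (leibniz n))))

  S : R.ℝ
  S = R.mkℝ (λ n → ∑ n summand) (IsCauchy-resp-≈ ∑summand≈½closedForm (R.cauchy (R.ι ½ R.* closedForm)))

  -- As `t n` is a constant sequence, `p n` has to be compared with all late approximants of `x`.
  -- Passing through the n-th one, half of `ε` is paid by `p ≈ R.seq x` and half by the Cauchy
  -- property of `x`.
  ⟶-rational : ∀ (t : ℕ → R.ℝ) (p : ℕ → ℚ) (x : R.ℝ) → (∀ n k → R.seq (t n) k ≡ p n) → p ≈ R.seq x → t R.⟶ x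
  ⟶-rational t p x const p≈x ε 0<ε = N , λ n N≤n →
      (λ ε′ 0<ε′ → N , λ k N≤k → subst (λ z → R.seq x k - ε ≤ z + ε′) (sym (const n k))
        (≤-trans (gap⇒≤ (solve 3 (λ x p e → p :- (x :- e) := e :- (x :- p)) refl (R.seq x k) (p n) ε)
                        (≤⇒0≤gap (≤-trans (p≤∣p∣ (R.seq x k - p n)) (≤-trans (≤-reflexive (∣p-q∣≡∣q-p∣ (R.seq x k) (p n))) (close n k N≤n N≤k)))))
                 (p≤p+ε′ (p n) 0<ε′)))
    , (λ ε′ 0<ε′ → N , λ k N≤k → subst (λ z → z ≤ R.seq x k + ε + ε′) (sym (const n k))
        (≤-trans (gap⇒≤ (solve 3 (λ x p e → x :+ e :- p := e :- (p :- x)) refl (R.seq x k) (p n) ε)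
                        (≤⇒0≤gap (≤-trans (p≤∣p∣ (p n - R.seq x k)) (close n k N≤n N≤k))))
                 (p≤p+ε′ (R.seq x k + ε) 0<ε′)))
    where
    N₁ N₂ N : ℕ
    N₁ = proj₁ (eventually p≈x (½ * ε) (½ε 0<ε))
    N₂ = proj₁ (R.cauchy x (½ * ε) (½ε 0<ε))
    N = N₁ ℕ.⊔ N₂
    p≤p+ε′ : ∀ p {ε′} → 0ℚ < ε′ → p ≤ p + ε′
    p≤p+ε′ p {ε′} h = subst (_≤ p + ε′) (+-identityʳ p) (+-monoʳ-≤ p (<⇒≤ h))
    close : ∀ n k → N ℕ.≤ n → N ℕ.≤ k → ∣ p n - R.seq x k ∣ ≤ ε
    close n k N≤n N≤k = ≤-trans (∣p-r∣≤∣p-q∣+∣q-r∣ (p n) (R.seq x n) (R.seq x k))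
      (≤-trans (+-mono-≤ (proj₂ (eventually p≈x (½ * ε) (½ε 0<ε)) n (⊔≤⇒ˡ {N₁} {N₂} N≤n))
                         (proj₂ (R.cauchy x (½ * ε) (½ε 0<ε)) n k (⊔≤⇒ʳ {N₁} {N₂} N≤n) (⊔≤⇒ʳ {N₁} {N₂} N≤k)))
               (≤-reflexive (½ε+½ε ε)))

  hasSum : ∀ (b : ℕ → ℚ) (x : R.ℝ) → (λ n → ∑ n b) ≈ R.seq x → R.HasSum (λ n → R.ι (b n)) x
  hasSum b x = ⟶-rational (R.partialSum (λ n → R.ι (b n))) (λ n → ∑ n b) x partialSum-const
    where
    partialSum-const : ∀ n k → R.seq (R.partialSum (λ n → R.ι (b n)) n) k ≡ ∑ n b
    partialSum-const zero    k = refl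
    partialSum-const (suc n) k = cong (_+ b n) (partialSum-const n k)

  hasSum-≡ : ∀ (b : ℕ → ℚ) (x : R.ℝ) (c : ℕ → ℚ) → (∀ n → b n ≡ c n) → (∀ n → ∑ n c ≡ R.seq x n) →
    R.HasSum (λ n → R.ι (b n)) x
  hasSum-≡ b x c b≡c c≡x = hasSum b x (≈-reflexive (λ n → trans (∑-cong n (λ i _ → b≡c i)) (c≡x n)))

  F-isHypergeometric : R.Is₄F₃ 1ℚ 1ℚ 1ℚ (ℤ.+ 3 / 2) (ℤ.+ 5 / 2) (ℤ.+ 5 / 2) (ℤ.+ 5 / 2) 1ℚ (R.ι 27ℚ R.* S)
  F-isHypergeometric = hasSum-≡ hypergeometricTerm (R.ι 27ℚ R.* S) (λ n → 27ℚ * summand n) hypergeometricTerm≡27*summand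
    (λ n → ∑-*ˡ n 27ℚ summand)

  S-isSum : R.HasSum (λ n → R.ι (centralTerm n)) S
  S-isSum = hasSum-≡ centralTerm S summand centralTerm≡summand (λ _ → refl)

  ζ3-isζ3 : R.Isζ3 ζ3
  ζ3-isζ3 = hasSum-≡ _ ζ3 (λ n → recip n * recip n * recip n) 1/[1+n]³ (λ _ → refl)

  G-isCatalan : R.IsCatalan G
  G-isCatalan = hasSum-≡ _ G (λ n → sign n * q n) catalanTerm (λ _ → refl)

  π-isπ : R.Isπ π
  π-isπ = ⟶-rational (λ k → R.ι ((ℤ.+ (4 ℕ.* cellsInQuarterDisc (suc k)) / suc k ℕ.^ 2) {{ℕₚ.m^n≢0 (suc k) 2}}))
    (λ k → 4ℚ * area k) π (λ k _ → 4cells/n² k) (≈-*ˡ 4ℚ area≈leibniz)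

  F≃27S : R.ι 27ℚ R.* S R.≃ R.ι 27ℚ R.* S
  F≃27S = eventually (≈-refl {R.seq (R.ι 27ℚ R.* S)})

  27S≃closedForm : R.ι 27ℚ R.* S R.≃ R.ι (ℤ.+ 27 / 2) R.* closedForm
  27S≃closedForm = eventually (≈-trans (≈-*ˡ 27ℚ ∑summand≈½closedForm)
    (≈-reflexive (λ n → solve 1 (λ x → con 27ℚ :* (con ½ :* x) := con (ℤ.+ 27 / 2) :* x) refl (R.seq closedForm n))))

open import Defs
open import Data.Integer using (+_)
open import Data.Rational using (1ℚ; _/_)

theorem1 : ∃[ F ] ∃[ S ] ∃[ ζ3 ] ∃[ G ] ∃[ π ]
    ( Is₄F₃ 1ℚ 1ℚ 1ℚ (+ 3 / 2) (+ 5 / 2) (+ 5 / 2) (+ 5 / 2) 1ℚ F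
    × HasSum (λ n → ι (centralTerm n)) S
    × Isζ3 ζ3
    × IsCatalan G
    × Isπ π
    × F ≃ ι (+ 27 / 1) * S
    × ι (+ 27 / 1) * S
    ≃ ι (+ 27 / 2) *
    (ι (+ 7 / 1) * ζ3 + (ι (+ 3 / 1) - ι (+ 2 / 1) * G) * π - ι (+ 12 / 1)) )
-- The hypergeometric value is taken to be 27·S itself, so the content of the first identity lies in
-- `F-isHypergeometric`.
theorem1 = ι (+ 27 / 1) * S , S , ζ3 , G , π
  , F-isHypergeometric , S-isSum , ζ3-isζ3 , G-isCatalan , π-isπ , F≃27S , 27S≃closedForm
  where open Series
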